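{- Let $q$ be a prime power and $m$ a positive integer with $\gcd(m,q)=1$. Then $C'(m,q)\cong\Sigma(m,q)$ and $C'(m,q)/\langle X\rangle\cong S(m,q)$.
   Context: $X$ is the $m\times m$ matrix over $\mathbb{F}_q$ of multiplication by $x$ on $\mathbb{F}_q[x]/(x^m-1)$ in the basis $1,x,\dots,x^{m-1}$ (an $m$-cycle permutation matrix); $C(m,q)$ is the group of units of the algebra $\mathbb{F}_q[X]$ of circulant matrices, and $C'(m,q)=\{C\in C(m,q): C\mathbf 1=\mathbf 1\}$ with $\mathbf 1$ the all-ones vector; equivalently $C'(m,q)$ is the group of residues $a(x)\in\mathbb{F}_q[x]/(x^m-1)$ with $\gcd(a,x^m-1)=1$ and $a(1)=1$, and $\langle X\rangle$ corresponds to $\langle x\rangle$. In $\mathbb{Q}[x]/(x^m-1)$ (exponents mod $m$) put $e_v=x^v-1$, $\epsilon_v=q\,e_v-e_{qv}$; $\mathcal Z_m$ = $\mathbb{Z}$-span of $e_1,\dots,e_{m-1}$, $\mathcal E_{m,q}$ = $\mathbb{Z}$-span of $\epsilon_1,\dots,\epsilon_{m-1}$, $\Sigma(m,q)=\mathcal Z_m/\mathcal E_{m,q}$; with $f_v=qx^v-\sum_{i=0}^{q-1}x^{qv+i}$, $S(m,q)=\mathcal Z_m/\langle f_1,\dots,f_{m-1}\rangle_{\mathbb{Z}}$ (the sandpile group of the generalized de Bruijn graph on $\mathbb{Z}_m$ with arcs $v\to qv+i$, $0\le i\le q-1$). -}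

module Defs where

open import Level using (Level; _⊔_)
open import Data.Nat as ℕ using (ℕ; zero; suc; NonZero; _%_; _^_)
open import Data.Nat.Primality using (Prime)
open import Data.Integer as ℤ using (ℤ)
open import Data.Fin using (Fin; toℕ)
import Data.Fin as Fin
open import Data.List using (List; foldr; upTo; map; drop)
open import Data.Product using (Σ; ∃; ∃-syntax; _×_; _,_)
open import Data.Bool using (if_then_else_)
open import Relation.Nullary using (¬_)
open import Relation.Nullary.Decidable using (⌊_⌋)
open import Relation.Binary.PropositionalEquality using (_≡_; _≗_)
open import Algebra.Bundles using (CommutativeRing)

IsPrimePower : ℕ → Set
IsPrimePower q = ∃[ p ] ∃[ k ] (Prime p × (k ℕ.≥ 1) × q ≡ p ^ k)

module FinSum {a} {A : Set a} (_+_ : A → A → A) (0a : A) where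
  sumFin : ∀ {n} → (Fin n → A) → A
  sumFin {zero}  f = 0a
  sumFin {suc n} f = f Fin.zero + sumFin (λ i → f (Fin.suc i))

-- Field side: F[x]/(x^m - 1), elements = coefficient vectors Fin m → F
-- (coefficient of x^j at index j).

IsField : ∀ {c ℓ} → CommutativeRing c ℓ → Set (c ⊔ ℓ)
IsField R = ¬ (1# ≈ 0#) × (∀ a → ¬ (a ≈ 0#) → ∃[ b ] (a * b ≈ 1#))
  where open CommutativeRing R

module Circulant {c ℓ} (R : CommutativeRing c ℓ) (m : ℕ) .{{_ : NonZero m}} where
  open CommutativeRing R
  open FinSum _+_ 0# public

  infix 4 _≈P_ _≈X_
  infixl 7 _*P_

  Poly : Set c
  Poly = Fin m → Carrier

  _≈P_ : Poly → Poly → Set ℓ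
  a ≈P b = ∀ j → a j ≈ b j

  xpow : ℕ → Poly
  xpow k j = if ⌊ toℕ j ℕ.≟ k % m ⌋ then 1# else 0#

  1P : Poly
  1P = xpow 0

  _*P_ : Poly → Poly → Poly
  (a *P b) k = sumFin λ i → sumFin λ j → (a i * b j) * xpow (toℕ i ℕ.+ toℕ j) k

  -- a(1) = sum of the coefficients (= row sum of the circulant matrix)
  eval1 : Poly → Carrier
  eval1 a = sumFin a

  -- a is a unit of the algebra F[X] ≅ F[x]/(x^m - 1)
  IsUnit : Poly → Set (c ⊔ ℓ)
  IsUnit a = ∃[ b ] (a *P b ≈P 1P)

  -- membership in C'(m,q): unit with a(1) = 1 (i.e. C 1 = 1)
  InC' : Poly → Set (c ⊔ ℓ)
  InC' a = IsUnit a × (eval1 a ≈ 1#)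

  _≈X_ : Poly → Poly → Set ℓ
  a ≈X b = ∃[ k ] (a ≈P (b *P xpow k))

-- Integer side: ℤ[x]/(x^m - 1) ⊂ ℚ[x]/(x^m - 1), vectors Fin m → ℤ.

module IntLattice (m q : ℕ) .{{_ : NonZero m}} where

  infix 4 _≈Σ_ _≈S_
  infixl 6 _+Z_ _-Z_
  infixr 7 _·Z_

  ZVec : Set
  ZVec = Fin m → ℤ

  _+Z_ : ZVec → ZVec → ZVec
  (z +Z w) j = z j ℤ.+ w j

  _-Z_ : ZVec → ZVec → ZVec
  (z -Z w) j = z j ℤ.- w j

  _·Z_ : ℤ → ZVec → ZVec
  (n ·Z z) j = n ℤ.* z j

  0Z : ZVec
  0Z j = ℤ.0ℤ

  mono : ℕ → ZVec
  mono k j = if ⌊ toℕ j ℕ.≟ k % m ⌋ then ℤ.1ℤ else ℤ.0ℤ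

  sumL : List ℕ → (ℕ → ZVec) → ZVec
  sumL vs g = foldr (λ v acc → g v +Z acc) 0Z vs

  range1 : List ℕ
  range1 = drop 1 (upTo m)

  InSpan : (ℕ → ZVec) → ZVec → Set
  InSpan g z = Σ (ℕ → ℤ) λ c → z ≗ sumL range1 (λ v → c v ·Z g v)

  e : ℕ → ZVec
  e v = mono v -Z mono 0

  ε : ℕ → ZVec
  ε v = (ℤ.+ q ·Z e v) -Z e (q ℕ.* v)

  f : ℕ → ZVec
  f v = (ℤ.+ q ·Z mono v) -Z sumL (upTo q) (λ i → mono (q ℕ.* v ℕ.+ i))

  InZ : ZVec → Set
  InZ = InSpan e

  -- equality in Σ(m,q) = 𝒵_m / ℰ_{m,q}
  _≈Σ_ : ZVec → ZVec → Set
  z ≈Σ w = InSpan ε (z -Z w)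

  -- equality in S(m,q) = 𝒵_m / ⟨f_1,…,f_{m-1}⟩
  _≈S_ : ZVec → ZVec → Set
  z ≈S w = InSpan f (z -Z w)

-- Isomorphism of a subgroup-presented group (carrier: elements of Poly
-- satisfying P, equality ≈₁, product *₁) with a quotient of 𝒵_m
-- (elements satisfying InZ, equality ≈₂, sum +₂): a well-defined, bijective
-- homomorphism φ.
record IsoVia {a b ℓ₁ ℓ₂ p} {A : Set a} {B : Set b}
              (P : A → Set p) (_≈₁_ : A → A → Set ℓ₁) (_*₁_ : A → A → A)
              (Q : B → Set) (_≈₂_ : B → B → Set ℓ₂) (_+₂_ : B → B → B)
              (φ : A → B) : Set (a ⊔ b ⊔ ℓ₁ ⊔ ℓ₂ ⊔ p) where
  field
    into       : ∀ x → P x → Q (φ x)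
    cong       : ∀ x y → P x → P y → x ≈₁ y → φ x ≈₂ φ y
    homo       : ∀ x y → P x → P y → φ (x *₁ y) ≈₂ (φ x +₂ φ y)
    injective  : ∀ x y → P x → P y → φ x ≈₂ φ y → x ≈₁ y
    surjective : ∀ z → Q z → ∃[ x ] (P x × φ x ≈₂ z)

Isomorphic : ∀ {a b ℓ₁ ℓ₂ p} {A : Set a} {B : Set b}
             (P : A → Set p) (_≈₁_ : A → A → Set ℓ₁) (_*₁_ : A → A → A)
             (Q : B → Set) (_≈₂_ : B → B → Set ℓ₂) (_+₂_ : B → B → B) →
             Set (a ⊔ b ⊔ ℓ₁ ⊔ ℓ₂ ⊔ p)
Isomorphic P _≈₁_ _*₁_ Q _≈₂_ _+₂_ = ∃[ φ ] IsoVia P _≈₁_ _*₁_ Q _≈₂_ _+₂_ φ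

{-# OPTIONS --safe #-}
module Submission where

-- Let K be an extension of F with an element g of order M = q^d - 1, where m ∣ M, and ω = g^(M/m). A residue a(x)
-- is determined by its values a(ω^v), and these values arise from some a exactly when a(ω^(qv)) = a(ω^v)^q. Taking
-- logarithms to base g therefore identifies C' with Hom(Σ(m,q), ℤ/M), x becoming the homomorphism e_v ↦ v M/m. The
-- kernel of that homomorphism is (x - 1) 𝒵_m / ℰ_{m,q} ≅ S(m,q), because (x - 1) f_v = ε_{v+1} - ε_v, so restriction
-- identifies C'/⟨x⟩ with Hom(S(m,q), ℤ/M). Finally a finite quotient of ℤⁿ killed by M is (non-canonically)
-- isomorphic to its dual, since an integer matrix is equivalent to its transpose.
--
-- K is a residue field of F[x]/(x^M - 1), in which a^(M+1) = a, at a point where ∏ (x^(M/p) - 1) ≠ 0 over the primes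
-- p ∣ M.

open import Data.Nat as ℕ using (zero; suc; ℕ; NonZero; _%_; _∸_)
open import Data.Fin as Fin using (Fin; zero; suc; toℕ; fromℕ; finToFun; funToFin; fromℕ<)
open import Relation.Nullary using (¬_; yes; no; contradiction; Dec)
open import Function using (_∘_; id)
open import Algebra.Bundles using (CommutativeMonoid; CommutativeSemiring; CommutativeRing; AbelianGroup; Semiring)
open import Defs
open import Algebra.Morphism.Structures using (IsSemiringHomomorphism)
open import Data.Sum using (inj₁; inj₂; _⊎_)
open import Function.Bundles using (Bijection)
import Data.Fin.Properties as Finₚ
import Data.Fin.Permutation as Perm
import Algebra.Properties.CommutativeMonoid.Sum as MonoidSum
import Data.Integer.Properties as ℤₚ
import Data.Integer.DivMod as ℤ÷
import Data.Nat.Divisibility as ℕ∣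
import Data.Nat.Properties as ℕₚ
import Algebra.Morphism.Construct.Identity as Identity
import Algebra.Construct.Pointwise as Pointwise
import Algebra.Properties.Semiring.Exp as Exp
import Algebra.Properties.Semiring.Mult as Mult
import Relation.Binary.Reasoning.Setoid as SetoidReasoning
import Algebra.Properties.CommutativeSemiring.Binomial as Binomial
import Algebra.Properties.CommutativeSemigroup as CSemigroup
import Algebra.Properties.Ring as RingProperties
import Data.Nat.DivMod as ℕ÷
import Algebra.Properties.CommutativeSemiring.Exp as CExp
import Data.Integer.Divisibility.Signed as ℤ∣
import Data.Nat.Tactic.RingSolver as ℕ-Solver

-- Logarithms produce a dual group, with values in ℤ/M, whereas a quotient of the lattice is asked
-- for. No canonical map joins the two, so a choice is unavoidable: here it is a pair of
-- automorphisms with B(x, y) = B(γ y, α x), where B is the matrix of relations. In this bilinear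
-- form the property is stable under column operations and transposition, so Euclidean reduction
-- proves it. Σ and S are then two instances of one lemma about relations killed by M. The exponent
-- comes from q^d ≡ 1 modulo m, which exists by coprimality. It serves twice: q^d e_v ≡ e_w with w =
-- q^d v ≡ v shows that M kills Σ, and 1 + M = q^d is 0 in K, so that M is -1 there, m is invertible
-- and Fourier inversion over the m-th roots of unity is available. Counting the roots of
-- polynomials is replaced by finite means throughout: geometric sums at roots of unity, the
-- pigeonhole principle and exhaustive search. In the same spirit K arises from a search among
-- idempotents, since a^(M+1) = a makes every a^M idempotent, and not from an irreducible
-- polynomial.

-- Finite sums in commutative monoids and semirings.

module Sums where

  open import Relation.Binary.PropositionalEquality as ≡ using (_≡_)

  -- Opaque, so that summands can be inferred from the sums.
  module MonoidSums {c ℓ} (M : CommutativeMonoid c ℓ) where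
    open CommutativeMonoid M
    private module S = MonoidSum M

    opaque
      ∑ : ∀ {n} → (Fin n → Carrier) → Carrier
      ∑ = S.sum

      ∑-empty : (t : Fin 0 → Carrier) → ∑ t ≈ ε
      ∑-empty t = refl

      ∑-suc : ∀ {n} (t : Fin (suc n) → Carrier) → ∑ t ≈ t zero ∙ ∑ (t ∘ suc)
      ∑-suc t = refl

      ∑-cong : ∀ {n} {s t : Fin n → Carrier} → (∀ i → s i ≈ t i) → ∑ s ≈ ∑ t
      ∑-cong = S.sum-cong-≋

      ∑-∙ : ∀ {n} (s t : Fin n → Carrier) → ∑ (λ i → s i ∙ t i) ≈ ∑ s ∙ ∑ t
      ∑-∙ = S.∑-distrib-+

      ∑-swap : ∀ {m n} (t : Fin m → Fin n → Carrier) → ∑ (λ i → ∑ (t i)) ≈ ∑ (λ j → ∑ λ i → t i j)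
      ∑-swap = S.∑-comm

      ∑-permute : ∀ {n} (t : Fin n → Carrier) (π : Perm.Permutation n n) → ∑ t ≈ ∑ (λ i → t (π Perm.⟨$⟩ʳ i))
      ∑-permute = S.∑-permute

      ∑-replicate-ε : ∀ n → ∑ {n} (λ _ → ε) ≈ ε
      ∑-replicate-ε = S.sum-replicate-zero

      ∑≈sum : ∀ {n} (t : Fin n → Carrier) → ∑ t ≈ S.sum t
      ∑≈sum t = refl

      sumFin≈∑ : ∀ {n} (t : Fin n → Carrier) → FinSum.sumFin _∙_ ε t ≈ ∑ t
      sumFin≈∑ {zero} t = refl
      sumFin≈∑ {suc n} t = ∙-congˡ (sumFin≈∑ (t ∘ suc))

    ∑-zero : ∀ {n} {t : Fin n → Carrier} → (∀ i → t i ≈ ε) → ∑ t ≈ ε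
    ∑-zero p = trans (∑-cong p) (∑-replicate-ε _)

    ∑-single : ∀ {n} (k : Fin n) {t : Fin n → Carrier} → (∀ i → ¬ i ≡ k → t i ≈ ε) → ∑ t ≈ t k
    ∑-single zero {t} p = trans (∑-suc t) (trans (∙-congˡ (∑-zero λ i → p (suc i) λ ())) (identityʳ _))
    ∑-single (suc k) {t} p = trans (∑-suc t) (trans
      (∙-cong (p zero λ ()) (∑-single k λ i i≢k → p (suc i) (i≢k ∘ Finₚ.suc-injective))) (identityˡ _))

  module FiniteSums {c ℓ} (R : CommutativeSemiring c ℓ) where
    open CommutativeSemiring R hiding (zero)
    open MonoidSums +-commutativeMonoid public renaming (∑-∙ to ∑-+)

    ∑-*ˡ : ∀ {n} x (t : Fin n → Carrier) → x * ∑ t ≈ ∑ (λ i → x * t i)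
    ∑-*ˡ {zero} x t = trans (*-congˡ (∑-empty t)) (trans (zeroʳ x) (sym (∑-empty _)))
    ∑-*ˡ {suc n} x t = trans (*-congˡ (∑-suc t)) (trans (distribˡ x _ _)
      (trans (+-congˡ (∑-*ˡ x (t ∘ suc))) (sym (∑-suc _))))

    ∑-*ʳ : ∀ {n} x (t : Fin n → Carrier) → ∑ t * x ≈ ∑ (λ i → t i * x)
    ∑-*ʳ x t = trans (*-comm _ x) (trans (∑-*ˡ x t) (∑-cong λ i → *-comm x (t i)))

-- Equivalence of a square integer matrix with its transpose.

module SelfTransposition where

  open import Data.Nat.Induction using (<-wellFounded)
  open import Induction.WellFounded using (Acc; acc)
  open import Data.Integer as ℤ using (ℤ; 0ℤ; +_; ∣_∣; _+_; _*_; -_; _-_)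
  open import Data.Integer.Divisibility.Signed using (_∣_; divides; _∣?_)
  open import Data.Integer.Tactic.RingSolver using (solve-∀)
  open import Data.Product using (Σ; _,_)
  open import Relation.Binary.PropositionalEquality
  open Sums

  module ℤΣ = FiniteSums (CommutativeRing.commutativeSemiring ℤₚ.+-*-commutativeRing)
  open ℤΣ

  ℤ^ : ℕ → Set
  ℤ^ n = Fin n → ℤ

  -- GL_n(ℤ), kept as mutually inverse linear maps rather than as matrices, so that composites and
  -- inverses come without matrix products or determinants. Linearity of `from` follows from that of
  -- `to`.
  record Automorphism (n : ℕ) : Set where
    field
      to : ℤ^ n → ℤ^ n
      from : ℤ^ n → ℤ^ n
      to-cong : ∀ {x y} → x ≗ y → to x ≗ to y
      from-cong : ∀ {x y} → x ≗ y → from x ≗ from y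
      to-+ : ∀ x y → to (λ i → x i + y i) ≗ λ i → to x i + to y i
      to-* : ∀ a x → to (λ i → a * x i) ≗ λ i → a * to x i
      to-from : ∀ x → to (from x) ≗ x
      from-to : ∀ x → from (to x) ≗ x
  open Automorphism

  from-+ : ∀ {n} (U : Automorphism n) x y → from U (λ i → x i + y i) ≗ λ i → from U x i + from U y i
  from-+ U x y i = trans
    (from-cong U (λ j → sym (trans (to-+ U (from U x) (from U y) j) (cong₂ _+_ (to-from U x j) (to-from U y j)))) i)
    (from-to U _ i)

  from-* : ∀ {n} (U : Automorphism n) a x → from U (λ i → a * x i) ≗ λ i → a * from U x i
  from-* U a x i = trans
    (from-cong U (λ j → sym (trans (to-* U a (from U x) j) (cong (a *_) (to-from U x j)))) i)
    (from-to U _ i)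

  _⁻¹ᴬ : ∀ {n} → Automorphism n → Automorphism n
  U ⁻¹ᴬ = record
    { to = from U ; from = to U ; to-cong = from-cong U ; from-cong = to-cong U
    ; to-+ = from-+ U ; to-* = from-* U ; to-from = from-to U ; from-to = to-from U }

  _∘ᴬ_ : ∀ {n} → Automorphism n → Automorphism n → Automorphism n
  U ∘ᴬ V = record
    { to = to U ∘ to V ; from = from V ∘ from U
    ; to-cong = to-cong U ∘ to-cong V ; from-cong = from-cong V ∘ from-cong U
    ; to-+ = λ x y i → trans (to-cong U (to-+ V x y) i) (to-+ U _ _ i)
    ; to-* = λ a x i → trans (to-cong U (to-* V a x) i) (to-* U a _ i)
    ; to-from = λ x i → trans (to-cong U (to-from V _) i) (to-from U x i)
    ; from-to = λ x i → trans (from-cong V (from-to U _) i) (from-to V x i) }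

  idᴬ : ∀ {n} → Automorphism n
  idᴬ = record
    { to = λ x → x ; from = λ x → x ; to-cong = λ p → p ; from-cong = λ p → p
    ; to-+ = λ _ _ _ → refl ; to-* = λ _ _ _ → refl ; to-from = λ _ _ → refl ; from-to = λ _ _ → refl }

  infixr 5 _∷ᵛ_
  _∷ᵛ_ : ∀ {n} → ℤ → ℤ^ n → ℤ^ (suc n)
  (a ∷ᵛ x) zero = a
  (a ∷ᵛ x) (suc i) = x i

  extend : ∀ {n} → Automorphism n → Automorphism (suc n)
  extend U = record
    { to = λ x → x zero ∷ᵛ to U (x ∘ suc) ; from = λ x → x zero ∷ᵛ from U (x ∘ suc)
    ; to-cong = λ { p zero → p zero ; p (suc i) → to-cong U (p ∘ suc) i }
    ; from-cong = λ { p zero → p zero ; p (suc i) → from-cong U (p ∘ suc) i }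
    ; to-+ = λ { x y zero → refl ; x y (suc i) → to-+ U _ _ i }
    ; to-* = λ { a x zero → refl ; a x (suc i) → to-* U a _ i }
    ; to-from = λ { x zero → refl ; x (suc i) → to-from U _ i }
    ; from-to = λ { x zero → refl ; x (suc i) → from-to U _ i } }

  opaque
    dot : ∀ {n} → ℤ^ n → ℤ^ n → ℤ
    dot x y = ∑ λ i → x i * y i

    dot-∑ : ∀ {n} (x y : ℤ^ n) → dot x y ≡ ∑ (λ i → x i * y i)
    dot-∑ x y = refl

  dot-suc : ∀ {n} (x y : ℤ^ (suc n)) → dot x y ≡ x zero * y zero + dot (x ∘ suc) (y ∘ suc)
  dot-suc x y = trans (dot-∑ x y) (trans (∑-suc _) (cong (λ t → x zero * y zero + t) (sym (dot-∑ (x ∘ suc) (y ∘ suc)))))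

  dot-cong : ∀ {n} {x x′ y y′ : ℤ^ n} → x ≗ x′ → y ≗ y′ → dot x y ≡ dot x′ y′
  dot-cong p q = trans (dot-∑ _ _) (trans (∑-cong λ i → cong₂ _*_ (p i) (q i)) (sym (dot-∑ _ _)))

  dot-congʳ : ∀ {n} (x : ℤ^ n) {y y′ : ℤ^ n} → y ≗ y′ → dot x y ≡ dot x y′
  dot-congʳ x = dot-cong {x = x} λ _ → refl

  dot-+ʳ : ∀ {n} (x y z : ℤ^ n) → dot x (λ i → y i + z i) ≡ dot x y + dot x z
  dot-+ʳ x y z = trans (dot-∑ _ _) (trans (∑-cong λ i → ℤₚ.*-distribˡ-+ (x i) (y i) (z i))
    (trans (∑-+ (λ i → x i * y i) (λ i → x i * z i)) (sym (cong₂ _+_ (dot-∑ x y) (dot-∑ x z)))))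

  dot-*ʳ : ∀ {n} a (x y : ℤ^ n) → dot x (λ i → a * y i) ≡ a * dot x y
  dot-*ʳ a x y = trans (dot-∑ _ _) (trans (∑-cong λ i → rearrange (x i) a (y i))
    (trans (sym (∑-*ˡ a (λ i → x i * y i))) (cong (a *_) (sym (dot-∑ x y)))))
    where
    rearrange : ∀ x a y → x * (a * y) ≡ a * (x * y)
    rearrange = solve-∀

  dot-comm : ∀ {n} (x y : ℤ^ n) → dot x y ≡ dot y x
  dot-comm x y = trans (dot-∑ x y) (trans (∑-cong λ i → ℤₚ.*-comm (x i) (y i)) (sym (dot-∑ y x)))

  dot-zeroˡ : ∀ {n} (x y : ℤ^ n) → (∀ i → x i ≡ 0ℤ) → dot x y ≡ 0ℤ
  dot-zeroˡ x y p = trans (dot-∑ x y) (∑-zero λ i → cong (_* y i) (p i))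

  -- An elementary operation: acting on column vectors it changes only coordinate 0, so acting on a
  -- matrix from the right it adds c j times column 0 to column j + 1.
  shear : ∀ {n} → ℤ^ n → Automorphism (suc n)
  shear c = record
    { to = λ x → (x zero + dot c (x ∘ suc)) ∷ᵛ (x ∘ suc)
    ; from = λ x → (x zero - dot c (x ∘ suc)) ∷ᵛ (x ∘ suc)
    ; to-cong = λ { p zero → cong₂ _+_ (p zero) (dot-congʳ c (p ∘ suc)) ; p (suc i) → p (suc i) }
    ; from-cong = λ { p zero → cong₂ _-_ (p zero) (dot-congʳ c (p ∘ suc)) ; p (suc i) → p (suc i) }
    ; to-+ = λ { x y zero → trans (cong (λ t → x zero + y zero + t) (dot-+ʳ c _ _)) (interchange (x zero) (y zero) _ _)
               ; x y (suc i) → refl }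
    ; to-* = λ { a x zero → trans (cong (λ t → a * x zero + t) (dot-*ʳ a c _)) (sym (ℤₚ.*-distribˡ-+ a (x zero) _))
               ; a x (suc i) → refl }
    ; to-from = λ { x zero → cancel (x zero) _ ; x (suc i) → refl }
    ; from-to = λ { x zero → cancel′ (x zero) _ ; x (suc i) → refl } }
    where
    interchange : ∀ a b s t → a + b + (s + t) ≡ a + s + (b + t)
    interchange = solve-∀
    cancel : ∀ a s → a - s + s ≡ a
    cancel = solve-∀
    cancel′ : ∀ a s → a + s - s ≡ a
    cancel′ = solve-∀

  permute : ∀ {n} → Perm.Permutation n n → Automorphism n
  permute π = record
    { to = λ x → x ∘ (π Perm.⟨$⟩ʳ_) ; from = λ x → x ∘ (π Perm.⟨$⟩ˡ_)
    ; to-cong = λ p i → p _ ; from-cong = λ p i → p _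
    ; to-+ = λ _ _ _ → refl ; to-* = λ _ _ _ → refl ; to-from = λ x i → cong x (Perm.inverseˡ π) ; from-to = λ x i → cong x (Perm.inverseʳ π) }

  Matrix : ℕ → Set
  Matrix n = Fin n → Fin n → ℤ

  _ᵀ : ∀ {n} → Matrix n → Matrix n
  (B ᵀ) i j = B j i

  opaque
    bilinear : ∀ {n} → Matrix n → ℤ^ n → ℤ^ n → ℤ
    bilinear B x y = dot x (λ i → dot (B i) y)

    bilinear-dot : ∀ {n} (B : Matrix n) x y → bilinear B x y ≡ dot x (λ i → dot (B i) y)
    bilinear-dot B x y = refl

    bilinear-cong : ∀ {n} (B : Matrix n) {x x′ y y′} → x ≗ x′ → y ≗ y′ → bilinear B x y ≡ bilinear B x′ y′
    bilinear-cong B p q = dot-cong p λ i → dot-congʳ (B i) q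

    bilinear-ᵀ : ∀ {n} (B : Matrix n) x y → bilinear B x y ≡ bilinear (B ᵀ) y x
    bilinear-ᵀ {n} B x y = begin
      dot x (λ i → dot (B i) y) ≡⟨ expand B x y ⟩
      ∑ (λ i → ∑ (λ j → x i * (B i j * y j))) ≡⟨ ∑-swap (λ i j → x i * (B i j * y j)) ⟩
      ∑ (λ j → ∑ (λ i → x i * (B i j * y j))) ≡⟨ ∑-cong (λ j → ∑-cong λ i → rotate (x i) (B i j) (y j)) ⟩
      ∑ (λ j → ∑ (λ i → y j * (B i j * x i))) ≡⟨ expand (B ᵀ) y x ⟨
      dot y (λ j → dot ((B ᵀ) j) x) ∎
      where
      open ≡-Reasoning
      rotate : ∀ a b c → a * (b * c) ≡ c * (b * a)
      rotate = solve-∀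
      expand : ∀ (B : Matrix n) x y → dot x (λ i → dot (B i) y) ≡ ∑ (λ i → ∑ (λ j → x i * (B i j * y j)))
      expand B x y = trans (dot-∑ _ _) (∑-cong λ i →
        trans (cong (x i *_) (dot-∑ (B i) y)) (∑-*ˡ (x i) (λ j → B i j * y j)))

  bilinear-row : ∀ {n} (B B′ : Matrix n) x {y y′} → (∀ i → dot (B i) y ≡ dot (B′ i) y′) →
    bilinear B x y ≡ bilinear B′ x y′
  bilinear-row B B′ x p = trans (bilinear-dot B x _) (trans (dot-congʳ x p) (sym (bilinear-dot B′ x _)))

  -- In matrix terms: B and its transpose are equivalent over ℤ.
  SelfTranspose : ∀ {n} → Matrix n → Set
  SelfTranspose {n} B = Σ (Automorphism n) λ γ → Σ (Automorphism n) λ α →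
    ∀ x y → bilinear B x y ≡ bilinear B (to γ y) (to α x)

  -- Transposing swaps the two arguments of the form, hence the roles of γ and α. This turns every
  -- column operation below into a row operation as well.
  selfTranspose-ᵀ : ∀ {n} (B : Matrix n) → SelfTranspose (B ᵀ) → SelfTranspose B
  selfTranspose-ᵀ B (γ , α , p) = α , γ , λ x y →
    trans (bilinear-ᵀ B x y) (trans (p y x) (sym (bilinear-ᵀ B _ _)))

  -- With B V = B′ the change of columns is absorbed on both sides, as V⁻¹ in γ and as V in α.
  selfTranspose-column : ∀ {n} (B B′ : Matrix n) (V : Automorphism n) →
    (∀ i y → dot (B i) (to V y) ≡ dot (B′ i) y) → SelfTranspose B′ → SelfTranspose B
  selfTranspose-column B B′ V BV≡B′ (γ , α , p) = γ ∘ᴬ (V ⁻¹ᴬ) , V ∘ᴬ α , λ x y → begin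
    bilinear B x y ≡⟨ bilinear-cong B (λ _ → refl) (λ i → sym (to-from V y i)) ⟩
    bilinear B x (to V (from V y)) ≡⟨ bilinear-row B B′ x (λ i → BV≡B′ i _) ⟩
    bilinear B′ x (from V y) ≡⟨ p x _ ⟩
    bilinear B′ (to γ (from V y)) (to α x) ≡⟨ bilinear-row B B′ _ (λ i → BV≡B′ i _) ⟨
    bilinear B (to γ (from V y)) (to V (to α x)) ∎
    where open ≡-Reasoning

  shearRow : ∀ {n} → ℤ^ n → ℤ^ (suc n) → ℤ^ (suc n)
  shearRow c r = r zero ∷ᵛ λ j → r (suc j) + r zero * c j

  dot-shear : ∀ {n} (c : ℤ^ n) r y → dot r (to (shear c) y) ≡ dot (shearRow c r) y
  dot-shear c r y = begin
    dot r (to (shear c) y)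
      ≡⟨ dot-suc r _ ⟩
    r zero * (y zero + dot c y′) + dot r′ y′
      ≡⟨ expand (r zero) (y zero) ⟩
    r zero * y zero + (dot y′ r′ + r zero * dot y′ c)
      ≡⟨ cong (λ t → r zero * y zero + (dot y′ r′ + t)) (dot-*ʳ (r zero) y′ c) ⟨
    r zero * y zero + (dot y′ r′ + dot y′ (λ j → r zero * c j))
      ≡⟨ cong (λ t → r zero * y zero + t) (dot-+ʳ y′ r′ (λ j → r zero * c j)) ⟨
    r zero * y zero + dot y′ (λ j → r′ j + r zero * c j)
      ≡⟨ cong (λ t → r zero * y zero + t) (dot-comm y′ _) ⟩
    r zero * y zero + dot (λ j → r′ j + r zero * c j) y′
      ≡⟨ dot-suc (shearRow c r) y ⟨
    dot (shearRow c r) y ∎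
    where
    open ≡-Reasoning
    y′ = y ∘ suc
    r′ = r ∘ suc
    distribute : ∀ a b s t → a * (b + s) + t ≡ a * b + (t + a * s)
    distribute = solve-∀
    expand : ∀ a b → a * (b + dot c y′) + dot r′ y′ ≡ a * b + (dot y′ r′ + a * dot y′ c)
    expand a b = trans (distribute a b (dot c y′) (dot r′ y′))
      (cong₂ (λ s t → a * b + (t + a * s)) (dot-comm c y′) (dot-comm r′ y′))

  dot-permute : ∀ {n} (π : Perm.Permutation n n) r y →
    dot r (to (permute π) y) ≡ dot (r ∘ (π Perm.⟨$⟩ˡ_)) y
  dot-permute π r y = sym (trans (dot-∑ _ y) (trans (∑-permute (λ i → r (π Perm.⟨$⟩ˡ i) * y i) π)
    (trans (∑-cong λ i → cong (λ t → r t * y (π Perm.⟨$⟩ʳ i)) (Perm.inverseˡ π)) (sym (dot-∑ r _)))))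

  -- The corner contributes the symmetric form x₀ a y₀, so the automorphisms of the complementary
  -- block extend by the identity.
  selfTranspose-block : ∀ {n} (B : Matrix (suc n)) →
    (∀ j → B zero (suc j) ≡ 0ℤ) → (∀ i → B (suc i) zero ≡ 0ℤ) →
    SelfTranspose (λ i j → B (suc i) (suc j)) → SelfTranspose B
  selfTranspose-block {n} B row col (γ , α , p) = extend γ , extend α , λ x y → begin
    bilinear B x y ≡⟨ split x y ⟩
    x zero * (a * y zero) + bilinear C (x ∘ suc) (y ∘ suc)
      ≡⟨ cong₂ _+_ (rotate (x zero) a (y zero)) (p (x ∘ suc) (y ∘ suc)) ⟩
    y zero * (a * x zero) + bilinear C (to γ (y ∘ suc)) (to α (x ∘ suc))
      ≡⟨ split (to (extend γ) y) (to (extend α) x) ⟨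
    bilinear B (to (extend γ) y) (to (extend α) x) ∎
    where
    open ≡-Reasoning
    a = B zero zero
    C : Matrix n
    C i j = B (suc i) (suc j)
    rotate : ∀ a b c → a * (b * c) ≡ c * (b * a)
    rotate = solve-∀
    split : ∀ x y → bilinear B x y ≡ x zero * (a * y zero) + bilinear C (x ∘ suc) (y ∘ suc)
    split x y = trans (bilinear-dot B x y) (trans (dot-suc x _) (cong₂ _+_
      (cong (x zero *_) (trans (dot-suc (B zero) y)
        (trans (cong (λ t → a * y zero + t) (dot-zeroˡ (B zero ∘ suc) (y ∘ suc) row)) (ℤₚ.+-identityʳ (a * y zero)))))
      (trans (dot-congʳ (x ∘ suc) λ i → trans (dot-suc (B (suc i)) y)
        (trans (cong (λ t → t * y zero + dot (C i) (y ∘ suc)) (col i)) (ℤₚ.+-identityˡ (dot (C i) (y ∘ suc)))))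
        (sym (bilinear-dot C (x ∘ suc) (y ∘ suc))))))

  -- Shearing by the negated quotients clears the row and leaves column 0 alone. In continuation
  -- form, so that only these two facts about the new matrix are passed on.
  selfTranspose-clearRow : ∀ {n} (B : Matrix (suc n)) → (∀ j → B zero zero ∣ B zero (suc j)) →
    (∀ B′ → (∀ j → B′ zero (suc j) ≡ 0ℤ) → (∀ i → B′ i zero ≡ B i zero) → SelfTranspose B′) → SelfTranspose B
  selfTranspose-clearRow B div k = selfTranspose-column B (λ i → shearRow c (B i)) (shear c)
    (λ i → dot-shear c (B i)) (k _ cleared (λ _ → refl))
    where
    c : ℤ^ _
    c j = - _∣_.quotient (div j)
    cleared : ∀ j → shearRow c (B zero) (suc j) ≡ 0ℤ
    cleared j = trans (cong (λ t → t + B zero zero * c j) (_∣_.equality (div j)))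
      (annihilate (_∣_.quotient (div j)) (B zero zero))
      where
      annihilate : ∀ q a → q * a + a * - q ≡ 0ℤ
      annihilate = solve-∀


  module _ {n} (ih : ∀ (C : Matrix n) → SelfTranspose C) where

    -- The column is cleared as the row of the transpose. That step fixes column 0 of the transpose,
    -- which is the row already cleared, so both are zero at the end.
    selfTranspose-divides : (B : Matrix (suc n)) → (∀ j → B zero zero ∣ B zero (suc j)) →
      (∀ i → B zero zero ∣ B (suc i) zero) → SelfTranspose B
    selfTranspose-divides B row col =
      selfTranspose-clearRow B row λ B₁ row₁ col₁ →
      selfTranspose-ᵀ B₁ (selfTranspose-clearRow (B₁ ᵀ)
        (λ i → subst₂ _∣_ (sym (col₁ zero)) (sym (col₁ (suc i))) (col i))
        λ B₂ row₂ col₂ → selfTranspose-block B₂ row₂ (λ j → trans (col₂ (suc j)) (row₁ j)) (ih _))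

    -- One Euclidean step: the remainder of an entry of the first row becomes the new corner.
    selfTranspose-reduce : (B : Matrix (suc n)) (j : Fin n) (c : ℤ) →
      (∀ B′ → B′ zero zero ≡ B zero (suc j) + B zero zero * c → SelfTranspose B′) → SelfTranspose B
    selfTranspose-reduce B j c k =
      -- This shear adds c times column 0 to every other column; only column j matters, because the
      -- transposition then brings it to the front.
      selfTranspose-column B B₁ (shear (λ _ → c)) (λ i → dot-shear (λ _ → c) (B i))
        (selfTranspose-column B₁ B₂ (permute π) (λ i → dot-permute π (B₁ i)) (k B₂ refl))
      where
      π = Perm.transpose zero (suc j)
      B₁ B₂ : Matrix (suc n)
      B₁ i = shearRow (λ _ → c) (B i)
      B₂ i = B₁ i ∘ (π Perm.⟨$⟩ˡ_)

    -- If the corner fails to divide some entry of its row or column, the remainder of that entry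
    -- becomes the new corner: nonzero, and smaller in absolute value, whence the recursion on
    -- ∣corner∣.
    selfTranspose-nonzero : (B : Matrix (suc n)) → .{{_ : ℤ.NonZero (B zero zero)}} →
      Acc ℕ._<_ ∣ B zero zero ∣ → SelfTranspose B
    euclid : (B : Matrix (suc n)) → .{{_ : ℤ.NonZero (B zero zero)}} →
      Acc ℕ._<_ ∣ B zero zero ∣ → (j : Fin n) → ¬ (B zero zero ∣ B zero (suc j)) → SelfTranspose B

    euclid B (acc rec) j a∤b = selfTranspose-reduce B j (- quo) λ B′ eq →
      let eq′ : B′ zero zero ≡ + rem
          eq′ = trans eq (trans (cong (λ t → t + a * - quo) (ℤ÷.a≡a%n+[a/n]*n (B zero (suc j)) a)) (shrink (+ rem) quo a))
          rem≢0 : + rem ≢ 0ℤ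
          rem≢0 r≡0 = a∤b (divides quo (trans (ℤ÷.a≡a%n+[a/n]*n (B zero (suc j)) a)
                        (trans (cong (_+ quo * a) r≡0) (ℤₚ.+-identityˡ _))))
      in selfTranspose-nonzero B′ {{ℤ.≢-nonZero (rem≢0 ∘ trans (sym eq′))}}
           (rec (subst (ℕ._< ∣ a ∣) (sym (cong ∣_∣ eq′)) (ℤ÷.n%d<d (B zero (suc j)) a)))
      where
      a = B zero zero
      quo = B zero (suc j) ℤ÷./ a
      rem = B zero (suc j) ℤ÷.% a
      shrink : ∀ r q a → r + q * a + a * - q ≡ r
      shrink = solve-∀

    selfTranspose-nonzero B ac with Finₚ.all? (λ j → B zero zero ∣? B zero (suc j)) | Finₚ.all? (λ i → B zero zero ∣? B (suc i) zero)
    ... | yes row | yes col = selfTranspose-divides B row col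
    ... | yes _ | no ¬col = let i , ¬d = Finₚ.¬∀⟶∃¬ n _ (λ i → B zero zero ∣? B (suc i) zero) ¬col in
                              selfTranspose-ᵀ B (euclid (B ᵀ) ac i ¬d)
    ... | no ¬row | _ = let j , ¬d = Finₚ.¬∀⟶∃¬ n _ (λ j → B zero zero ∣? B zero (suc j)) ¬row in
                              euclid B ac j ¬d

    -- A reduction with multiplier 0 merely swaps columns and so brings a nonzero entry into the
    -- corner.
    pivot : (B : Matrix (suc n)) (j : Fin n) → B zero (suc j) ≢ 0ℤ → B zero zero ≡ 0ℤ → SelfTranspose B
    pivot B j b≢0 a≡0 = selfTranspose-reduce B j 0ℤ λ B′ eq →
      selfTranspose-nonzero B′ {{ℤ.≢-nonZero λ z → b≢0 (trans (sym (trans (cong (λ t → B zero (suc j) + t) (ℤₚ.*-zeroʳ (B zero zero))) (ℤₚ.+-identityʳ _))) (trans (sym eq) z))}} (<-wellFounded _)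

    selfTranspose-step : (B : Matrix (suc n)) → SelfTranspose B
    selfTranspose-step B with B zero zero ℤ.≟ 0ℤ
    ... | no a≢0 = selfTranspose-nonzero B {{ℤ.≢-nonZero a≢0}} (<-wellFounded _)
    ... | yes a≡0 with Finₚ.all? (λ j → B zero (suc j) ℤ.≟ 0ℤ) | Finₚ.all? (λ i → B (suc i) zero ℤ.≟ 0ℤ)
    ... | yes row | yes col = selfTranspose-block B row col (ih _)
    ... | yes _ | no ¬col = let i , b≢0 = Finₚ.¬∀⟶∃¬ n _ (λ i → B (suc i) zero ℤ.≟ 0ℤ) ¬col in
                                selfTranspose-ᵀ B (pivot (B ᵀ) i b≢0 a≡0)
    ... | no ¬row | _ = let j , b≢0 = Finₚ.¬∀⟶∃¬ n _ (λ j → B zero (suc j) ℤ.≟ 0ℤ) ¬row in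
                                pivot B j b≢0 a≡0

  selfTranspose : ∀ n (B : Matrix n) → SelfTranspose B
  selfTranspose zero B = idᴬ , idᴬ , λ _ _ → bilinear-cong B (λ ()) (λ ())
  selfTranspose (suc n) B = selfTranspose-step (selfTranspose n) B

-- Duality for quotients of ℤⁿ killed by M.

module SelfDuality where

  open import Data.Bool using (if_then_else_)
  open import Data.Integer as ℤ using (ℤ; 0ℤ; 1ℤ; +_; ∣_∣; _+_; _*_; -_; _-_)
  open import Data.Integer.Divisibility.Signed using (_∣_; divides; ∣n⇒∣m*n; ∣⇒∣ᵤ; ∣m∣n⇒∣m+n)
  open import Data.Integer.Tactic.RingSolver using (solve-∀)
  open import Data.Product using (∃; _×_; _,_; proj₁; proj₂)
  open import Relation.Nullary.Decidable using (⌊_⌋)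
  open import Relation.Binary.PropositionalEquality
  open Sums
  open SelfTransposition

  open ℤΣ
  open Automorphism

  basis : ∀ {n} → Fin n → ℤ^ n
  basis i j = if ⌊ j Fin.≟ i ⌋ then 1ℤ else 0ℤ

  dot-basisˡ : ∀ {n} (i : Fin n) y → dot (basis i) y ≡ y i
  dot-basisˡ i y = trans (dot-∑ (basis i) y) (trans (∑-single i off) on)
    where
    off : ∀ j → ¬ j ≡ i → basis i j * y j ≡ 0ℤ
    off j j≢i with j Fin.≟ i
    ... | yes j≡i = contradiction j≡i j≢i
    ... | no _ = refl
    on : basis i i * y i ≡ y i
    on with i Fin.≟ i
    ... | yes _ = ℤₚ.*-identityˡ (y i)
    ... | no i≢i = contradiction refl i≢i

  dot-basisʳ : ∀ {n} (i : Fin n) y → dot y (basis i) ≡ y i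
  dot-basisʳ i y = trans (dot-comm y (basis i)) (dot-basisˡ i y)

  dot-*ˡ : ∀ {n} a (x y : ℤ^ n) → dot (λ i → a * x i) y ≡ a * dot x y
  dot-*ˡ a x y = trans (dot-comm _ y) (trans (dot-*ʳ a y x) (cong (a *_) (dot-comm y x)))

  dot-+ˡ : ∀ {n} (x y z : ℤ^ n) → dot (λ i → x i + y i) z ≡ dot x z + dot y z
  dot-+ˡ x y z = trans (dot-comm _ z) (trans (dot-+ʳ z x y) (cong₂ _+_ (dot-comm z x) (dot-comm z y)))

  ∣-∑ : ∀ {n} k {t : ℤ^ n} → (∀ i → k ∣ t i) → k ∣ ∑ t
  ∣-∑ {zero} k {t} p = divides 0ℤ (∑-empty t)
  ∣-∑ {suc n} k {t} p = subst (k ∣_) (sym (∑-suc t)) (∣m∣n⇒∣m+n (p zero) (∣-∑ k (p ∘ suc)))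

  ∣-dot : ∀ {n} k (x : ℤ^ n) {y} → (∀ i → k ∣ y i) → k ∣ dot x y
  ∣-dot k x {y} p = subst (k ∣_) (sym (dot-∑ x y)) (∣-∑ k λ i → ∣n⇒∣m*n (x i) (p i))

  ∣⇒*/ℕ : ∀ M .{{_ : ℕ.NonZero M}} z → + M ∣ z → + M * (z ℤ÷./ℕ M) ≡ z
  ∣⇒*/ℕ M z (divides w z≡wM) = trans (ℤₚ.*-comm (+ M) k) (sym (trans z≡r+kM (trans (cong (λ t → + t + k * + M) r≡0) (ℤₚ.+-identityˡ (k * + M)))))
    where
    k = z ℤ÷./ℕ M
    r = z ℤ÷.%ℕ M
    z≡r+kM : z ≡ + r + k * + M
    z≡r+kM = ℤ÷.a≡a%ℕn+[a/ℕn]*n z M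
    isolate : ∀ a r k m → a ≡ r + k * m → r ≡ a - k * m
    isolate a r k m refl = lemma r (k * m)
      where
      lemma : ∀ r t → r ≡ r + t - t
      lemma = solve-∀
    factor : ∀ w k m → w * m - k * m ≡ (w - k) * m
    factor = solve-∀
    M∣r : M ℕ∣.∣ r
    M∣r = ∣⇒∣ᵤ (divides (w - k) (trans (isolate z (+ r) k (+ M) z≡r+kM)
      (trans (cong (_- k * + M) z≡wM) (factor w k (+ M)))))
    r≡0 : r ≡ 0
    r≡0 with r in eq
    ... | zero = refl
    ... | suc _ = contradiction (ℕ∣.∣⇒≤ (subst (M ℕ∣.∣_) eq M∣r))
                    (ℕₚ.<⇒≱ (subst (ℕ._< M) eq (ℤ÷.n%ℕd<d z M)))

  _·ᴹ_ : ∀ {n} → ℤ^ n → Matrix n → ℤ^ n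
  (x ·ᴹ B) j = dot x ((B ᵀ) j)

  dot-·ᴹ : ∀ {n} (B : Matrix n) x y → dot (x ·ᴹ B) y ≡ bilinear B x y
  dot-·ᴹ B x y = trans (dot-comm _ y) (trans (dot-congʳ y λ j → dot-comm x ((B ᵀ) j))
    (trans (sym (bilinear-dot (B ᵀ) y x)) (sym (bilinear-ᵀ B x y))))

  ·ᴹ-cong : ∀ {n} (B : Matrix n) {x y} → x ≗ y → x ·ᴹ B ≗ y ·ᴹ B
  ·ᴹ-cong B p j = dot-cong p (λ _ → refl)

  infix 4 _≡_mod[_]
  -- A record and not an abbreviation for divisibility of a - b, so that a and b can be inferred
  -- from the type.
  record _≡_mod[_] (a b : ℤ) (M : ℕ) : Set where
    constructor congruent
    field difference : + M ∣ a - b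
  open _≡_mod[_] public

  -- A finite quotient ℤⁿ / (row span of B), killed by M, is isomorphic to its own dual
  -- { y ∈ (ℤ/M)ⁿ : B y ≡ 0 }: the transport y ↦ (γ y ·ᴹ B) / M is an isomorphism.
  module SelfDual {n} (B : Matrix n) (M : ℕ) .{{_ : ℕ.NonZero M}}
    (kills : ∀ (z : ℤ^ n) → ∃ λ (x : ℤ^ n) → ∀ j → (x ·ᴹ B) j ≡ + M * z j) where

    private
      γ = proj₁ (selfTranspose n B)
      α = proj₁ (proj₂ (selfTranspose n B))

      -- The self-transposition of B, read as an adjunction between y ↦ B y and y ↦ γ y ·ᴹ B.
      -- Everything below follows from it and from the invertibility of γ and α.
      adjoint : ∀ x y → dot (to γ y ·ᴹ B) (to α x) ≡ dot x (λ i → dot (B i) y)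
      adjoint x y = trans (dot-·ᴹ B (to γ y) (to α x))
        (trans (sym (proj₂ (proj₂ (selfTranspose n B)) x y)) (bilinear-dot B x y))

      M-cancel : ∀ {a b} → + M * a ≡ + M * b → a ≡ b
      M-cancel {a} {b} = ℤₚ.*-cancelˡ-≡ (+ M) a b

    InDual : ℤ^ n → Set
    InDual y = ∀ i → + M ∣ dot (B i) y

    InRowSpan : ℤ^ n → Set
    InRowSpan z = ∃ λ x → z ≗ x ·ᴹ B

    -- Rounded division makes this total; for y in the dual the quotient is exact, by `M*ψ`.
    ψ : ℤ^ n → ℤ^ n
    ψ y j = (to γ y ·ᴹ B) j ℤ÷./ℕ M

    -- As α is onto, coordinate j of γ y ·ᴹ B is by `adjoint` an integer combination of the entries
    -- of B y, all of them divisible by M.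
    M*ψ : ∀ {y} → InDual y → ∀ j → + M * ψ y j ≡ (to γ y ·ᴹ B) j
    M*ψ {y} y∈ j = ∣⇒*/ℕ M _ (subst (+ M ∣_) eq (∣-dot (+ M) (from α (basis j)) y∈))
      where
      eq : dot (from α (basis j)) (λ i → dot (B i) y) ≡ (to γ y ·ᴹ B) j
      eq = trans (sym (adjoint _ y)) (trans (dot-congʳ _ (to-from α (basis j))) (dot-basisʳ j (to γ y ·ᴹ B)))

    -- B has full rank because its rows span M ℤⁿ. Concretely, choosing y with γ y ·ᴹ B = M e_k,
    -- `adjoint` recovers M times coordinate k of α u from u ·ᴹ B.
    ·ᴹ-injective : ∀ {u v} → u ·ᴹ B ≗ v ·ᴹ B → u ≗ v
    ·ᴹ-injective {u} {v} p i = trans (sym (from-to α u i)) (trans (from-cong α αu≗αv i) (from-to α v i))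
      where
      αu≗αv : to α u ≗ to α v
      αu≗αv k = M-cancel (trans (M*α u) (trans same (sym (M*α v))))
        where
        x = proj₁ (kills (basis k))
        y = from γ x
        M*α : ∀ t → + M * to α t k ≡ dot t (λ i → dot (B i) y)
        M*α t = begin
          + M * to α t k ≡⟨ cong (+ M *_) (dot-basisˡ k (to α t)) ⟨
          + M * dot (basis k) (to α t) ≡⟨ dot-*ˡ (+ M) (basis k) (to α t) ⟨
          dot (λ j → + M * basis k j) (to α t) ≡⟨ dot-cong {y = to α t} (λ j → trans (·ᴹ-cong B (to-from γ x) j) (proj₂ (kills (basis k)) j)) (λ _ → refl) ⟨
          dot (to γ y ·ᴹ B) (to α t) ≡⟨ adjoint t y ⟩
          dot t (λ i → dot (B i) y) ∎
          where open ≡-Reasoning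
        same : dot u (λ i → dot (B i) y) ≡ dot v (λ i → dot (B i) y)
        same = trans (sym (bilinear-dot B u y)) (trans (sym (dot-·ᴹ B u y))
          (trans (dot-cong {y = y} p (λ _ → refl)) (trans (dot-·ᴹ B v y) (bilinear-dot B v y))))

    -- If y = y₁ + y₂ + M w, dividing by M leaves γ w ·ᴹ B: an ambiguity modulo M on the dual side
    -- becomes an element of the row span.
    ψ-homo : ∀ {y y₁ y₂} → InDual y → InDual y₁ → InDual y₂ →
      (∀ i → y i ≡ y₁ i + y₂ i mod[ M ]) → InRowSpan (λ j → ψ y j - (ψ y₁ j + ψ y₂ j))
    ψ-homo {y} {y₁} {y₂} y∈ y₁∈ y₂∈ p = to γ w , λ j → M-cancel (begin
      + M * (ψ y j - (ψ y₁ j + ψ y₂ j)) ≡⟨ distribute (+ M) (ψ y j) (ψ y₁ j) (ψ y₂ j) ⟩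
      + M * ψ y j - (+ M * ψ y₁ j + + M * ψ y₂ j) ≡⟨ cong₂ _-_ (M*ψ y∈ j) (cong₂ _+_ (M*ψ y₁∈ j) (M*ψ y₂∈ j)) ⟩
      F (to γ y) j - (F (to γ y₁) j + F (to γ y₂) j) ≡⟨ cong (_- (F (to γ y₁) j + F (to γ y₂) j)) (expand j) ⟩
      F (to γ y₁) j + F (to γ y₂) j + + M * F (to γ w) j - (F (to γ y₁) j + F (to γ y₂) j) ≡⟨ cancel (F (to γ y₁) j + F (to γ y₂) j) (+ M * F (to γ w) j) ⟩
      + M * F (to γ w) j ∎)
      where
      open ≡-Reasoning
      F : ℤ^ n → ℤ^ n
      F x = x ·ᴹ B
      w : ℤ^ n
      w i = _∣_.quotient (difference (p i))
      distribute : ∀ m a b c → m * (a - (b + c)) ≡ m * a - (m * b + m * c)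
      distribute = solve-∀
      cancel : ∀ a b → a + b - a ≡ b
      cancel = solve-∀
      y≗ : ∀ i → y i ≡ y₁ i + y₂ i + + M * w i
      y≗ i = trans (regroup (y i) (y₁ i + y₂ i)) (cong (λ t → y₁ i + y₂ i + t)
        (trans (_∣_.equality (difference (p i))) (ℤₚ.*-comm (w i) (+ M))))
        where
        regroup : ∀ a b → a ≡ b + (a - b)
        regroup = solve-∀
      γy≗ : ∀ i → to γ y i ≡ to γ y₁ i + to γ y₂ i + + M * to γ w i
      γy≗ i = trans (to-cong γ y≗ i) (trans (to-+ γ _ _ i) (cong₂ _+_ (to-+ γ y₁ y₂ i) (to-* γ (+ M) w i)))
      expand : ∀ j → F (to γ y) j ≡ F (to γ y₁) j + F (to γ y₂) j + + M * F (to γ w) j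
      expand j = trans (·ᴹ-cong B γy≗ j) (trans (dot-+ˡ _ _ ((B ᵀ) j))
        (cong₂ _+_ (dot-+ˡ (to γ y₁) (to γ y₂) ((B ᵀ) j)) (dot-*ˡ (+ M) (to γ w) ((B ᵀ) j))))

    ψ-cong : ∀ {y y₁} → InDual y → InDual y₁ →
      (∀ i → y i ≡ y₁ i mod[ M ]) → InRowSpan (λ j → ψ y j - ψ y₁ j)
    ψ-cong {y} {y₁} y∈ y₁∈ p =
      let x , q = ψ-homo y∈ y₁∈ 0∈ (λ i → congruent (subst (λ t → + M ∣ y i - t) (sym (ℤₚ.+-identityʳ (y₁ i))) (difference (p i))))
      in x , λ j → trans (cong (λ t → ψ y j - t) (sym (trans (cong (λ t → ψ y₁ j + t) (ψ0≡0 j)) (ℤₚ.+-identityʳ (ψ y₁ j))))) (q j)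
      where
      0∈ : InDual (λ _ → 0ℤ)
      0∈ i = divides 0ℤ (trans (dot-comm (B i) _) (dot-zeroˡ _ (B i) λ _ → refl))
      ψ0≡0 : ∀ j → ψ (λ _ → 0ℤ) j ≡ 0ℤ
      ψ0≡0 j = M-cancel (trans (M*ψ 0∈ j) (trans (dot-zeroˡ _ ((B ᵀ) j) (to-* γ 0ℤ (λ _ → 0ℤ))) (sym (ℤₚ.*-zeroʳ (+ M)))))

    -- Conversely, a difference x ·ᴹ B of images lifts to γ y = γ y₁ + M x, since B can be
    -- cancelled.
    ψ-injective : ∀ {y y₁} → InDual y → InDual y₁ →
      InRowSpan (λ j → ψ y j - ψ y₁ j) → ∀ i → y i ≡ y₁ i mod[ M ]
    ψ-injective {y} {y₁} y∈ y₁∈ (x , p) i = congruent (divides (from γ x i) (begin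
      y i - y₁ i ≡⟨ cong (_- y₁ i) (trans (sym (from-to γ y i)) (trans (from-cong γ γy≗ i)
                                                       (trans (from-+ γ _ _ i) (cong₂ _+_ (from-to γ y₁ i) (from-* γ (+ M) x i))))) ⟩
      y₁ i + + M * from γ x i - y₁ i ≡⟨ cancel (y₁ i) (+ M) (from γ x i) ⟩
      from γ x i * + M ∎))
      where
      open ≡-Reasoning
      cancel : ∀ a m b → a + m * b - a ≡ b * m
      cancel = solve-∀
      γy≗ : ∀ i → to γ y i ≡ to γ y₁ i + + M * x i
      γy≗ = ·ᴹ-injective λ j → begin
        (to γ y ·ᴹ B) j ≡⟨ M*ψ y∈ j ⟨
        + M * ψ y j ≡⟨ regroup (+ M) (ψ y j) (ψ y₁ j) ⟩
        + M * ψ y₁ j + + M * (ψ y j - ψ y₁ j) ≡⟨ cong₂ (λ s t → s + + M * t) (M*ψ y₁∈ j) (p j) ⟩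
        (to γ y₁ ·ᴹ B) j + + M * (x ·ᴹ B) j ≡⟨ cong (λ t → (to γ y₁ ·ᴹ B) j + t) (dot-*ˡ (+ M) x ((B ᵀ) j)) ⟨
        (to γ y₁ ·ᴹ B) j + ((λ i → + M * x i) ·ᴹ B) j ≡⟨ dot-+ˡ (to γ y₁) _ ((B ᵀ) j) ⟨
        ((λ i → to γ y₁ i + + M * x i) ·ᴹ B) j ∎
        where
        regroup : ∀ m a b → m * a ≡ m * b + m * (a - b)
        regroup = solve-∀

    -- M z lies in the row span, say M z = x ·ᴹ B, and y = γ⁻¹ x is the preimage; `adjoint` shows
    -- that M divides B y.
    ψ-surjective : ∀ z → ∃ λ y → InDual y × ψ y ≗ z
    ψ-surjective z = y , y∈ , λ j → M-cancel (trans (M*ψ y∈ j) (γy j))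
      where
      x = proj₁ (kills z)
      y = from γ x
      γy : ∀ j → (to γ y ·ᴹ B) j ≡ + M * z j
      γy j = trans (·ᴹ-cong B (to-from γ x) j) (proj₂ (kills z) j)
      y∈ : InDual y
      y∈ i = divides (dot z (to α (basis i))) (begin
        dot (B i) y ≡⟨ dot-basisˡ i (λ i → dot (B i) y) ⟨
        dot (basis i) (λ i → dot (B i) y) ≡⟨ adjoint (basis i) y ⟨
        dot (to γ y ·ᴹ B) (to α (basis i)) ≡⟨ dot-cong {y = to α (basis i)} γy (λ _ → refl) ⟩
        dot (λ j → + M * z j) (to α (basis i)) ≡⟨ dot-*ˡ (+ M) z (to α (basis i)) ⟩
        + M * dot z (to α (basis i)) ≡⟨ ℤₚ.*-comm (+ M) _ ⟩
        dot z (to α (basis i)) * + M ∎)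
        where open ≡-Reasoning

-- The algebra F[x]/(x^m - 1) and evaluation at roots of unity.

module CirculantAlgebra where

  open import Data.Nat.DivMod using (_mod_; m%n%n≡m%n; %-distribˡ-+; m<n⇒m%n≡m; [m+kn]%n≡m%n; m%n<n; m≡m%n+[m/n]*n)
  open import Data.Product using (_×_; _,_)
  open import Relation.Binary.PropositionalEquality as ≡ using (_≡_)
  open Sums

  toℕ-mod : ∀ k m .{{_ : NonZero m}} → toℕ (k mod m) ≡ k % m
  toℕ-mod k m = Finₚ.toℕ-fromℕ< (m%n<n k m)

  module _ (m : ℕ) .{{_ : NonZero m}} where

    %-+ˡ : ∀ k l → (k % m ℕ.+ l) % m ≡ (k ℕ.+ l) % m
    %-+ˡ k l = ≡.trans (%-distribˡ-+ (k % m) l m)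
      (≡.trans (≡.cong (λ t → (t ℕ.+ l % m) % m) (m%n%n≡m%n k m)) (≡.sym (%-distribˡ-+ k l m)))

    %-+ʳ : ∀ k l → (k ℕ.+ l % m) % m ≡ (k ℕ.+ l) % m
    %-+ʳ k l = ≡.trans (≡.cong (_% m) (ℕₚ.+-comm k _)) (≡.trans (%-+ˡ l k) (≡.cong (_% m) (ℕₚ.+-comm l k)))

    -- In place of a subtraction, s (m - 1) is added to both sides, which completes s to a multiple
    -- of m.
    %-cancelʳ-+ : ∀ s {k l} → (k ℕ.+ s) % m ≡ (l ℕ.+ s) % m → k % m ≡ l % m
    %-cancelʳ-+ s {k} {l} eq = ≡.trans (complete k) (≡.trans (≡.cong (λ t → (t ℕ.+ s ℕ.* ℕ.pred m) % m) eq) (≡.sym (complete l)))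
      where
      complete : ∀ k → k % m ≡ ((k ℕ.+ s) % m ℕ.+ s ℕ.* ℕ.pred m) % m
      complete k = ≡.trans (≡.sym ([m+kn]%n≡m%n k s m)) (≡.trans
        (≡.cong (_% m) (≡.trans (≡.cong (λ t → k ℕ.+ s ℕ.* t) (≡.sym (ℕₚ.suc-pred m)))
          (≡.trans (≡.cong (k ℕ.+_) (ℕₚ.*-suc s (ℕ.pred m))) (≡.sym (ℕₚ.+-assoc k s _)))))
        (≡.sym (%-+ˡ (k ℕ.+ s) _)))

  Homomorphism : ∀ {a b c d} (R : CommutativeRing a b) (S : CommutativeRing c d) →
    (CommutativeRing.Carrier R → CommutativeRing.Carrier S) → Set _
  Homomorphism R S = IsSemiringHomomorphism
    (Semiring.rawSemiring (CommutativeRing.semiring R)) (Semiring.rawSemiring (CommutativeRing.semiring S))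

  module Powers {c ℓ} (R : CommutativeRing c ℓ) where
    open CommutativeRing R
    open Exp semiring public using (_^_; ^-congˡ; ^-congʳ; ^-homo-*; ^-assocʳ)

    1^n≈1 : ∀ n → 1# ^ n ≈ 1#
    1^n≈1 zero = refl
    1^n≈1 (suc n) = trans (*-identityˡ _) (1^n≈1 n)

    ^-periodic : ∀ {z} m .{{_ : NonZero m}} → z ^ m ≈ 1# → ∀ k → z ^ (k % m) ≈ z ^ k
    ^-periodic {z} m z^m≈1 k = begin
      z ^ (k % m) ≈⟨ *-identityʳ _ ⟨
      z ^ (k % m) * 1# ≈⟨ *-congˡ (1^n≈1 (k ℕ./ m)) ⟨
      z ^ (k % m) * 1# ^ (k ℕ./ m) ≈⟨ *-congˡ (^-congˡ (k ℕ./ m) z^m≈1) ⟨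
      z ^ (k % m) * (z ^ m) ^ (k ℕ./ m) ≈⟨ *-congˡ (^-assocʳ z m (k ℕ./ m)) ⟩
      z ^ (k % m) * z ^ (m ℕ.* (k ℕ./ m)) ≈⟨ ^-homo-* z (k % m) _ ⟨
      z ^ (k % m ℕ.+ m ℕ.* (k ℕ./ m)) ≈⟨ ^-congʳ z (≡.trans (≡.cong (k % m ℕ.+_) (ℕₚ.*-comm m _)) (≡.sym (m≡m%n+[m/n]*n k m))) ⟩
      z ^ k ∎
      where open SetoidReasoning setoid

  module HomomorphicSums {a b c d} (R : CommutativeRing a b) (S : CommutativeRing c d)
    {ι} (hom : Homomorphism R S ι) where
    private
      module R = CommutativeRing R
      module S = CommutativeRing S
      module RΣ = FiniteSums R.commutativeSemiring
      module SΣ = FiniteSums S.commutativeSemiring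
    open IsSemiringHomomorphism hom
    open Powers R using () renaming (_^_ to _^ᴿ_)
    open Powers S using () renaming (_^_ to _^ˢ_)

    homo-∑ : ∀ {n} (t : Fin n → R.Carrier) → ι (RΣ.∑ t) S.≈ SΣ.∑ (ι ∘ t)
    homo-∑ {zero} t = S.trans (⟦⟧-cong (RΣ.∑-empty t)) (S.trans 0#-homo (S.sym (SΣ.∑-empty _)))
    homo-∑ {suc n} t = S.trans (⟦⟧-cong (RΣ.∑-suc t)) (S.trans (+-homo _ _)
      (S.trans (S.+-congˡ (homo-∑ (t ∘ suc))) (S.sym (SΣ.∑-suc _))))

    open Mult R.semiring using () renaming (_×_ to _×ᴿ_)
    open Mult S.semiring using () renaming (_×_ to _×ˢ_)

    homo-×1 : ∀ n → ι (n ×ᴿ R.1#) S.≈ n ×ˢ S.1#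
    homo-×1 zero = 0#-homo
    homo-×1 (suc n) = S.trans (+-homo _ _) (S.+-cong 1#-homo (homo-×1 n))

    homo-^ : ∀ x n → ι (x ^ᴿ n) S.≈ ι x ^ˢ n
    homo-^ x zero = 1#-homo
    homo-^ x (suc n) = S.trans (*-homo x _) (S.*-congˡ (homo-^ x n))

  -- F[x]/(x^m - 1), whose elements are tested by pairing them with m-periodic sequences.
  module CirculantPairing {a b c d} (F : CommutativeRing a b) (K : CommutativeRing c d)
    {ι} (hom : Homomorphism F K ι) (m : ℕ) .{{_ : NonZero m}} where
    private module F = CommutativeRing F
    open CommutativeRing K hiding (zero)
    open FiniteSums commutativeSemiring
    open Circulant F m using (Poly; _≈P_; _*P_; xpow)
    open IsSemiringHomomorphism hom
    open HomomorphicSums F K hom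
    open SetoidReasoning setoid
    private module FΣ = FiniteSums F.commutativeSemiring

    opaque
      pair : Poly → (ℕ → Carrier) → Carrier
      pair p t = ∑ λ j → ι (p j) * t (toℕ j)

      pair-∑ : ∀ p t → pair p t ≈ ∑ λ j → ι (p j) * t (toℕ j)
      pair-∑ p t = refl

      pair-congˡ : ∀ {p r} → p ≈P r → ∀ t → pair p t ≈ pair r t
      pair-congˡ p≈r t = ∑-cong λ j → *-congʳ (⟦⟧-cong (p≈r j))

      pair-congʳ : ∀ p {s t} → (∀ k → s k ≈ t k) → pair p s ≈ pair p t
      pair-congʳ p s≈t = ∑-cong λ j → *-congˡ (s≈t (toℕ j))

    pair-xpow : ∀ k t → pair (xpow k) t ≈ t (k % m)
    pair-xpow k t = trans (pair-∑ _ t) (trans (∑-single (k mod m) off) (on (k mod m) (toℕ-mod k m)))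
      where
      off : ∀ j → ¬ j ≡ k mod m → ι (xpow k j) * t (toℕ j) ≈ 0#
      off j j≢ with toℕ j ℕ.≟ k % m
      ... | yes j≡ = contradiction (Finₚ.toℕ-injective (≡.trans j≡ (≡.sym (toℕ-mod k m)))) j≢
      ... | no _ = trans (*-congʳ 0#-homo) (zeroˡ _)
      on : ∀ j → toℕ j ≡ k % m → ι (xpow k j) * t (toℕ j) ≈ t (k % m)
      on j j≡ with toℕ j ℕ.≟ k % m
      ... | yes p = trans (*-congʳ 1#-homo) (trans (*-identityˡ _) (reflexive (≡.cong t p)))
      ... | no j≢ = contradiction j≡ j≢

    pair-*P : ∀ p r t → pair (p *P r) t ≈
      ∑ λ i → ∑ λ j → ι (p i) * ι (r j) * t ((toℕ i ℕ.+ toℕ j) % m)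
    pair-*P p r t = begin
      pair (p *P r) t
        ≈⟨ pair-∑ _ t ⟩
      ∑ (λ k → ι ((p *P r) k) * t (toℕ k))
        ≈⟨ ∑-cong (λ k → trans (*-congʳ (expand k)) (trans (∑-*ʳ _ _) (∑-cong λ i → ∑-*ʳ _ _))) ⟩
      ∑ (λ k → ∑ λ i → ∑ λ j → ι (p i F.* r j F.* xpow (toℕ i ℕ.+ toℕ j) k) * t (toℕ k))
        ≈⟨ trans (∑-swap _) (∑-cong λ i → ∑-swap _) ⟩
      ∑ (λ i → ∑ λ j → ∑ λ k → ι (p i F.* r j F.* xpow (toℕ i ℕ.+ toℕ j) k) * t (toℕ k))
        ≈⟨ ∑-cong (λ i → ∑-cong λ j → inner i j) ⟩
      ∑ (λ i → ∑ λ j → ι (p i) * ι (r j) * t ((toℕ i ℕ.+ toℕ j) % m)) ∎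
      where
      expand : ∀ k → ι ((p *P r) k) ≈ ∑ λ i → ∑ λ j → ι (p i F.* r j F.* xpow (toℕ i ℕ.+ toℕ j) k)
      expand k = trans (⟦⟧-cong (F.trans (FΣ.sumFin≈∑ _) (FΣ.∑-cong λ i → FΣ.sumFin≈∑ _)))
        (trans (homo-∑ _) (∑-cong λ i → homo-∑ _))
      inner : ∀ i j → ∑ (λ k → ι (p i F.* r j F.* xpow (toℕ i ℕ.+ toℕ j) k) * t (toℕ k))
        ≈ ι (p i) * ι (r j) * t ((toℕ i ℕ.+ toℕ j) % m)
      inner i j = begin
        ∑ (λ k → ι (p i F.* r j F.* xpow (toℕ i ℕ.+ toℕ j) k) * t (toℕ k))
          ≈⟨ ∑-cong (λ k → trans (*-congʳ (trans (*-homo _ _) (*-congʳ (*-homo _ _)))) (*-assoc _ _ _)) ⟩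
        ∑ (λ k → ι (p i) * ι (r j) * (ι (xpow (toℕ i ℕ.+ toℕ j) k) * t (toℕ k)))
          ≈⟨ trans (*-congˡ (pair-∑ _ t)) (∑-*ˡ _ _) ⟨
        ι (p i) * ι (r j) * pair (xpow (toℕ i ℕ.+ toℕ j)) t
          ≈⟨ *-congˡ (pair-xpow (toℕ i ℕ.+ toℕ j) t) ⟩
        ι (p i) * ι (r j) * t ((toℕ i ℕ.+ toℕ j) % m) ∎

    -- For z ^ m ≈ 1 this is evaluation at z.
    evaluate : Carrier → Poly → Carrier
    evaluate z p = pair p (Powers._^_ K z)

    open Powers K

    module _ {z} (z^m≈1 : z ^ m ≈ 1#) where

      evaluate-xpow : ∀ k → evaluate z (xpow k) ≈ z ^ k
      evaluate-xpow k = trans (pair-xpow k _) (^-periodic m z^m≈1 k)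

      evaluate-* : ∀ p r → evaluate z (p *P r) ≈ evaluate z p * evaluate z r
      evaluate-* p r = begin
        pair (p *P r) (z ^_)
          ≈⟨ pair-*P p r (z ^_) ⟩
        ∑ (λ i → ∑ λ j → ι (p i) * ι (r j) * z ^ ((toℕ i ℕ.+ toℕ j) % m))
          ≈⟨ ∑-cong (λ i → ∑-cong λ j → trans (*-congˡ (trans (^-periodic m z^m≈1 _) (^-homo-* z (toℕ i) (toℕ j))))
               (interchange (ι (p i)) (ι (r j)) _ _)) ⟩
        ∑ (λ i → ∑ λ j → ι (p i) * z ^ toℕ i * (ι (r j) * z ^ toℕ j))
          ≈⟨ ∑-cong (λ i → trans (*-congˡ (pair-∑ r _)) (∑-*ˡ _ _)) ⟨
        ∑ (λ i → ι (p i) * z ^ toℕ i * evaluate z r)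
          ≈⟨ trans (*-congʳ (pair-∑ p _)) (∑-*ʳ _ _) ⟨
        evaluate z p * evaluate z r ∎
        where
        open import Algebra.Properties.CommutativeSemigroup *-commutativeSemigroup using (interchange)

  module CirculantRing {c ℓ} (F : CommutativeRing c ℓ) (m : ℕ) .{{_ : NonZero m}} where
    open CommutativeRing F hiding (zero)
    open FiniteSums commutativeSemiring
    open Circulant F m using (Poly; _≈P_; _*P_; xpow; 1P)
    open CirculantPairing F F (Identity.isSemiringHomomorphism (Semiring.rawSemiring semiring) refl) m public
    open SetoidReasoning setoid

    -- With the identity as ι, a coefficient of a product is an iterated pairing. The ring laws
    -- thereby reduce to rules for `pair` and to arithmetic of exponents modulo m.
    coefficient : ∀ p r k → (p *P r) k ≈ pair p λ i → pair r λ j → xpow (i ℕ.+ j) k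
    coefficient p r k = trans (sumFin≈∑ _) (trans (∑-cong λ i → trans (sumFin≈∑ _)
      (trans (∑-cong λ j → *-assoc _ _ _) (trans (sym (∑-*ˡ _ _)) (*-congˡ (sym (pair-∑ r _)))))) (sym (pair-∑ p _)))

    coefficient-∑ : ∀ p r k → (p *P r) k ≈ ∑ λ i → ∑ λ j → p i * (r j * xpow (toℕ i ℕ.+ toℕ j) k)
    coefficient-∑ p r k = trans (sumFin≈∑ _) (∑-cong λ i → trans (sumFin≈∑ _) (∑-cong λ j → *-assoc _ _ _))

    xpow-cong : ∀ {k l} → k % m ≡ l % m → xpow k ≈P xpow l
    xpow-cong eq j rewrite eq = refl

    *P-cong : ∀ {p p′ r r′} → p ≈P p′ → r ≈P r′ → p *P r ≈P p′ *P r′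
    *P-cong {p} {p′} {r} {r′} p≈ r≈ k = trans (coefficient p r k)
      (trans (pair-congˡ p≈ _) (trans (pair-congʳ p′ λ i → pair-congˡ r≈ _) (sym (coefficient p′ r′ k))))

    *P-comm : ∀ p r → p *P r ≈P r *P p
    *P-comm p r k = begin
      (p *P r) k ≈⟨ coefficient-∑ p r k ⟩
      ∑ (λ i → ∑ λ j → p i * (r j * xpow (toℕ i ℕ.+ toℕ j) k)) ≈⟨ ∑-swap _ ⟩
      ∑ (λ j → ∑ λ i → p i * (r j * xpow (toℕ i ℕ.+ toℕ j) k)) ≈⟨ ∑-cong (λ j → ∑-cong λ i → trans (x∙yz≈y∙xz _ _ _)
                                                                     (reflexive (≡.cong (λ t → r j * (p i * xpow t k)) (ℕₚ.+-comm (toℕ i) (toℕ j))))) ⟩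
      ∑ (λ j → ∑ λ i → r j * (p i * xpow (toℕ j ℕ.+ toℕ i) k)) ≈⟨ coefficient-∑ r p k ⟨
      (r *P p) k ∎
      where open import Algebra.Properties.CommutativeSemigroup *-commutativeSemigroup using (x∙yz≈y∙xz)

    pair-pair : ∀ p r (t : ℕ → Carrier) → pair (p *P r) t ≈ pair p λ i → pair r λ j → t ((i ℕ.+ j) % m)
    pair-pair p r t = trans (pair-*P p r t) (trans
      (∑-cong λ i → trans (∑-cong λ j → *-assoc _ _ _) (trans (sym (∑-*ˡ _ _)) (*-congˡ (sym (pair-∑ r _)))))
      (sym (pair-∑ p _)))

    *P-assoc : ∀ p r s → (p *P r) *P s ≈P p *P (r *P s)
    *P-assoc p r s k = begin
      ((p *P r) *P s) k ≈⟨ coefficient (p *P r) s k ⟩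
      pair (p *P r) (λ l → pair s λ n → xpow (l ℕ.+ n) k) ≈⟨ pair-pair p r _ ⟩
      pair p (λ i → pair r λ j → pair s λ n → xpow ((i ℕ.+ j) % m ℕ.+ n) k) ≈⟨ pair-congʳ p (λ i → pair-congʳ r λ j → pair-congʳ s λ n →
                                                                                     xpow-cong (reindex i j n) k) ⟩
      pair p (λ i → pair r λ j → pair s λ n → xpow (i ℕ.+ (j ℕ.+ n) % m) k) ≈⟨ pair-congʳ p (λ i → pair-pair r s _) ⟨
      pair p (λ i → pair (r *P s) λ l → xpow (i ℕ.+ l) k) ≈⟨ coefficient p (r *P s) k ⟨
      (p *P (r *P s)) k ∎
      where
      reindex : ∀ i j n → ((i ℕ.+ j) % m ℕ.+ n) % m ≡ (i ℕ.+ (j ℕ.+ n) % m) % m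
      reindex i j n = ≡.trans (%-+ˡ m (i ℕ.+ j) n) (≡.trans (≡.cong (_% m) (ℕₚ.+-assoc i j n)) (≡.sym (%-+ʳ m i (j ℕ.+ n))))

    pair-xpow-periodic : ∀ k {t : ℕ → Carrier} → (∀ l → t (l % m) ≈ t l) → pair (xpow k) t ≈ t k
    pair-xpow-periodic k t-per = trans (pair-xpow k _) (t-per k)

    pair-coefficient : ∀ p k → pair p (λ i → xpow i k) ≈ p k
    pair-coefficient p k = trans (pair-∑ p _) (trans (∑-single k off) on)
      where
      off : ∀ j → ¬ j ≡ k → p j * xpow (toℕ j) k ≈ 0#
      off j j≢k with toℕ k ℕ.≟ toℕ j % m
      ... | yes k≡ = contradiction (Finₚ.toℕ-injective (≡.sym (≡.trans k≡ (m<n⇒m%n≡m (Finₚ.toℕ<n j))))) j≢k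
      ... | no _ = zeroʳ _
      on : p k * xpow (toℕ k) k ≈ p k
      on with toℕ k ℕ.≟ toℕ k % m
      ... | yes _ = *-identityʳ _
      ... | no k≢ = contradiction (≡.sym (m<n⇒m%n≡m (Finₚ.toℕ<n k))) k≢

    *P-identityˡ : ∀ p → 1P *P p ≈P p
    *P-identityˡ p k = trans (coefficient 1P p k) (trans
      (pair-xpow-periodic 0 λ l → pair-congʳ p λ j → xpow-cong (%-+ˡ m l j) k)
      (pair-coefficient p k))

    xpow-* : ∀ k l → xpow k *P xpow l ≈P xpow (k ℕ.+ l)
    xpow-* k l j = trans (coefficient _ _ j) (trans
      (pair-xpow-periodic k λ i → pair-congʳ (xpow l) λ n → xpow-cong (%-+ˡ m i n) j)
      (pair-xpow-periodic l λ n → xpow-cong (%-+ʳ m k n) j))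

    infixl 6 _+P_
    _+P_ : Poly → Poly → Poly
    (p +P r) j = p j + r j

    pair-+ˡ : ∀ p r t → pair (p +P r) t ≈ pair p t + pair r t
    pair-+ˡ p r t = trans (pair-∑ _ t) (trans (∑-cong λ j → distribʳ _ _ _)
      (trans (∑-+ _ _) (sym (+-cong (pair-∑ p t) (pair-∑ r t)))))

    pair-+ʳ : ∀ p s t → pair p (λ k → s k + t k) ≈ pair p s + pair p t
    pair-+ʳ p s t = trans (pair-∑ p _) (trans (∑-cong λ j → distribˡ _ _ _)
      (trans (∑-+ _ _) (sym (+-cong (pair-∑ p s) (pair-∑ p t)))))

    *P-distribˡ : ∀ p r s → p *P (r +P s) ≈P (p *P r) +P (p *P s)
    *P-distribˡ p r s k = begin
      (p *P (r +P s)) k ≈⟨ coefficient p (r +P s) k ⟩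
      pair p (λ i → pair (r +P s) λ j → xpow (i ℕ.+ j) k)
        ≈⟨ pair-congʳ p (λ i → pair-+ˡ r s _) ⟩
      pair p (λ i → pair r (λ j → xpow (i ℕ.+ j) k) + pair s (λ j → xpow (i ℕ.+ j) k))
        ≈⟨ pair-+ʳ p _ _ ⟩
      pair p (λ i → pair r λ j → xpow (i ℕ.+ j) k) + pair p (λ i → pair s λ j → xpow (i ℕ.+ j) k)
        ≈⟨ +-cong (coefficient p r k) (coefficient p s k) ⟨
      ((p *P r) +P (p *P s)) k ∎

    circulantRing : CommutativeRing c ℓ
    circulantRing = record
      { Carrier = Poly ; _≈_ = _≈P_ ; _+_ = _+P_ ; _*_ = _*P_
      ; -_ = λ p j → - p j ; 0# = λ _ → 0# ; 1# = 1P
      ; isCommutativeRing = record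
        { isRing = record
          { +-isAbelianGroup = AbelianGroup.isAbelianGroup (Pointwise.abelianGroup (Fin m) +-abelianGroup)
          ; *-cong = *P-cong
          ; *-assoc = *P-assoc
          ; *-identity = *P-identityˡ , λ p k → trans (*P-comm p 1P k) (*P-identityˡ p k)
          ; distrib = *P-distribˡ , λ s p r k → trans (*P-comm (p +P r) s k) (trans (*P-distribˡ s p r k)
              (+-cong (*P-comm s p k) (*P-comm s r k))) }
        ; *-comm = *P-comm } }

    private module P = CommutativeRing circulantRing
    open Powers circulantRing using () renaming (_^_ to _^P_)

    xpow-^ : ∀ k n → xpow k ^P n ≈P xpow (n ℕ.* k)
    xpow-^ k zero = P.refl
    xpow-^ k (suc n) = P.trans (P.*-congˡ {xpow k} (xpow-^ k n)) (xpow-* k (n ℕ.* k))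

    constant : Carrier → Poly
    constant a j = a * 1P j

    constant-* : ∀ a p → constant a *P p ≈P λ j → a * p j
    constant-* a p k = begin
      (constant a *P p) k ≈⟨ coefficient (constant a) p k ⟩
      pair (constant a) (λ i → pair p λ j → xpow (i ℕ.+ j) k) ≈⟨ pair-∑ _ _ ⟩
      ∑ (λ i → a * 1P i * pair p λ j → xpow (toℕ i ℕ.+ j) k) ≈⟨ ∑-cong (λ i → *-assoc _ _ _) ⟩
      ∑ (λ i → a * (1P i * pair p λ j → xpow (toℕ i ℕ.+ j) k)) ≈⟨ trans (*-congˡ (pair-∑ 1P _)) (∑-*ˡ _ _) ⟨
      a * pair 1P (λ i → pair p λ j → xpow (i ℕ.+ j) k) ≈⟨ *-congˡ (coefficient 1P p k) ⟨
      a * (1P *P p) k ≈⟨ *-congˡ (*P-identityˡ p k) ⟩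
      a * p k ∎

    constant-hom : Homomorphism F circulantRing constant
    constant-hom = record
      { isNearSemiringHomomorphism = record
        { +-isMonoidHomomorphism = record
          { isMagmaHomomorphism = record
            { isRelHomomorphism = record { cong = λ a≈b j → *-congʳ a≈b }
            ; homo = λ a b j → distribʳ _ a b }
          ; ε-homo = λ j → zeroˡ _ }
        ; *-homo = λ a b j → trans (*-assoc a b _) (sym (constant-* a (constant b) j)) }
      ; 1#-homo = λ j → *-identityˡ _ }

    private module PΣ = FiniteSums P.commutativeSemiring

    ∑-pointwise : ∀ {n} (t : Fin n → Poly) k → PΣ.∑ t k ≈ ∑ λ i → t i k
    ∑-pointwise {zero} t k = trans (PΣ.∑-empty t k) (sym (∑-empty _))
    ∑-pointwise {suc n} t k = trans (PΣ.∑-suc t k) (trans (+-congˡ (∑-pointwise (t ∘ suc) k)) (sym (∑-suc _)))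

    expansion : ∀ p → p ≈P PΣ.∑ λ j → constant (p j) *P xpow (toℕ j)
    expansion p k = trans (sym (pair-coefficient p k)) (trans (pair-∑ p _)
      (trans (∑-cong λ j → sym (constant-* (p j) (xpow (toℕ j)) k)) (sym (∑-pointwise _ k))))

-- Frobenius maps and finite fields.

module FiniteFields where

  open import Data.Nat.Primality using (Prime; euclidsLemma; prime⇒nonZero; prime⇒nonTrivial)
  open import Data.Nat.Combinatorics using (_C_; nCk≡n!/k![n-k]!; k![n∸k]!∣n!; nCn≡1)
  open import Data.Nat.Base using (_!)
  open import Data.Nat.DivMod using (m/n*n≡m)
  open import Data.Product using (_,_; proj₁; proj₂)
  open import Relation.Binary.PropositionalEquality as ≡ using (_≡_)
  open Sums
  open CirculantAlgebra

  prime∣!⇒≤ : ∀ {p} → Prime p → ∀ k → p ℕ∣.∣ k ! → p ℕ.≤ k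
  prime∣!⇒≤ {p} pr zero p∣1 = contradiction (ℕ∣.∣1⇒≡1 p∣1) (ℕ.nonTrivial⇒≢1 {{prime⇒nonTrivial pr}})
  prime∣!⇒≤ {p} pr (suc k) p∣ with euclidsLemma (suc k) (k !) pr p∣
  ... | inj₁ p∣1+k = ℕ∣.∣⇒≤ p∣1+k
  ... | inj₂ p∣k! = ℕₚ.m≤n⇒m≤1+n (prime∣!⇒≤ pr k p∣k!)

  -- p divides p! = (p C k) k! (p - k)! but neither of the two factorials, whose factors are all
  -- below p.
  prime∣C : ∀ {p} → Prime p → ∀ k → 0 ℕ.< k → k ℕ.< p → p ℕ∣.∣ p C k
  prime∣C {p} pr k 0<k k<p with euclidsLemma (p C k) (k ! ℕ.* (p ∸ k) !) pr p∣product
    where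
    k≤p = ℕₚ.<⇒≤ k<p
    p∣p! : ∀ {p} → .{{NonZero p}} → p ℕ∣.∣ p !
    p∣p! {suc p} = ℕ∣.m∣m*n (p !)
    instance _ = ℕₚ._!*_!≢0 k (p ∸ k)
             _ = prime⇒nonZero pr
    p∣product : p ℕ∣.∣ (p C k) ℕ.* (k ! ℕ.* (p ∸ k) !)
    p∣product = ≡.subst (p ℕ∣.∣_) (≡.sym (≡.trans
      (≡.cong (ℕ._* (k ! ℕ.* (p ∸ k) !)) (nCk≡n!/k![n-k]! k≤p)) (m/n*n≡m (k![n∸k]!∣n! k≤p)))) p∣p!
  ... | inj₁ p∣C = p∣C
  ... | inj₂ p∣k![p-k]! with euclidsLemma (k !) ((p ∸ k) !) pr p∣k![p-k]!
  ... | inj₁ p∣k! = contradiction (prime∣!⇒≤ pr k p∣k!) (ℕₚ.<⇒≱ k<p)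
  ... | inj₂ p∣[p-k]! = contradiction (prime∣!⇒≤ pr (p ∸ k) p∣[p-k]!)
                            (ℕₚ.<⇒≱ (ℕₚ.∸-monoʳ-< 0<k (ℕₚ.<⇒≤ k<p)))

  module Frobenius {c ℓ} (A : CommutativeRing c ℓ) where
    open CommutativeRing A hiding (zero)
    open Powers A
    open Mult semiring using (_×_; ×-congʳ; ×-homo-1; ×-assoc-*; ×1-homo-*)
    open FiniteSums commutativeSemiring
    open SetoidReasoning setoid
    private module B = Binomial commutativeSemiring

    module _ {p} (p-prime : Prime p) (p×1≈0 : p × 1# ≈ 0#) where

      p∣n⇒n×x≈0 : ∀ {n} x → p ℕ∣.∣ n → n × x ≈ 0#
      p∣n⇒n×x≈0 {n} x (ℕ∣.divides k n≡kp) = begin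
        n × x ≈⟨ ×-congʳ n (*-identityˡ x) ⟨
        n × (1# * x) ≈⟨ ×-assoc-* n 1# x ⟨
        (n × 1#) * x ≡⟨ ≡.cong (λ t → t × 1# * x) n≡kp ⟩
        ((k ℕ.* p) × 1#) * x ≈⟨ *-congʳ (×1-homo-* k p) ⟩
        (k × 1#) * (p × 1#) * x ≈⟨ *-congʳ (trans (*-congˡ p×1≈0) (zeroʳ _)) ⟩
        0# * x ≈⟨ zeroˡ x ⟩
        0# ∎

      ^p-+ : ∀ x y → (x + y) ^ p ≈ x ^ p + y ^ p
      ^p-+ x y = expand (ℕₚ.suc-pred p {{prime⇒nonZero p-prime}}) p-prime
        where
        expand : ∀ {n} → suc n ≡ p → Prime p → (x + y) ^ p ≈ x ^ p + y ^ p
        expand {n} ≡.refl _ = begin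
          (x + y) ^ suc n ≈⟨ B.theorem (suc n) x y ⟩
          B.binomialExpansion x y (suc n) ≈⟨ ∑≈sum (B.binomialTerm x y (suc n)) ⟨
          ∑ (B.binomialTerm x y (suc n)) ≈⟨ ∑-suc _ ⟩
          B.binomialTerm x y (suc n) zero + ∑ (λ i → B.binomialTerm x y (suc n) (suc i)) ≈⟨ +-cong first (trans (∑-single (fromℕ n) middle) last) ⟩
          y ^ suc n + x ^ suc n ≈⟨ +-comm _ _ ⟩
          x ^ suc n + y ^ suc n ∎
          where
          first : B.binomialTerm x y (suc n) zero ≈ y ^ suc n
          first = trans (×-homo-1 _) (*-identityˡ _)
          middle : ∀ i → ¬ i ≡ fromℕ n → B.binomialTerm x y (suc n) (suc i) ≈ 0#
          middle i i≢n = p∣n⇒n×x≈0 _ (prime∣C p-prime (suc (toℕ i)) (ℕ.s≤s ℕ.z≤n)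
            (ℕ.s≤s (ℕₚ.≤∧≢⇒< (ℕₚ.≤-pred (Finₚ.toℕ<n i)) λ e → i≢n (Finₚ.toℕ-injective (≡.trans e (≡.sym (Finₚ.toℕ-fromℕ n)))))))
          last : B.binomialTerm x y (suc n) (suc (fromℕ n)) ≈ x ^ suc n
          last rewrite Finₚ.toℕ-fromℕ n | nCn≡1 (suc n) | ℕₚ.n∸n≡0 n = trans (×-homo-1 _) (*-identityʳ _)

      ^p^k-+ : ∀ k x y → (x + y) ^ (p ℕ.^ k) ≈ x ^ (p ℕ.^ k) + y ^ (p ℕ.^ k)
      ^p^k-+ zero x y = trans (*-identityʳ _) (sym (+-cong (*-identityʳ x) (*-identityʳ y)))
      ^p^k-+ (suc k) x y = begin
        (x + y) ^ (p ℕ.* p ℕ.^ k) ≈⟨ ^-assocʳ _ p (p ℕ.^ k) ⟨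
        ((x + y) ^ p) ^ (p ℕ.^ k) ≈⟨ ^-congˡ (p ℕ.^ k) (^p-+ x y) ⟩
        (x ^ p + y ^ p) ^ (p ℕ.^ k) ≈⟨ ^p^k-+ k _ _ ⟩
        (x ^ p) ^ (p ℕ.^ k) + (y ^ p) ^ (p ℕ.^ k) ≈⟨ +-cong (^-assocʳ x p (p ℕ.^ k)) (^-assocʳ y p (p ℕ.^ k)) ⟩
        x ^ (p ℕ.* p ℕ.^ k) + y ^ (p ℕ.* p ℕ.^ k) ∎

      ^p^k-∑ : ∀ k {n} (t : Fin n → Carrier) → ∑ t ^ (p ℕ.^ k) ≈ ∑ λ i → t i ^ (p ℕ.^ k)
      ^p^k-∑ k {zero} t = trans (^-congˡ (p ℕ.^ k) (∑-empty t)) (trans (0^n≈0 (p ℕ.^ k) {{ℕₚ.m^n≢0 p k {{prime⇒nonZero p-prime}}}}) (sym (∑-empty _)))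
        where
        0^n≈0 : ∀ n → .{{NonZero n}} → 0# ^ n ≈ 0#
        0^n≈0 (suc n) = zeroˡ _
      ^p^k-∑ k {suc n} t = trans (^-congˡ (p ℕ.^ k) (∑-suc t)) (trans (^p^k-+ k _ _)
        (trans (+-congˡ (^p^k-∑ k (t ∘ suc))) (sym (∑-suc _))))

  module Cancellation {c ℓ} (K : CommutativeRing c ℓ) (K-field : IsField K) where
    open CommutativeRing K

    *-cancelˡ : ∀ {a x y} → ¬ (a ≈ 0#) → a * x ≈ a * y → x ≈ y
    *-cancelˡ {a} {x} {y} a≉0 ax≈ay =
      let b , ab≈1 = proj₂ K-field a a≉0
          undo : ∀ z → b * (a * z) ≈ z
          undo z = trans (sym (*-assoc b a z)) (trans (*-congʳ (trans (*-comm b a) ab≈1)) (*-identityˡ z))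
      in trans (sym (undo x)) (trans (*-congˡ ax≈ay) (undo y))

    unit≉0 : ∀ {a b} → a * b ≈ 1# → ¬ (a ≈ 0#)
    unit≉0 ab≈1 a≈0 = proj₁ K-field (trans (sym ab≈1) (trans (*-congʳ a≈0) (zeroˡ _)))

  module FiniteField {c ℓ} (F : CommutativeRing c ℓ) (F-field : IsField F) {q : ℕ}
    (enum : Bijection (≡.setoid (Fin q)) (CommutativeRing.setoid F)) where
    open CommutativeRing F hiding (zero)
    open Powers F
    open SetoidReasoning (CommutativeRing.setoid F)
    open Mult semiring using (_×_; ×1-homo-*)
    open Cancellation F F-field
    private
      module Σ+ = MonoidSums +-commutativeMonoid
      module Σ* = MonoidSums *-commutativeMonoid

    element : Fin q → Carrier
    element = Bijection.to enum

    index : Carrier → Fin q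
    index a = proj₁ (Bijection.surjective enum a)

    element-index : ∀ a → element (index a) ≈ a
    element-index a = proj₂ (Bijection.surjective enum a) ≡.refl

    element-injective : ∀ {i j} → element i ≈ element j → i ≡ j
    element-injective = Bijection.injective enum

    index-cong : ∀ {a b} → a ≈ b → index a ≡ index b
    index-cong a≈b = element-injective (trans (element-index _) (trans a≈b (sym (element-index _))))

    infix 4 _≈?_
    _≈?_ : ∀ a b → Dec (a ≈ b)
    a ≈? b with index a Fin.≟ index b
    ... | yes eq = yes (trans (sym (element-index a)) (trans (reflexive (≡.cong element eq)) (element-index b)))
    ... | no neq = no (neq ∘ index-cong)

    1≉0 : ¬ (1# ≈ 0#)
    1≉0 = proj₁ F-field

    integral : ∀ {a b} → a * b ≈ 0# → ¬ (a ≈ 0#) → b ≈ 0#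
    integral {a} ab≈0 a≉0 = *-cancelˡ a≉0 (trans ab≈0 (sym (zeroʳ a)))

    permutation : (f g : Carrier → Carrier) → (∀ {a b} → a ≈ b → f a ≈ f b) → (∀ {a b} → a ≈ b → g a ≈ g b) →
      (∀ a → f (g a) ≈ a) → (∀ a → g (f a) ≈ a) → Perm.Permutation q q
    permutation f g f-cong g-cong fg gf = Perm.permutation (index ∘ f ∘ element) (index ∘ g ∘ element)
      (round f g f-cong fg) (round g f g-cong gf)
      where
      round : ∀ (f g : Carrier → Carrier) → (∀ {a b} → a ≈ b → f a ≈ f b) → (∀ a → f (g a) ≈ a) →
        ∀ i → index (f (element (index (g (element i))))) ≡ i
      round f g f-cong fg i = element-injective (trans (element-index _)
        (trans (f-cong (element-index _)) (fg (element i))))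

    -- Summing all elements before and after translation by 1.
    q×1≈0 : q × 1# ≈ 0#
    q×1≈0 = begin
      q × 1# ≈⟨ ∑-replicate q ⟨
      ∑ {q} (λ _ → 1#) ≈⟨ +-identityˡ _ ⟨
      0# + ∑ {q} (λ _ → 1#) ≈⟨ +-congʳ (-‿inverseˡ (∑ element)) ⟨
      - ∑ element + ∑ element + ∑ {q} (λ _ → 1#) ≈⟨ +-assoc _ _ _ ⟩
      - ∑ element + (∑ element + ∑ {q} (λ _ → 1#)) ≈⟨ +-congˡ (∑-∙ element (λ _ → 1#)) ⟨
      - ∑ element + ∑ (λ i → element i + 1#) ≈⟨ +-congˡ (∑-cong λ i → element-index _) ⟨
      - ∑ element + ∑ (λ i → element (index (element i + 1#))) ≈⟨ +-congˡ (∑-permute element translate) ⟨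
      - ∑ element + ∑ element ≈⟨ -‿inverseˡ _ ⟩
      0# ∎
      where
      open Σ+
      translate : Perm.Permutation q q
      translate = permutation (_+ 1#) (_- 1#) +-congʳ +-congʳ
        (λ a → trans (+-assoc a _ _) (trans (+-congˡ (-‿inverseˡ 1#)) (+-identityʳ a)))
        (λ a → trans (+-assoc a _ _) (trans (+-congˡ (-‿inverseʳ 1#)) (+-identityʳ a)))
      ∑-replicate : ∀ n → ∑ {n} (λ _ → 1#) ≈ n × 1#
      ∑-replicate zero = ∑-empty _
      ∑-replicate (suc n) = trans (∑-suc _) (+-congˡ (∑-replicate n))

    -- A field has no zero divisors, so the power p^k that kills 1 can be stripped down to p. This
    -- identifies the characteristic.
    p^k×1≈0⇒p×1≈0 : ∀ p k → (p ℕ.^ k) × 1# ≈ 0# → p × 1# ≈ 0#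
    p^k×1≈0⇒p×1≈0 p zero 1×1≈0 = contradiction (trans (sym (+-identityʳ 1#)) 1×1≈0) 1≉0
    p^k×1≈0⇒p×1≈0 p (suc k) p^1+k×1≈0 with p × 1# ≈? 0#
    ... | yes p×1≈0 = p×1≈0
    ... | no p×1≉0 = p^k×1≈0⇒p×1≈0 p k (integral (trans (sym (×1-homo-* p (p ℕ.^ k))) p^1+k×1≈0) p×1≉0)

    0^q≈0 : 0# ^ q ≈ 0#
    0^q≈0 = 0^n≈0 (index 0#)
      where
      0^n≈0 : ∀ {n} → Fin n → 0# ^ n ≈ 0#
      0^n≈0 {suc n} _ = zeroˡ _

    -- Multiplying all nonzero elements before and after multiplication by a.
    ^q-fixed : ∀ a → a ^ q ≈ a
    ^q-fixed a with a ≈? 0#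
    ... | yes a≈0 = trans (^-congˡ q a≈0) (trans 0^q≈0 (sym a≈0))
    ... | no a≉0 = begin
      a ^ q ≈⟨ ∏-replicate q ⟨
      ∏ {q} (λ _ → a) ≈⟨ ∑-cong split ⟩
      ∏ (λ i → scalar i * coscalar i) ≈⟨ ∑-∙ scalar coscalar ⟩
      ∏ scalar * ∏ coscalar ≈⟨ *-cong ∏scalar≈1 ∏coscalar≈a ⟩
      1# * a ≈⟨ *-identityˡ a ⟩
      a ∎
      where
      open Σ* renaming (∑ to ∏)
      b = proj₁ (proj₂ F-field a a≉0)
      ab≈1 = proj₂ (proj₂ F-field a a≉0)
      ba≈1 = trans (*-comm b a) ab≈1
      -- The products run over all q elements. `nonzero` puts 1 in place of the element 0; `scalar`
      -- collects the factors a belonging to nonzero elements, and `coscalar` the single one left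
      -- over at 0, which is why a ^ q comes out as a and not as 1.
      nonzero scalar coscalar : Fin q → Carrier
      nonzero i with element i ≈? 0#
      ... | yes _ = 1#
      ... | no _ = element i
      scalar i with element i ≈? 0#
      ... | yes _ = 1#
      ... | no _ = a
      coscalar i with element i ≈? 0#
      ... | yes _ = a
      ... | no _ = 1#
      split : ∀ i → a ≈ scalar i * coscalar i
      split i with element i ≈? 0#
      ... | yes _ = sym (*-identityˡ a)
      ... | no _ = sym (*-identityʳ a)
      ∏coscalar≈a : ∏ coscalar ≈ a
      ∏coscalar≈a = trans (∑-single (index 0#) off) on
        where
        off : ∀ i → ¬ i ≡ index 0# → coscalar i ≈ 1#
        off i i≢ with element i ≈? 0#
        ... | yes e≈0 = contradiction (element-injective (trans e≈0 (sym (element-index 0#)))) i≢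
        ... | no _ = refl
        on : coscalar (index 0#) ≈ a
        on with element (index 0#) ≈? 0#
        ... | yes _ = refl
        ... | no e≉0 = contradiction (element-index 0#) e≉0
      scale : Perm.Permutation q q
      scale = permutation (a *_) (b *_) *-congˡ *-congˡ
        (λ x → trans (sym (*-assoc a b x)) (trans (*-congʳ ab≈1) (*-identityˡ x)))
        (λ x → trans (sym (*-assoc b a x)) (trans (*-congʳ ba≈1) (*-identityˡ x)))
      nonzero-scale : ∀ i → nonzero (index (a * element i)) ≈ scalar i * nonzero i
      nonzero-scale i with element (index (a * element i)) ≈? 0# | element i ≈? 0#
      ... | yes _ | yes _ = sym (*-identityˡ 1#)
      ... | yes ae≈0 | no e≉0 = contradiction (integral (trans (sym (element-index _)) ae≈0) a≉0) e≉0
      ... | no ae≉0 | yes e≈0 = contradiction (trans (element-index _) (trans (*-congˡ e≈0) (zeroʳ a))) ae≉0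
      ... | no _ | no _ = element-index _
      ∏≉0 : ∀ {n} (t : Fin n → Carrier) → (∀ i → ¬ (t i ≈ 0#)) → ¬ (∏ t ≈ 0#)
      ∏≉0 {zero} t t≉0 e = 1≉0 (trans (sym (∑-empty t)) e)
      ∏≉0 {suc n} t t≉0 e = ∏≉0 (t ∘ suc) (t≉0 ∘ suc) (integral (trans (sym (∑-suc t)) e) (t≉0 zero))
      nonzero≉0 : ∀ i → ¬ (nonzero i ≈ 0#)
      nonzero≉0 i with element i ≈? 0#
      ... | yes _ = 1≉0
      ... | no e≉0 = e≉0
      ∏scalar≈1 : ∏ scalar ≈ 1#
      ∏scalar≈1 = *-cancelˡ (∏≉0 nonzero nonzero≉0) (begin
        ∏ nonzero * ∏ scalar ≈⟨ *-comm _ _ ⟩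
        ∏ scalar * ∏ nonzero ≈⟨ ∑-∙ scalar nonzero ⟨
        ∏ (λ i → scalar i * nonzero i) ≈⟨ ∑-cong nonzero-scale ⟨
        ∏ (λ i → nonzero (index (a * element i))) ≈⟨ ∑-permute nonzero scale ⟨
        ∏ nonzero ≈⟨ *-identityʳ _ ⟨
        ∏ nonzero * 1# ∎)
      ∏-replicate : ∀ n → ∏ {n} (λ _ → a) ≈ a ^ n
      ∏-replicate zero = ∑-empty _
      ∏-replicate (suc n) = trans (∑-suc _) (*-congˡ (∏-replicate n))

    ^q^k-fixed : ∀ k a → a ^ (q ℕ.^ k) ≈ a
    ^q^k-fixed zero a = *-identityʳ a
    ^q^k-fixed (suc k) a = trans (sym (^-assocʳ a q (q ℕ.^ k))) (trans (^-congˡ (q ℕ.^ k) (^q-fixed a)) (^q^k-fixed k a))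

-- Residue fields of a finite ring in which a^(1+s) = a.

module ResidueFields where

  open import Level using () renaming (suc to lsuc)
  open import Data.Nat.Divisibility using () renaming (_∣_ to _ℕ∣_)
  open import Data.Product using (∃; _,_; proj₁; proj₂; _×_)
  open Sums
  open CirculantAlgebra
  open FiniteFields

  -- R / Ann(e), with the elements of R as representatives.
  module QuotientByAnnihilator {c ℓ} (R : CommutativeRing c ℓ) (e : CommutativeRing.Carrier R) where
    open CommutativeRing R

    infix 4 _∼_
    _∼_ : Carrier → Carrier → Set ℓ
    x ∼ y = e * x ≈ e * y

    quotient : CommutativeRing c ℓ
    quotient = record
      { Carrier = Carrier ; _≈_ = _∼_ ; _+_ = _+_ ; _*_ = _*_ ; -_ = -_ ; 0# = 0# ; 1# = 1#
      ; isCommutativeRing = record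
        { isRing = record
          { +-isAbelianGroup = record
            { isGroup = record
              { isMonoid = record
                { isSemigroup = record
                  { isMagma = record
                    { isEquivalence = record { refl = refl ; sym = sym ; trans = trans }
                    ; ∙-cong = λ p q → trans (distribˡ e _ _) (trans (+-cong p q) (sym (distribˡ e _ _))) }
                  ; assoc = λ x y z → *-congˡ (+-assoc x y z) }
                ; identity = (λ x → *-congˡ (+-identityˡ x)) , λ x → *-congˡ (+-identityʳ x) }
              ; inverse = (λ x → *-congˡ (-‿inverseˡ x)) , λ x → *-congˡ (-‿inverseʳ x)
              ; ⁻¹-cong = λ p → trans (sym (-‿distribʳ-* e _)) (trans (-‿cong p) (-‿distribʳ-* e _)) }
            ; comm = λ x y → *-congˡ (+-comm x y) }
          ; *-cong = λ {x} {x′} {y} {y′} p q → trans (sym (*-assoc e x y)) (trans (*-congʳ p)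
              (trans (xy∙z≈xz∙y e x′ y) (trans (*-congʳ q) (trans (xy∙z≈xz∙y e y′ x′) (*-assoc e x′ y′)))))
          ; *-assoc = λ x y z → *-congˡ (*-assoc x y z)
          ; *-identity = (λ x → *-congˡ (*-identityˡ x)) , λ x → *-congˡ (*-identityʳ x)
          ; distrib = (λ x y z → *-congˡ (distribˡ x y z)) , λ x y z → *-congˡ (distribʳ x y z) }
        ; *-comm = λ x y → *-congˡ (*-comm x y) } }
      where
      open RingProperties ring
      open CSemigroup *-commutativeSemigroup using (xy∙z≈xz∙y)

    quotient-hom : ∀ {a b} {F : CommutativeRing a b} {ι} → Homomorphism F R ι → Homomorphism F quotient ι
    quotient-hom hom = record
      { isNearSemiringHomomorphism = record
        { +-isMonoidHomomorphism = record
          { isMagmaHomomorphism = record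
            { isRelHomomorphism = record { cong = λ p → *-congˡ (⟦⟧-cong p) }
            ; homo = λ a b → *-congˡ (+-homo a b) }
          ; ε-homo = *-congˡ 0#-homo }
        ; *-homo = λ a b → *-congˡ (*-homo a b) }
      ; 1#-homo = *-congˡ 1#-homo }
      where open IsSemiringHomomorphism hom

  -- In a finite ring with a ^ (1 + s) = a, every a ^ s is idempotent; refining an idempotent by all of
  -- these in turn leaves one, e, for which each e * a ^ s is 0 or e, so that R / Ann(e) is a field.
  module ResidueField {c ℓ} (R : CommutativeRing c ℓ) where
    open CommutativeRing R hiding (zero)
    open Powers R
    open SetoidReasoning setoid
    open CSemigroup *-commutativeSemigroup using (xy∙z≈xz∙y)

    module AtNonzero (_≈?_ : ∀ x y → Dec (x ≈ y)) {N} (r : Fin N → Carrier) (r-surjective : ∀ x → ∃ λ i → x ≈ r i)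
      (s : ℕ) .{{_ : NonZero s}} (^-fixed : ∀ x → x ^ suc s ≈ x) (h : Carrier) (h≉0 : ¬ h ≈ 0#) where

      ^s-idempotent : ∀ x → x ^ s * x ^ s ≈ x ^ s
      ^s-idempotent x = trans (*-congˡ (sym (^-congʳ x (ℕₚ.suc-pred s)))) (trans (*-comm _ _) (trans (*-assoc x _ _) (begin
        x * (x ^ ℕ.pred s * x ^ s) ≈⟨ *-congˡ (*-comm _ _) ⟩
        x * (x ^ s * x ^ ℕ.pred s) ≈⟨ *-assoc x _ _ ⟨
        x ^ suc s * x ^ ℕ.pred s ≈⟨ *-congʳ (^-fixed x) ⟩
        x * x ^ ℕ.pred s ≈⟨ ^-congʳ x (ℕₚ.suc-pred s) ⟩
        x ^ s ∎)))

      -- If e tˢ = 0 then e is kept; otherwise e tˢ replaces it, on which tˢ acts as the identity.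
      -- Both alternatives pass to multiples, so later refinements preserve the earlier ones; hence
      -- the witness that e′ is a multiple of e.
      refine : ∀ {n} (t : Fin n → Carrier) e → ¬ e ≈ 0# →
        ∃ λ e′ → ¬ e′ ≈ 0# × (∃ λ w → e′ ≈ e * w) × ∀ i → e′ * t i ^ s ≈ 0# ⊎ e′ * t i ^ s ≈ e′
      refine {zero} t e e≉0 = e , e≉0 , (1# , sym (*-identityʳ e)) , λ ()
      refine {suc n} t e e≉0 with (e * t zero ^ s) ≈? 0#
      ... | yes et≈0 with refine (t ∘ suc) e e≉0
      ... | e′ , e′≉0 , (w , e′≈ew) , p = e′ , e′≉0 , (w , e′≈ew) , λ where
        zero → inj₁ (trans (*-congʳ e′≈ew) (trans (xy∙z≈xz∙y e w _) (trans (*-congʳ et≈0) (zeroˡ w))))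
        (suc i) → p i
      refine {suc n} t e e≉0 | no et≉0 with refine (t ∘ suc) (e * t zero ^ s) et≉0
      ... | e′ , e′≉0 , (w , e′≈etw) , p = e′ , e′≉0 , (t zero ^ s * w , trans e′≈etw (*-assoc e _ w)) , λ where
        zero → inj₂ (begin
          e′ * t zero ^ s ≈⟨ *-congʳ e′≈etw ⟩
          e * t zero ^ s * w * t zero ^ s ≈⟨ xy∙z≈xz∙y _ w _ ⟩
          e * t zero ^ s * t zero ^ s * w ≈⟨ *-congʳ (trans (*-assoc e _ _) (*-congˡ (^s-idempotent (t zero)))) ⟩
          e * t zero ^ s * w ≈⟨ e′≈etw ⟨
          e′ ∎)
        (suc i) → p i

      private
        h^s≉0 : ¬ h ^ s ≈ 0#
        h^s≉0 h^s≈0 = h≉0 (trans (sym (^-fixed h)) (trans (*-congˡ h^s≈0) (zeroʳ h)))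

        -- Starting from h ^ s makes e a multiple of h ^ s, so that e h ^ s = e and h stays nonzero
        -- in the quotient.
        refined = refine r (h ^ s) h^s≉0

      e : Carrier
      e = proj₁ refined

      open QuotientByAnnihilator R e public

      private
        e≉0 : ¬ e ≈ 0#
        e≉0 = proj₁ (proj₂ refined)

        e-dichotomy : ∀ x → e * x ^ s ≈ 0# ⊎ e * x ^ s ≈ e
        e-dichotomy x with r-surjective x
        ... | i , x≈rᵢ with proj₂ (proj₂ (proj₂ refined)) i
        ... | inj₁ p = inj₁ (trans (*-congˡ (^-congˡ s x≈rᵢ)) p)
        ... | inj₂ p = inj₂ (trans (*-congˡ (^-congˡ s x≈rᵢ)) p)

      _∼?_ : ∀ x y → Dec (x ∼ y)
      x ∼? y = (e * x) ≈? (e * y)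

      quotient-field : IsField quotient
      quotient-field = (λ 1∼0 → e≉0 (trans (sym (*-identityʳ e)) (trans 1∼0 (zeroʳ e)))) , inverse
        where
        inverse : ∀ x → ¬ x ∼ 0# → ∃ λ y → x * y ∼ 1#
        inverse x x≁0 with e-dichotomy x
        ... | inj₁ ex^s≈0 = contradiction (begin
          e * x ≈⟨ *-congˡ (^-fixed x) ⟨
          e * (x * x ^ s) ≈⟨ *-congˡ (*-comm x _) ⟩
          e * (x ^ s * x) ≈⟨ *-assoc e _ x ⟨
          e * x ^ s * x ≈⟨ *-congʳ ex^s≈0 ⟩
          0# * x ≈⟨ zeroˡ x ⟩
          0# ≈⟨ zeroʳ e ⟨
          e * 0# ∎) x≁0
        ... | inj₂ ex^s≈e = x ^ ℕ.pred s , trans (*-congˡ (^-congʳ x (ℕₚ.suc-pred s))) (trans ex^s≈e (sym (*-identityʳ e)))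

      h≁0 : ¬ h ∼ 0#
      h≁0 h∼0 with proj₁ (proj₂ (proj₂ refined))
      ... | w , e≈h^sw = e≉0 (begin
        e ≈⟨ e≈h^sw ⟩
        h ^ s * w ≈⟨ *-congʳ (^s-idempotent h) ⟨
        h ^ s * h ^ s * w ≈⟨ xy∙z≈xz∙y _ _ w ⟩
        h ^ s * w * h ^ s ≈⟨ *-congʳ e≈h^sw ⟨
        e * h ^ s ≈⟨ *-congˡ (^-congʳ h (ℕₚ.suc-pred s)) ⟨
        e * (h * h ^ ℕ.pred s) ≈⟨ *-assoc e h _ ⟨
        e * h * h ^ ℕ.pred s ≈⟨ *-congʳ (trans h∼0 (zeroʳ e)) ⟩
        0# * h ^ ℕ.pred s ≈⟨ zeroˡ _ ⟩
        0# ∎)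

-- A polynomial vanishing at all M-th roots of unity that are not primitive.

module PrimitivePart where

  open import Level using (_⊔_) renaming (suc to lsuc)
  open import Data.Nat.Divisibility using (_∣_; divides; ∣⇒≤; ∣-trans; m∣m*n; ∣m+n∣m⇒∣n; *-cancelˡ-∣; _∣?_; m%n≡0⇒n∣m)
  open import Data.Nat.DivMod using (_mod_)
  open import Data.Nat.GCD using (module Bézout; module GCD; gcd; gcd[m,n]∣m; gcd[m,n]∣n; gcd-GCD)
  open import Data.Nat.Primality using (Prime; prime?; euclidsLemma; prime⇒nonZero; prime⇒nonTrivial)
  open import Data.Nat.Primality.Factorisation using (factorise)
  open import Data.Nat.Tactic.RingSolver using (solve-∀)
  open import Data.List using ([]; _∷_)
  open import Data.Nat.ListAction using (product)
  open import Data.List.Relation.Unary.All using ([]; _∷_)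
  open import Data.Product using (∃; _,_; proj₁; proj₂; _×_)
  open import Relation.Binary.PropositionalEquality as ≡ using (_≡_; _≢_)
  open Sums
  open CirculantAlgebra
  open FiniteFields
  open ResidueFields

  primeDivisor : ∀ t → .{{NonZero t}} → t ≢ 1 → ∃ λ p → Prime p × p ∣ t
  primeDivisor t t≢1 with factorise t
  ... | record { factors = [] ; isFactorisation = t≡1 } = contradiction t≡1 t≢1
  ... | record { factors = p ∷ ps ; isFactorisation = t≡ ; factorsPrime = pr ∷ _ } =
    p , pr , divides (product ps) (≡.trans t≡ (ℕₚ.*-comm p _))

  module _ {c ℓ} (R : CommutativeRing c ℓ) where
    open CommutativeRing R
    open Powers R

    ^-multiple : ∀ {z} k n → z ^ n ≈ 1# → z ^ (k ℕ.* n) ≈ 1#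
    ^-multiple {z} k n z^n≈1 = trans (^-congʳ z (ℕₚ.*-comm k n)) (trans (sym (^-assocʳ z n k))
      (trans (^-congˡ k z^n≈1) (1^n≈1 k)))

    private
      ^-difference : ∀ {z} d x y m n → z ^ m ≈ 1# → z ^ n ≈ 1# → d ℕ.+ y ℕ.* n ≡ x ℕ.* m → z ^ d ≈ 1#
      ^-difference {z} d x y m n z^m≈1 z^n≈1 eq = trans (sym (*-identityʳ _)) (trans (*-congˡ (sym (^-multiple y n z^n≈1)))
        (trans (sym (^-homo-* z d (y ℕ.* n))) (trans (^-congʳ z eq) (^-multiple x m z^m≈1))))

    ^-gcd : ∀ {z} a b → z ^ a ≈ 1# → z ^ b ≈ 1# → z ^ gcd a b ≈ 1#
    ^-gcd {z} a b z^a≈1 z^b≈1 with Bézout.identity (gcd-GCD a b)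
    ... | Bézout.+- x y eq = ^-difference (gcd a b) x y a b z^a≈1 z^b≈1 eq
    ... | Bézout.-+ x y eq = ^-difference (gcd a b) y x b a z^b≈1 z^a≈1 eq

    -- If z^d = 1 with 0 < d < M, then z^g = 1 for the proper divisor g = gcd(d, M) of M. A prime p
    -- dividing M / g makes M / p a multiple of g, so that z^(M/p) = 1 as well.
    exact-order : ∀ {z} M → .{{NonZero M}} → z ^ M ≈ 1# →
      (∀ p s → Prime p → M ≡ s ℕ.* p → ¬ z ^ s ≈ 1#) → ∀ d → 0 ℕ.< d → d ℕ.< M → ¬ z ^ d ≈ 1#
    exact-order {z} M z^M≈1 p-power≉1 d 0<d d<M z^d≈1 with gcd[m,n]∣n d M
    ... | divides t M≡td′ with primeDivisor t {{ℕ.≢-nonZero t≢0}} t≢1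
      where
      t≢0 : t ≢ 0
      t≢0 ≡.refl = ℕ.≢-nonZero⁻¹ M M≡td′
      t≢1 : t ≢ 1
      t≢1 ≡.refl = ℕₚ.<⇒≱ d<M (ℕₚ.≤-trans (ℕₚ.≤-reflexive (≡.trans M≡td′ (ℕₚ.*-identityˡ _)))
        (∣⇒≤ {{ℕ.>-nonZero 0<d}} (gcd[m,n]∣m d M)))
    ... | p , pr , divides u t≡up = p-power≉1 p (u ℕ.* gcd d M) pr
      (≡.trans M≡td′ (≡.trans (≡.cong (ℕ._* gcd d M) t≡up) (rearrange u p (gcd d M))))
      (^-multiple u (gcd d M) (^-gcd d M z^d≈1 z^M≈1))
      where
      rearrange : ∀ u p g → u ℕ.* p ℕ.* g ≡ u ℕ.* g ℕ.* p
      rearrange = solve-∀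

  module PrimitiveElement {c ℓ} (F : CommutativeRing c ℓ) (F-field : IsField F) (M : ℕ) .{{_ : NonZero M}} where
    open CommutativeRing F hiding (zero)
    open Circulant F M using (Poly; _≈P_; _*P_; xpow; 1P)
    open CirculantRing F M
    private module P = CommutativeRing circulantRing
    open RingProperties ring

    shift : ∀ s p n → (xpow s *P p) ((n ℕ.+ s) mod M) ≈ p (n mod M)
    shift s p n = trans (coefficient (xpow s) p ((n ℕ.+ s) mod M)) (trans
      (pair-xpow-periodic s λ i → pair-congʳ p λ j → xpow-cong (%-+ˡ M i j) ((n ℕ.+ s) mod M))
      (trans (pair-congʳ p translate) (pair-coefficient p (n mod M))))
      where
      index : ∀ n → toℕ (n mod M) ≡ n % M
      index n = toℕ-mod n M
      translate : ∀ j → xpow (s ℕ.+ j) ((n ℕ.+ s) mod M) ≈ xpow j (n mod M)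
      translate j with toℕ ((n ℕ.+ s) mod M) ℕ.≟ (s ℕ.+ j) % M | toℕ (n mod M) ℕ.≟ j % M
      ... | yes _ | yes _ = refl
      ... | no _ | no _ = refl
      ... | yes p | no ¬p = contradiction (≡.trans (index n) (%-cancelʳ-+ M s (≡.trans (≡.sym (index (n ℕ.+ s)))
        (≡.trans p (≡.cong (_% M) (ℕₚ.+-comm s j)))))) ¬p
      ... | no ¬p | yes p = contradiction (≡.trans (index (n ℕ.+ s)) (≡.trans (≡.sym (%-+ˡ M n s))
        (≡.trans (≡.cong (λ t → (t ℕ.+ s) % M) (≡.trans (≡.sym (index n)) p))
          (≡.trans (%-+ˡ M j s) (≡.cong (_% M) (ℕₚ.+-comm j s)))))) ¬p

    mod-cong : ∀ {k l} → k % M ≡ l % M → k mod M ≡ l mod M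
    mod-cong {k} {l} eq = Finₚ.toℕ-injective (≡.trans (toℕ-mod k M) (≡.trans eq (≡.sym (toℕ-mod l M))))

    -- The product of x ^ (M / p) - 1 over the primes p ≤ n dividing M. With P the product of these p, its
    -- exponents are multiples of M / P, and no cancellation reaches the constant coefficient ±1,
    -- since M / p is not a multiple of M / P for p ∤ P.
    record Stage (n : ℕ) : Set (c ⊔ ℓ) where
      field
        h : Poly
        P : ℕ
        support : ∀ j → ¬ M ∣ j ℕ.* P → h (j mod M) ≈ 0#
        nonvanishing : ¬ h (0 mod M) ≈ 0#
        prime-bound : ∀ p → Prime p → p ∣ P → p ℕ.≤ n
        factor : ∀ p s → Prime p → p ℕ.≤ n → M ≡ s ℕ.* p → ∃ λ w → h ≈P (xpow s P.- 1P) *P w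

    stage-zero : Stage 0
    stage-zero = record
      { h = 1P ; P = 1
      ; support = support
      ; nonvanishing = λ 1≈0 → proj₁ F-field (trans (sym one) 1≈0)
      ; prime-bound = λ p pr p∣1 → contradiction (∣⇒≤ p∣1) (ℕₚ.<⇒≱ (ℕ.nonTrivial⇒n>1 p {{prime⇒nonTrivial pr}}))
      ; factor = λ p s pr p≤0 → contradiction p≤0 (ℕₚ.<⇒≱ (ℕ.>-nonZero⁻¹ p {{prime⇒nonZero pr}})) }
      where
      support : ∀ j → ¬ M ∣ j ℕ.* 1 → 1P (j mod M) ≈ 0#
      support j M∤j with toℕ (j mod M) ℕ.≟ 0 % M
      ... | yes p = contradiction (≡.subst (M ∣_) (≡.sym (ℕₚ.*-identityʳ j)) (m%n≡0⇒n∣m j M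
                      (≡.trans (≡.sym (toℕ-mod j M)) (≡.trans p (ℕ÷.m*n%n≡0 0 M))))) M∤j
      ... | no _ = refl
      one : 1P (0 mod M) ≈ 1#
      one with toℕ (0 mod M) ℕ.≟ 0 % M
      ... | yes _ = refl
      ... | no ¬p = contradiction (toℕ-mod 0 M) ¬p

    stage-skip : ∀ {n} → Stage n → ¬ (Prime (suc n) × suc n ∣ M) → Stage (suc n)
    stage-skip {n} S skip = record
      { h = h ; P = P ; support = support ; nonvanishing = nonvanishing
      ; prime-bound = λ p pr p∣P → ℕₚ.m≤n⇒m≤1+n (prime-bound p pr p∣P)
      ; factor = λ p s pr p≤1+n M≡sp → factor p s pr
          (ℕₚ.≤-pred (ℕₚ.≤∧≢⇒< p≤1+n λ { ≡.refl → skip (pr , divides s M≡sp) })) M≡sp }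
      where open Stage S

    stage-prime : ∀ {n} → Stage n → Prime (suc n) → suc n ∣ M → Stage (suc n)
    stage-prime {n} S p-prime (divides s M≡sp) = record
      { h = h′ ; P = P ℕ.* p
      ; support = λ j M∤jPp → trans (h′-coefficient j) (trans
          (+-cong (support (j ℕ.+ s ℕ.* n) λ M∣ → M∤jPp (remove j M∣)) (-‿cong (support j λ M∣ → M∤jPp
            (≡.subst (M ∣_) (ℕₚ.*-assoc j P p) (∣-trans M∣ (m∣m*n p))))))
          (-‿inverseʳ 0#))
      ; nonvanishing = λ h′0≈0 → nonvanishing (-‿injective (trans (sym (trans (h′-coefficient 0)
          (trans (+-congʳ (support (s ℕ.* n) M∤snP)) (+-identityˡ _)))) (trans h′0≈0 (sym -0#≈0#))))
      ; prime-bound = λ r r-prime r∣Pp → bound r r-prime (euclidsLemma P p r-prime r∣Pp)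
      ; factor = factor′ }
      where
      open Stage S
      p = suc n
      δ : ℕ → Poly
      δ s = xpow s P.- 1P
      h′ : Poly
      h′ = δ s *P h
      -- Since M = s (n + 1), the index j + s n stands for j - s modulo M.
      h′-coefficient : ∀ j → h′ (j mod M) ≈ h ((j ℕ.+ s ℕ.* n) mod M) - h (j mod M)
      h′-coefficient j = trans (P.distribʳ h (xpow s) (P.- 1P) (j mod M)) (+-cong
        (trans (reflexive (≡.cong (xpow s *P h) (mod-cong {j} {j ℕ.+ s ℕ.* n ℕ.+ s} full-turn))) (shift s h (j ℕ.+ s ℕ.* n)))
        (trans (RingProperties.-1*x≈-x P.ring h (j mod M)) refl))
        where
        full-turn : j % M ≡ (j ℕ.+ s ℕ.* n ℕ.+ s) % M
        full-turn = ≡.trans (≡.sym (ℕ÷.[m+n]%n≡m%n j M)) (≡.cong (_% M) (≡.trans (≡.cong (j ℕ.+_) M≡sp) (regroup j s n)))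
          where
          regroup : ∀ j s n → j ℕ.+ s ℕ.* suc n ≡ j ℕ.+ s ℕ.* n ℕ.+ s
          regroup = solve-∀
      remove : ∀ j → M ∣ (j ℕ.+ s ℕ.* n) ℕ.* P → M ∣ j ℕ.* (P ℕ.* p)
      remove j M∣ = ∣m+n∣m⇒∣n (≡.subst (M ∣_) (trade j) (∣-trans M∣ (m∣m*n p))) (divides (n ℕ.* P) ≡.refl)
        where
        regroup : ∀ j s n P p → (j ℕ.+ s ℕ.* n) ℕ.* P ℕ.* p ≡ n ℕ.* P ℕ.* (s ℕ.* p) ℕ.+ j ℕ.* (P ℕ.* p)
        regroup = solve-∀
        trade : ∀ j → (j ℕ.+ s ℕ.* n) ℕ.* P ℕ.* p ≡ n ℕ.* P ℕ.* M ℕ.+ j ℕ.* (P ℕ.* p)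
        trade j = ≡.trans (regroup j s n P p) (≡.cong (λ t → n ℕ.* P ℕ.* t ℕ.+ j ℕ.* (P ℕ.* p)) (≡.sym M≡sp))
      s≢0 : s ≢ 0
      s≢0 ≡.refl = ℕ.≢-nonZero⁻¹ M M≡sp
      -- The shifted copy of h misses the constant coefficient: M ∣ s n P would give p ∣ n P, but n
      -- < p and all primes dividing P are at most n. The constant coefficient therefore only
      -- changes sign.
      M∤snP : ¬ M ∣ s ℕ.* n ℕ.* P
      M∤snP M∣ with euclidsLemma n P p-prime (*-cancelˡ-∣ s {{ℕ.≢-nonZero s≢0}}
                      (≡.subst₂ _∣_ M≡sp (ℕₚ.*-assoc s n P) M∣))
      ... | inj₂ p∣P = ℕₚ.1+n≰n (prime-bound p p-prime p∣P)
      ... | inj₁ p∣n = ℕₚ.1+n≰n (∣⇒≤ {{ℕ.≢-nonZero λ { ≡.refl → ℕ.nonTrivial⇒≢1 {{prime⇒nonTrivial p-prime}} ≡.refl }}} p∣n)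
      bound : ∀ r → Prime r → r ∣ P ⊎ r ∣ p → r ℕ.≤ p
      bound r r-prime (inj₁ r∣P) = ℕₚ.m≤n⇒m≤1+n (prime-bound r r-prime r∣P)
      bound r r-prime (inj₂ r∣p) = ∣⇒≤ r∣p
      factor′ : ∀ r t → Prime r → r ℕ.≤ p → M ≡ t ℕ.* r → ∃ λ w → h′ ≈P δ t *P w
      factor′ r t r-prime r≤p M≡tr with r ℕ.≟ p
      ... | yes ≡.refl = h , P.reflexive (≡.cong (λ u → δ u *P h) (ℕₚ.*-cancelʳ-≡ s t p (≡.trans (≡.sym M≡sp) M≡tr)))
      ... | no r≢p = let w , h≈ = factor r t r-prime (ℕₚ.≤-pred (ℕₚ.≤∧≢⇒< r≤p r≢p)) M≡tr in
        δ s *P w , P.trans (P.*-congˡ {δ s} h≈) (x∙yz≈y∙xz (δ s) (δ t) w)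
        where open CSemigroup P.*-commutativeSemigroup using (x∙yz≈y∙xz)

    stage : ∀ n → Stage n
    stage zero = stage-zero
    stage (suc n) with prime? (suc n) | suc n ∣? M
    ... | yes pr | yes p∣M = stage-prime (stage n) pr p∣M
    ... | no ¬pr | _ = stage-skip (stage n) (¬pr ∘ proj₁)
    ... | _ | no p∤M = stage-skip (stage n) (p∤M ∘ proj₂)

    primitivePart : ∃ λ h → ¬ (∀ k → h k ≈ 0#) ×
      ∀ p s → Prime p → M ≡ s ℕ.* p → ∃ λ w → h ≈P (xpow s P.- 1P) *P w
    primitivePart = h , (λ h≈0 → nonvanishing (h≈0 (0 mod M))) , λ p s pr M≡sp →
      factor p s pr (∣⇒≤ (divides s M≡sp)) M≡sp
      where open Stage (stage M)

-- An extension field with an element of order M.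

module RootExtensions where

  open import Level using (_⊔_) renaming (suc to lsuc)
  open import Data.Nat.Primality using (Prime)
  open import Data.Product using (∃; _,_; proj₁; proj₂)
  open import Relation.Binary.PropositionalEquality as ≡ using (_≡_)
  open Sums
  open CirculantAlgebra
  open FiniteFields
  open ResidueFields
  open PrimitivePart

  -- K plays the role of the field with M + 1 elements, and g that of a generator of its
  -- multiplicative group.
  record RootExtension {c ℓ} (F : CommutativeRing c ℓ) (M : ℕ) : Set (lsuc (c ⊔ ℓ)) where
    field
      K : CommutativeRing c ℓ
    open CommutativeRing K
    open Powers K
    field
      isField : IsField K
      _≈?_ : ∀ x y → Dec (x ≈ y)
      ι : CommutativeRing.Carrier F → Carrier
      hom : Homomorphism F K ι
      g : Carrier
      g^M≈1 : g ^ M ≈ 1#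
      g-exact : ∀ d → 0 ℕ.< d → d ℕ.< M → ¬ g ^ d ≈ 1#

  module Extension {c ℓ} (F : CommutativeRing c ℓ) (F-field : IsField F) {q : ℕ}
    (enum : Bijection (≡.setoid (Fin q)) (CommutativeRing.setoid F)) (q-primePower : IsPrimePower q)
    (d M : ℕ) .{{_ : NonZero M}} (q^d≡1+M : q ℕ.^ d ≡ suc M) where

    private module F = CommutativeRing F
    open FiniteField F F-field enum
    open Circulant F M using (Poly; _*P_; xpow; 1P)
    open CirculantRing F M
    open CommutativeRing circulantRing hiding (zero)
    open Powers circulantRing
    open FiniteSums commutativeSemiring
    open HomomorphicSums F circulantRing constant-hom
    open Mult semiring using (_×_)
    open SetoidReasoning setoid
    private
      p = proj₁ q-primePower
      k = proj₁ (proj₂ q-primePower)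
      p-prime : Prime p
      p-prime = proj₁ (proj₂ (proj₂ q-primePower))
      q≡p^k : q ≡ p ℕ.^ k
      q≡p^k = proj₂ (proj₂ (proj₂ (proj₂ q-primePower)))

      p×1≈0 : p × 1# ≈ 0#
      p×1≈0 = trans (sym (homo-×1 p)) (trans (⟦⟧-cong (p^k×1≈0⇒p×1≈0 p k
        (F.trans (F.reflexive (≡.cong (_×ᶠ F.1#) (≡.sym q≡p^k))) q×1≈0))) 0#-homo)
        where
        open IsSemiringHomomorphism constant-hom
        open Mult F.semiring using () renaming (_×_ to _×ᶠ_)

      p^kd≡1+M : p ℕ.^ (k ℕ.* d) ≡ suc M
      p^kd≡1+M = ≡.trans (≡.sym (ℕₚ.^-*-assoc p k d)) (≡.trans (≡.cong (ℕ._^ d) (≡.sym q≡p^k)) q^d≡1+M)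

    -- The exponent 1 + M is a power of the characteristic, so the power map is additive; it fixes
    -- the coefficients, which lie in F, and the monomials, because x^M = 1.
    ^-fixed : ∀ a → a ^ suc M ≈ a
    ^-fixed a = begin
      a ^ suc M ≈⟨ ^-congˡ (suc M) (expansion a) ⟩
      ∑ (λ j → constant (a j) *P xpow (toℕ j)) ^ suc M ≈⟨ ^-congʳ _ p^kd≡1+M ⟨
      ∑ (λ j → constant (a j) *P xpow (toℕ j)) ^ (p ℕ.^ (k ℕ.* d)) ≈⟨ Frobenius.^p^k-∑ circulantRing p-prime p×1≈0 (k ℕ.* d) _ ⟩
      ∑ (λ j → (constant (a j) *P xpow (toℕ j)) ^ (p ℕ.^ (k ℕ.* d))) ≈⟨ ∑-cong (λ j → trans (^-congʳ (constant (a j) *P xpow (toℕ j)) p^kd≡1+M) (term j)) ⟩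
      ∑ (λ j → constant (a j) *P xpow (toℕ j)) ≈⟨ expansion a ⟨
      a ∎
      where
      term : ∀ j → (constant (a j) *P xpow (toℕ j)) ^ suc M ≈ constant (a j) *P xpow (toℕ j)
      term j = trans (CExp.^-distrib-* commutativeSemiring (constant (a j)) (xpow (toℕ j)) (suc M)) (*-cong
        {constant (a j) ^ suc M} {constant (a j)} {xpow (toℕ j) ^ suc M} {xpow (toℕ j)}
        (trans (sym (homo-^ (a j) (suc M))) (IsSemiringHomomorphism.⟦⟧-cong constant-hom
          (F.trans (Powers.^-congʳ F (a j) (≡.sym q^d≡1+M)) (^q^k-fixed d (a j)))))
        (trans (xpow-^ (toℕ j) (suc M)) (xpow-cong (≡.trans (≡.cong (λ t → (toℕ j ℕ.+ t) % M) (ℕₚ.*-comm M (toℕ j)))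
          (ℕ÷.[m+kn]%n≡m%n (toℕ j) (toℕ j) M)))))

    private
      decide : ∀ a b → Dec (a ≈ b)
      decide a b = Finₚ.all? λ j → a j ≈? b j

      polynomial : Fin (q ℕ.^ M) → Poly
      polynomial i = element ∘ finToFun i

      polynomial-surjective : ∀ a → ∃ λ i → a ≈ polynomial i
      polynomial-surjective a = funToFin (index ∘ a) , λ j → F.trans (F.sym (element-index (a j)))
        (F.reflexive (≡.cong element (≡.sym (Finₚ.finToFun-funToFin (index ∘ a) j))))

      open PrimitiveElement F F-field M
      h = proj₁ primitivePart
      open ResidueField.AtNonzero circulantRing decide polynomial polynomial-surjective M ^-fixed h (proj₁ (proj₂ primitivePart))
      module K = CommutativeRing quotient
      module KP = Powers quotient

    opaque
      rootExtension : RootExtension F M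
      rootExtension = record
        { K = quotient ; isField = quotient-field ; _≈?_ = _∼?_
        ; ι = constant ; hom = quotient-hom {F = F} {constant} constant-hom
        ; g = xpow 1 ; g^M≈1 = g^M∼1
        -- For M = s r with r prime, x^s - 1 divides h; were g^s = 1 in the quotient, h would vanish
        -- there.
        ; g-exact = exact-order quotient {xpow 1} M g^M∼1 λ r s r-prime M≡sr g^s∼1 →
            let w , h≈ = proj₂ (proj₂ primitivePart) r s r-prime M≡sr in
            h≁0 (K.trans {h} {(xpow s - 1P) *P w} {0#} (*-congˡ {e} {h} {(xpow s - 1P) *P w} h≈)
              (K.trans {(xpow s - 1P) *P w} {0# *P w} {0#} (K.*-congʳ {w} {xpow s - 1P} {0#}
                (K.trans {xpow s - 1P} {1P - 1P} {0#} (K.+-congʳ { - 1P} {xpow s} {1P} (K.trans {xpow s} {xpow 1 KP.^ s} {1P} (*-congˡ {e} (sym (power s))) g^s∼1))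
                  (*-congˡ {e} (-‿inverseʳ 1P)))) (*-congˡ {e} (zeroˡ w)))) }
        where
        same-power : ∀ x s → x KP.^ s ≡ x ^ s
        same-power x zero = ≡.refl
        same-power x (suc s) = ≡.cong (x *P_) (same-power x s)
        power : ∀ s → xpow 1 KP.^ s ≈ xpow s
        power s = trans (reflexive (same-power (xpow 1) s)) (trans (xpow-^ 1 s) (xpow-cong (≡.cong (_% M) (ℕₚ.*-identityʳ s))))
        g^M∼1 : xpow 1 KP.^ M ∼ 1P
        g^M∼1 = *-congˡ {e} (trans (power M) (xpow-cong (≡.trans (ℕ÷.n%n≡0 M) (≡.sym (ℕ÷.m*n%n≡0 0 M)))))

-- Congruences modulo M and roots of unity in a field.

module RootsAndCongruences where

  open import Data.Nat.Divisibility using (divides) renaming (_∣_ to _ℕ∣_; m%n≡0⇒n∣m to m%n≡0⇒n∣m; ∣m∣n⇒∣m+n to ℕ∣m∣n⇒∣m+n; n∣m⇒m%n≡0 to n∣m⇒m%n≡0; ∣⇒≤ to ℕ∣⇒≤; _∣?_ to _ℕ∣?_)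
  open import Data.Integer as ℤ using (ℤ; +_)
  open import Data.Integer.Tactic.RingSolver using (solve-∀)
  open import Data.Product using (∃; _,_)
  open import Relation.Binary.PropositionalEquality as ≡ using (_≡_)
  open Sums
  open SelfDuality using (_≡_mod[_]; congruent; difference)
  open CirculantAlgebra
  open FiniteFields using (module Cancellation)

  module _ {M : ℕ} where

    mod-refl : ∀ {a} → a ≡ a mod[ M ]
    mod-refl {a} = congruent (ℤ∣.divides (+ 0) (ℤₚ.+-inverseʳ a))

    mod-reflexive : ∀ {a b} → a ≡ b → a ≡ b mod[ M ]
    mod-reflexive ≡.refl = mod-refl

    mod-sym : ∀ {a b} → a ≡ b mod[ M ] → b ≡ a mod[ M ]
    mod-sym {a} {b} (congruent p) = congruent (≡.subst (+ M ℤ∣.∣_) (flip a b) (ℤ∣.∣m⇒∣-m p))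
      where
      flip : ∀ a b → ℤ.- (a ℤ.- b) ≡ b ℤ.- a
      flip = solve-∀

    mod-trans : ∀ {a b c} → a ≡ b mod[ M ] → b ≡ c mod[ M ] → a ≡ c mod[ M ]
    mod-trans {a} {b} {c} (congruent p) (congruent q) =
      congruent (≡.subst (+ M ℤ∣.∣_) (telescope a b c) (ℤ∣.∣m∣n⇒∣m+n p q))
      where
      telescope : ∀ a b c → a ℤ.- b ℤ.+ (b ℤ.- c) ≡ a ℤ.- c
      telescope = solve-∀

    mod-+ : ∀ {a a′ b b′} → a ≡ a′ mod[ M ] → b ≡ b′ mod[ M ] → a ℤ.+ b ≡ a′ ℤ.+ b′ mod[ M ]
    mod-+ {a} {a′} {b} {b′} (congruent p) (congruent q) =
      congruent (≡.subst (+ M ℤ∣.∣_) (regroup a a′ b b′) (ℤ∣.∣m∣n⇒∣m+n p q))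
      where
      regroup : ∀ a a′ b b′ → a ℤ.- a′ ℤ.+ (b ℤ.- b′) ≡ a ℤ.+ b ℤ.- (a′ ℤ.+ b′)
      regroup = solve-∀

    mod-*ˡ : ∀ {a b} c → a ≡ b mod[ M ] → c ℤ.* a ≡ c ℤ.* b mod[ M ]
    mod-*ˡ {a} {b} c (congruent p) = congruent (≡.subst (+ M ℤ∣.∣_) (distribute c a b) (ℤ∣.∣n⇒∣m*n c p))
      where
      distribute : ∀ c a b → c ℤ.* (a ℤ.- b) ≡ c ℤ.* a ℤ.- c ℤ.* b
      distribute = solve-∀

    mod-neg : ∀ {a b} → a ≡ b mod[ M ] → ℤ.- a ≡ ℤ.- b mod[ M ]
    mod-neg {a} {b} (congruent p) = congruent (≡.subst (+ M ℤ∣.∣_) (distribute a b) (ℤ∣.∣m⇒∣-m p))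
      where
      distribute : ∀ a b → ℤ.- (a ℤ.- b) ≡ ℤ.- a ℤ.- ℤ.- b
      distribute = solve-∀

    ≡0-mod⇒∣ : ∀ {a} → a ≡ + 0 mod[ M ] → + M ℤ∣.∣ a
    ≡0-mod⇒∣ {a} (congruent p) = ≡.subst (+ M ℤ∣.∣_) (ℤₚ.+-identityʳ a) p

    %ℕ-mod : .{{_ : NonZero M}} → ∀ a → + (a ℤ÷.%ℕ M) ≡ a mod[ M ]
    %ℕ-mod a = mod-sym (congruent (ℤ∣.divides (a ℤ÷./ℕ M)
      (≡.trans (≡.cong (ℤ._- + (a ℤ÷.%ℕ M)) (ℤ÷.a≡a%ℕn+[a/ℕn]*n a M)) (cancel (+ (a ℤ÷.%ℕ M)) (a ℤ÷./ℕ M ℤ.* + M)))))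
      where
      cancel : ∀ r t → r ℤ.+ t ℤ.- r ≡ t
      cancel = solve-∀

    private
      +-difference : ∀ x t → + (x ℕ.+ t) ℤ.- + x ≡ + t
      +-difference x t = ≡.trans (≡.cong (ℤ._- + x) (ℤₚ.pos-+ x t)) (cancel (+ x) (+ t))
        where
        cancel : ∀ r t → r ℤ.+ t ℤ.- r ≡ t
        cancel = solve-∀

    +-mod⇒∣ : ∀ x t → + x ≡ + (x ℕ.+ t) mod[ M ] → M ℕ∣ t
    +-mod⇒∣ x t p = ℤ∣.∣⇒∣ᵤ (≡.subst (+ M ℤ∣.∣_) (+-difference x t) (difference (mod-sym p)))

    ∣⇒+-mod : ∀ x t → M ℕ∣ t → + x ≡ + (x ℕ.+ t) mod[ M ]
    ∣⇒+-mod x t p = mod-sym (congruent (≡.subst (+ M ℤ∣.∣_) (≡.sym (+-difference x t)) (ℤ∣.∣ᵤ⇒∣ p)))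

  -- The functions on ℤ/m that factor through 𝒵_m / ℰ_{m,q} → ℤ/M, evaluated at e_v.
  record Compatible (m q M : ℕ) .{{_ : NonZero m}} (b : ℕ → ℤ) : Set where
    field
      periodic : ∀ v → b (v % m) ≡ b v mod[ M ]
      at-zero : b 0 ≡ + 0 mod[ M ]
      frob : ∀ v → + q ℤ.* b v ≡ b (q ℕ.* v) mod[ M ]

  module FieldProperties {c ℓ} (K : CommutativeRing c ℓ) (K-field : IsField K) where
    open CommutativeRing K hiding (zero)
    open RingProperties ring
    open Powers K
    open Cancellation K K-field public
    open FiniteSums commutativeSemiring
    open SetoidReasoning setoid
    open Mult semiring using (_×_)

    ^suc-fixed⇒root : ∀ {z} n → ¬ z ≈ 0# → z ^ suc n ≈ z → z ^ n ≈ 1#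
    ^suc-fixed⇒root n z≉0 z^1+n≈z = *-cancelˡ z≉0 (trans z^1+n≈z (sym (*-identityʳ _)))

    geometric : ℕ → Carrier → Carrier
    geometric n u = ∑ {n} λ j → u ^ toℕ j

    geometric-sucˡ : ∀ n u → geometric (suc n) u ≈ 1# + u * geometric n u
    geometric-sucˡ n u = trans (∑-suc _) (+-congˡ (sym (∑-*ˡ u _)))

    geometric-sucʳ : ∀ n u → geometric (suc n) u ≈ geometric n u + u ^ n
    geometric-sucʳ zero u = trans (geometric-sucˡ 0 u) (trans (+-comm _ _) (+-congʳ (trans (*-congˡ (∑-empty _)) (trans (zeroʳ u) (sym (∑-empty _))))))
    geometric-sucʳ (suc n) u = begin
      geometric (suc (suc n)) u ≈⟨ geometric-sucˡ (suc n) u ⟩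
      1# + u * geometric (suc n) u ≈⟨ +-congˡ (trans (*-congˡ (geometric-sucʳ n u)) (distribˡ u _ _)) ⟩
      1# + (u * geometric n u + u * u ^ n) ≈⟨ +-assoc _ _ _ ⟨
      1# + u * geometric n u + u ^ suc n ≈⟨ +-congʳ (geometric-sucˡ n u) ⟨
      geometric (suc n) u + u ^ suc n ∎

    geometric-root : ∀ n {u} → u ^ n ≈ 1# → ¬ u ≈ 1# → geometric n u ≈ 0#
    geometric-root n {u} u^n≈1 u≉1 = *-cancelˡ {u - 1#} u-1≉0 (begin
      (u - 1#) * geometric n u ≈⟨ [y-z]x≈yx-zx _ u 1# ⟩
      u * geometric n u - 1# * geometric n u ≈⟨ +-congˡ (-‿cong (*-identityˡ _)) ⟩
      u * geometric n u - geometric n u ≈⟨ +-congʳ fixed ⟩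
      geometric n u - geometric n u ≈⟨ -‿inverseʳ _ ⟩
      0# ≈⟨ zeroʳ _ ⟨
      (u - 1#) * 0# ∎)
      where
      u-1≉0 : ¬ u - 1# ≈ 0#
      u-1≉0 u-1≈0 = u≉1 (x∙y⁻¹≈ε⇒x≈y u 1# u-1≈0)
      fixed : u * geometric n u ≈ geometric n u
      fixed = +-cancelˡ 1# _ _ (begin
        1# + u * geometric n u ≈⟨ geometric-sucˡ n u ⟨
        geometric (suc n) u ≈⟨ geometric-sucʳ n u ⟩
        geometric n u + u ^ n ≈⟨ +-congˡ u^n≈1 ⟩
        geometric n u + 1# ≈⟨ +-comm _ _ ⟩
        1# + geometric n u ∎)

    geometric-one : ∀ n {u} → u ≈ 1# → geometric n u ≈ n × 1#
    geometric-one n u≈1 = trans (∑-cong λ j → trans (^-congˡ (toℕ j) u≈1) (1^n≈1 (toℕ j))) (count n)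
      where
      count : ∀ n → ∑ {n} (λ _ → 1#) ≈ n × 1#
      count zero = ∑-empty _
      count (suc n) = trans (∑-suc _) (+-congˡ (count n))

  module RootsOfUnity {c ℓ} (K : CommutativeRing c ℓ) (K-field : IsField K) where
    open CommutativeRing K hiding (zero)
    open Powers K
    open Mult semiring using (_×_)
    open FiniteSums commutativeSemiring
    open SetoidReasoning setoid
    open FieldProperties K K-field
    open CExp commutativeSemiring using (^-distrib-*)

    module Primitive (_≈?_ : ∀ x y → Dec (x ≈ y)) (n : ℕ) .{{_ : NonZero n}} (n×1≉0 : ¬ n × 1# ≈ 0#)
      (ρ : Carrier) (ρ^n≈1 : ρ ^ n ≈ 1#) (ρ-exact : ∀ d → 0 ℕ.< d → d ℕ.< n → ¬ ρ ^ d ≈ 1#) where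

      ρ⁻¹ : Carrier
      ρ⁻¹ = ρ ^ ℕ.pred n

      ρ*ρ⁻¹≈1 : ρ * ρ⁻¹ ≈ 1#
      ρ*ρ⁻¹≈1 = trans (^-congʳ ρ (ℕₚ.suc-pred n)) ρ^n≈1

      ρ^*ρ⁻¹^ : ∀ k → ρ ^ k * ρ⁻¹ ^ k ≈ 1#
      ρ^*ρ⁻¹^ k = trans (sym (^-distrib-* ρ ρ⁻¹ k)) (trans (^-congˡ k ρ*ρ⁻¹≈1) (1^n≈1 k))

      ρ^≉0 : ∀ k → ¬ ρ ^ k ≈ 0#
      ρ^≉0 k = unit≉0 (ρ^*ρ⁻¹^ k)

      ^-root : ∀ {u} k → u ^ n ≈ 1# → (u ^ k) ^ n ≈ 1#
      ^-root {u} k u^n≈1 = trans (^-assocʳ u k n) (trans (^-congʳ u (ℕₚ.*-comm k n)) (trans (sym (^-assocʳ u n k))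
        (trans (^-congˡ k u^n≈1) (1^n≈1 k))))

      *-root : ∀ {u v} → u ^ n ≈ 1# → v ^ n ≈ 1# → (u * v) ^ n ≈ 1#
      *-root u^n≈1 v^n≈1 = trans (^-distrib-* _ _ n) (trans (*-cong u^n≈1 v^n≈1) (*-identityˡ 1#))

      ρ⁻¹^n≈1 : ρ⁻¹ ^ n ≈ 1#
      ρ⁻¹^n≈1 = ^-root (ℕ.pred n) ρ^n≈1

      ρ^≈1⇒∣ : ∀ {t} → ρ ^ t ≈ 1# → n ℕ∣ t
      ρ^≈1⇒∣ {t} ρ^t≈1 = m%n≡0⇒n∣m t n (zero-remainder (trans (^-periodic n ρ^n≈1 t) ρ^t≈1))
        where
        zero-remainder : ρ ^ (t % n) ≈ 1# → t % n ≡ 0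
        zero-remainder p with t % n in eq
        ... | zero = ≡.refl
        ... | suc r = contradiction p (ρ-exact (suc r) (ℕ.s≤s ℕ.z≤n) (≡.subst (ℕ._< n) eq (ℕ÷.m%n<n t n)))

      ∣⇒ρ^≈1 : ∀ {t} → n ℕ∣ t → ρ ^ t ≈ 1#
      ∣⇒ρ^≈1 {t} n∣t = trans (sym (^-periodic n ρ^n≈1 t)) (^-congʳ ρ (n∣m⇒m%n≡0 t n n∣t))

      ρ^-≤⇒mod : ∀ {x y} → x ℕ.≤ y → ρ ^ x ≈ ρ ^ y → + x ≡ + y mod[ n ]
      ρ^-≤⇒mod {x} x≤y eq with ℕₚ.m≤n⇒∃[o]m+o≡n x≤y
      ... | t , ≡.refl = ∣⇒+-mod x t (ρ^≈1⇒∣ (*-cancelˡ (ρ^≉0 x) (trans (sym (^-homo-* ρ x t)) (trans (sym eq) (sym (*-identityʳ _))))))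

      ρ^-injective : ∀ {x y} → ρ ^ x ≈ ρ ^ y → + x ≡ + y mod[ n ]
      ρ^-injective {x} {y} eq with ℕₚ.≤-total x y
      ... | inj₁ x≤y = ρ^-≤⇒mod x≤y eq
      ... | inj₂ y≤x = mod-sym (ρ^-≤⇒mod y≤x (sym eq))

      ρ^-≤-cong : ∀ {x y} → x ℕ.≤ y → + x ≡ + y mod[ n ] → ρ ^ x ≈ ρ ^ y
      ρ^-≤-cong {x} x≤y eq with ℕₚ.m≤n⇒∃[o]m+o≡n x≤y
      ... | t , ≡.refl = sym (trans (^-homo-* ρ x t) (trans (*-congˡ (∣⇒ρ^≈1 (+-mod⇒∣ x t eq))) (*-identityʳ _)))

      ρ^-cong : ∀ {x y} → + x ≡ + y mod[ n ] → ρ ^ x ≈ ρ ^ y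
      ρ^-cong {x} {y} eq with ℕₚ.≤-total x y
      ... | inj₁ x≤y = ρ^-≤-cong x≤y eq
      ... | inj₂ y≤x = sym (ρ^-≤-cong y≤x (mod-sym eq))

      ρ^*ρ⁻¹^-exact : ∀ {i j : Fin n} → ρ ^ toℕ i * ρ⁻¹ ^ toℕ j ≈ 1# → i ≡ j
      ρ^*ρ⁻¹^-exact {i} {j} eq = Finₚ.toℕ-injective (reduce (ρ^-injective {toℕ i} {toℕ j} ρ^i≈ρ^j))
        where
        ρ^i≈ρ^j : ρ ^ toℕ i ≈ ρ ^ toℕ j
        ρ^i≈ρ^j = begin
          ρ ^ toℕ i ≈⟨ trans (*-congˡ (trans (*-comm _ _) (ρ^*ρ⁻¹^ (toℕ j)))) (*-identityʳ _) ⟨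
          ρ ^ toℕ i * (ρ⁻¹ ^ toℕ j * ρ ^ toℕ j) ≈⟨ *-assoc _ _ _ ⟨
          ρ ^ toℕ i * ρ⁻¹ ^ toℕ j * ρ ^ toℕ j ≈⟨ *-congʳ eq ⟩
          1# * ρ ^ toℕ j ≈⟨ *-identityˡ _ ⟩
          ρ ^ toℕ j ∎
        ordered : ∀ {x y} → x ℕ.≤ y → y ℕ.< n → + x ≡ + y mod[ n ] → x ≡ y
        ordered {x} x≤y y<n eq with ℕₚ.m≤n⇒∃[o]m+o≡n x≤y
        ... | zero , ≡.refl = ≡.sym (ℕₚ.+-identityʳ x)
        ... | suc t , ≡.refl = contradiction (ℕ∣⇒≤ (+-mod⇒∣ x (suc t) eq)) (ℕₚ.<⇒≱ (ℕₚ.≤-<-trans (ℕₚ.m≤n+m (suc t) x) y<n))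
        reduce : + toℕ i ≡ + toℕ j mod[ n ] → toℕ i ≡ toℕ j
        reduce eq with ℕₚ.≤-total (toℕ i) (toℕ j)
        ... | inj₁ i≤j = ordered i≤j (Finₚ.toℕ<n j) eq
        ... | inj₂ j≤i = ≡.sym (ordered j≤i (Finₚ.toℕ<n i) (mod-sym eq))

      orthogonality : ∀ i j → ¬ i ≡ j → ∑ {n} (λ k → (ρ ^ toℕ i * ρ⁻¹ ^ toℕ j) ^ toℕ k) ≈ 0#
      orthogonality i j i≢j = geometric-root n (*-root (^-root (toℕ i) ρ^n≈1) (^-root (toℕ j) ρ⁻¹^n≈1))
        (i≢j ∘ ρ^*ρ⁻¹^-exact)

      orthogonality-diagonal : ∀ (i : Fin n) → ∑ {n} (λ k → (ρ ^ toℕ i * ρ⁻¹ ^ toℕ i) ^ toℕ k) ≈ n × 1#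
      orthogonality-diagonal i = geometric-one n (ρ^*ρ⁻¹^ (toℕ i))

      -- Otherwise every ∑_j (z ρ⁻ⁱ)ʲ vanishes; but their sum over i is n.
      root⇒power : ∀ z → z ^ n ≈ 1# → ∃ λ (i : Fin n) → z ≈ ρ ^ toℕ i
      root⇒power z z^n≈1 with Finₚ.any? {n} (λ i → z ≈? (ρ ^ toℕ i))
      ... | yes found = found
      ... | no ¬found = contradiction (begin
        n × 1# ≈⟨ *-identityˡ _ ⟨
        1# * (n × 1#) ≈⟨ at-zero ⟨
        z ^ toℕ origin * ∑ {n} (λ i → (ρ⁻¹ ^ toℕ i) ^ toℕ origin) ≈⟨ ∑-single origin off ⟨
        ∑ (λ j → z ^ toℕ j * ∑ {n} λ i → (ρ⁻¹ ^ toℕ i) ^ toℕ j) ≈⟨ ∑-cong (λ j → ∑-*ˡ _ _) ⟩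
        ∑ (λ j → ∑ {n} λ i → z ^ toℕ j * (ρ⁻¹ ^ toℕ i) ^ toℕ j) ≈⟨ ∑-swap _ ⟩
        ∑ (λ i → ∑ λ j → z ^ toℕ j * (ρ⁻¹ ^ toℕ i) ^ toℕ j) ≈⟨ ∑-cong (λ i → ∑-cong λ j → ^-distrib-* z (ρ⁻¹ ^ toℕ i) (toℕ j)) ⟨
        ∑ (λ i → geometric n (z * ρ⁻¹ ^ toℕ i)) ≈⟨ ∑-zero (λ i → geometric-root n (*-root z^n≈1 (^-root (toℕ i) ρ⁻¹^n≈1)) (λ e → ¬found (i , z≈ρ^ i e))) ⟩
        0# ∎) n×1≉0
        where
        origin : Fin n
        origin = 0 ℕ÷.mod n
        toℕ-origin : toℕ origin ≡ 0
        toℕ-origin = ≡.trans (toℕ-mod 0 n) (ℕ÷.m*n%n≡0 0 n)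
        z≈ρ^ : ∀ i → z * ρ⁻¹ ^ toℕ i ≈ 1# → z ≈ ρ ^ toℕ i
        z≈ρ^ i e = begin
          z ≈⟨ trans (*-congˡ (trans (*-comm _ _) (ρ^*ρ⁻¹^ (toℕ i)))) (*-identityʳ _) ⟨
          z * (ρ⁻¹ ^ toℕ i * ρ ^ toℕ i) ≈⟨ *-assoc _ _ _ ⟨
          z * ρ⁻¹ ^ toℕ i * ρ ^ toℕ i ≈⟨ *-congʳ e ⟩
          1# * ρ ^ toℕ i ≈⟨ *-identityˡ _ ⟩
          ρ ^ toℕ i ∎
        at-zero : z ^ toℕ origin * ∑ {n} (λ i → (ρ⁻¹ ^ toℕ i) ^ toℕ origin) ≈ 1# * (n × 1#)
        at-zero rewrite toℕ-origin = *-congˡ (trans (∑-cong (λ i → sym (1^n≈1 (toℕ i)))) (geometric-one n {1#} refl))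
        exchange : ∀ i j → (ρ⁻¹ ^ i) ^ j ≈ (ρ ^ 0 * ρ⁻¹ ^ j) ^ i
        exchange i j = trans (^-assocʳ ρ⁻¹ i j) (trans (^-congʳ ρ⁻¹ (ℕₚ.*-comm i j))
          (trans (sym (^-assocʳ ρ⁻¹ j i)) (^-congˡ i (sym (*-identityˡ _)))))
        off : ∀ j → ¬ j ≡ origin → z ^ toℕ j * ∑ {n} (λ i → (ρ⁻¹ ^ toℕ i) ^ toℕ j) ≈ 0#
        off j j≢ = trans (*-congˡ (trans (∑-cong λ i → trans (exchange (toℕ i) (toℕ j))
          (^-congˡ (toℕ i) (*-congʳ (^-congʳ ρ (≡.sym toℕ-origin))))) (orthogonality origin j (j≢ ∘ ≡.sym)))) (zeroʳ _)

-- Logarithms of the values of a unit at the m-th roots of unity.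

module UnitLogarithms where

  open import Data.Nat.Primality using (Prime)
  open import Data.Nat.Tactic.RingSolver using (solve-∀)
  open import Data.Integer as ℤ using (ℤ; +_)
  open import Data.Product using (∃; _,_; proj₁; proj₂) renaming (_×_ to _∧_)
  open import Relation.Binary.PropositionalEquality as ≡ using (_≡_; _≢_)
  open Sums
  open SelfDuality using (_≡_mod[_])
  open CirculantAlgebra
  open FiniteFields
  open RootExtensions
  open RootsAndCongruences

  -- Applied to q = n + 1 it shows that q - 1 divides M, so that a power of g generates the (q -
  -- 1)-th roots of unity.
  pred∣^∸1 : ∀ n d → ∃ λ r → suc n ℕ.^ d ≡ suc (n ℕ.* r)
  pred∣^∸1 n zero = 0 , ≡.cong suc (≡.sym (ℕₚ.*-zeroʳ n))
  pred∣^∸1 n (suc d) = let r , eq = pred∣^∸1 n d in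
    suc (suc n ℕ.* r) , ≡.trans (≡.cong (suc n ℕ.*_) eq) (expand n r)
    where
    expand : ∀ n r → suc n ℕ.* suc (n ℕ.* r) ≡ suc (n ℕ.* suc (suc n ℕ.* r))
    expand = solve-∀

  -- A unit with a(1) = 1 is known by the logarithms of its values at the m-th roots of unity ω ^ v.
  module UnitLogarithm {c ℓ} (F : CommutativeRing c ℓ) (F-field : IsField F) {q : ℕ}
    (enum : Bijection (≡.setoid (Fin q)) (CommutativeRing.setoid F)) (q-primePower : IsPrimePower q)
    (m : ℕ) .{{_ : NonZero m}} (d M r : ℕ) .{{_ : NonZero M}} (q^d≡1+M : q ℕ.^ suc d ≡ suc M) (M≡rm : M ≡ r ℕ.* m)
    (extension : RootExtension F M) where

    private module F = CommutativeRing F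
    open FiniteField F F-field enum using (element; element-injective; ^q-fixed; q×1≈0; p^k×1≈0⇒p×1≈0)
      renaming (_≈?_ to _≈F?_)
    open Circulant F m using (Poly; _≈P_; _*P_; xpow; 1P; IsUnit; InC'; eval1)
    open RootExtension extension
    open CommutativeRing K hiding (zero)
    open RingProperties ring
    open Powers K
    open Mult semiring using (_×_; ×1-homo-*; ×-congˡ)
    open Mult F.semiring using () renaming (_×_ to _×ᶠ_)
    open CExp commutativeSemiring using (^-distrib-*)
    open FiniteSums commutativeSemiring
    open HomomorphicSums F K hom
    open IsSemiringHomomorphism hom
    open FieldProperties K isField
    open SetoidReasoning setoid
    open CirculantPairing F K hom m

    ι-zero : ∀ {a} → ι a ≈ 0# → a F.≈ F.0#
    ι-zero {a} ιa≈0 with a ≈F? F.0#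
    ... | yes a≈0 = a≈0
    ... | no a≉0 = let b , ab≈1 = proj₂ F-field a a≉0 in
      contradiction ιa≈0 (unit≉0 (trans (sym (*-homo a b)) (trans (⟦⟧-cong ab≈1) 1#-homo)))

    ι-injective : ∀ {a b} → ι a ≈ ι b → a F.≈ b
    ι-injective {a} {b} ιa≈ιb = RingProperties.x∙y⁻¹≈ε⇒x≈y F.ring a b (ι-zero (+-cancelʳ (ι b) _ _ (begin
      ι (a F.- b) + ι b ≈⟨ +-homo _ _ ⟨
      ι (a F.- b F.+ b) ≈⟨ ⟦⟧-cong (F.trans (F.+-assoc a _ _) (F.trans (F.+-congˡ (F.-‿inverseˡ b)) (F.+-identityʳ a))) ⟩
      ι a ≈⟨ ιa≈ιb ⟩
      ι b ≈⟨ +-identityˡ _ ⟨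
      0# + ι b ∎)))

    private
      p = proj₁ q-primePower
      k = proj₁ (proj₂ q-primePower)
      p-prime : Prime p
      p-prime = proj₁ (proj₂ (proj₂ q-primePower))
      q≡p^k : q ≡ p ℕ.^ k
      q≡p^k = proj₂ (proj₂ (proj₂ (proj₂ q-primePower)))

      p×1≈0 : p × 1# ≈ 0#
      p×1≈0 = trans (sym (homo-×1 p)) (trans (⟦⟧-cong (p^k×1≈0⇒p×1≈0 p k
        (F.trans (F.reflexive (≡.cong (_×ᶠ F.1#) (≡.sym q≡p^k))) q×1≈0))) 0#-homo)

      q×1≈0ᴷ : q × 1# ≈ 0#
      q×1≈0ᴷ = trans (sym (homo-×1 q)) (trans (⟦⟧-cong q×1≈0) 0#-homo)

    ^q-∑ : ∀ {n} (t : Fin n → Carrier) → ∑ t ^ q ≈ ∑ λ i → t i ^ q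
    ^q-∑ t = trans (^-congʳ (∑ t) q≡p^k) (trans (Frobenius.^p^k-∑ K p-prime p×1≈0 k t)
      (∑-cong λ i → ^-congʳ (t i) (≡.sym q≡p^k)))

    -- Multiples of q vanish in K, so n is -1 there. For n = M this also makes every divisor of M
    -- nonzero in K, in particular m and q - 1.
    q∣1+n⇒n×1≉0 : ∀ n t → suc n ≡ q ℕ.* t → ¬ n × 1# ≈ 0#
    q∣1+n⇒n×1≉0 n t 1+n≡qt n×1≈0 = proj₁ isField (begin
      1# ≈⟨ trans (+-congˡ n×1≈0) (+-identityʳ 1#) ⟨
      suc n × 1# ≈⟨ ×-congˡ {1#} 1+n≡qt ⟩
      (q ℕ.* t) × 1# ≈⟨ ×1-homo-* q t ⟩
      (q × 1#) * (t × 1#) ≈⟨ trans (*-congʳ q×1≈0ᴷ) (zeroˡ _) ⟩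
      0# ∎)

    M×1≉0 : ¬ M × 1# ≈ 0#
    M×1≉0 = q∣1+n⇒n×1≉0 M (q ℕ.^ d) (≡.sym q^d≡1+M)

    factor×1≉0 : ∀ s n → M ≡ s ℕ.* n → ¬ n × 1# ≈ 0#
    factor×1≉0 s n M≡sn n×1≈0 = M×1≉0 (trans (×-congˡ {1#} M≡sn) (trans (×1-homo-* s n) (trans (*-congˡ n×1≈0) (zeroʳ _))))

    module _ (s n : ℕ) (M≡sn : M ≡ s ℕ.* n) where

      subroot : (g ^ s) ^ n ≈ 1#
      subroot = trans (^-assocʳ g s n) (trans (^-congʳ g (≡.sym M≡sn)) g^M≈1)

      subroot-exact : ∀ i → 0 ℕ.< i → i ℕ.< n → ¬ (g ^ s) ^ i ≈ 1#
      subroot-exact i 0<i i<n gˢⁱ≈1 = g-exact (s ℕ.* i)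
        (≡.subst (ℕ._< s ℕ.* i) (ℕₚ.*-zeroʳ s) (ℕₚ.*-monoʳ-< s {{ℕ.≢-nonZero s≢0}} 0<i))
        (≡.subst (s ℕ.* i ℕ.<_) (≡.sym M≡sn) (ℕₚ.*-monoʳ-< s {{ℕ.≢-nonZero s≢0}} i<n))
        (trans (sym (^-assocʳ g s i)) gˢⁱ≈1)
        where
        s≢0 : s ≢ 0
        s≢0 ≡.refl = ℕ.≢-nonZero⁻¹ M M≡sn

    module G = RootsOfUnity.Primitive K isField _≈?_ M M×1≉0 g g^M≈1 g-exact

    ω : Carrier
    ω = g ^ r

    module W = RootsOfUnity.Primitive K isField _≈?_ m (factor×1≉0 r m M≡rm) ω (subroot r m M≡rm) (subroot-exact r m M≡rm)

    -- The q + 1 roots z, ι a of x ^ q = x would inject into {0} ∪ μ_(q-1).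
    ^q-fixed⇒base : ∀ z → z ^ q ≈ z → ∃ λ a → z ≈ ι a
    ^q-fixed⇒base z z^q≈z with Finₚ.any? (λ i → z ≈? ι (element i))
    ... | yes (i , z≈) = element i , z≈
    ... | no ¬base = contradiction collision no-collision
      where
      n = ℕ.pred q
      q≢0 : q ≢ 0
      q≢0 q≡0 = contradiction (≡.trans (≡.sym q^d≡1+M) (≡.cong (ℕ._^ suc d) q≡0)) λ ()
      1+n≡q : suc n ≡ q
      1+n≡q = ℕₚ.suc-pred q {{ℕ.≢-nonZero q≢0}}
      s = proj₁ (pred∣^∸1 n (suc d))
      M≡ns : M ≡ n ℕ.* s
      M≡ns = ℕₚ.suc-injective (≡.trans (≡.sym q^d≡1+M) (≡.trans (≡.cong (ℕ._^ suc d) (≡.sym 1+n≡q)) (proj₂ (pred∣^∸1 n (suc d)))))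
      M≡sn : M ≡ s ℕ.* n
      M≡sn = ≡.trans M≡ns (ℕₚ.*-comm n s)
      n≢0 : n ≢ 0
      n≢0 n≡0 = ℕ.≢-nonZero⁻¹ M (≡.trans M≡ns (≡.cong (ℕ._* s) n≡0))
      module Q = RootsOfUnity.Primitive K isField _≈?_ n {{ℕ.≢-nonZero n≢0}} (factor×1≉0 s n M≡sn) (g ^ s) (subroot s n M≡sn) (subroot-exact s n M≡sn)
      root : Fin (suc q) → Carrier
      root zero = z
      root (suc i) = ι (element i)
      root^q : ∀ i → root i ^ suc n ≈ root i
      root^q i = trans (^-congʳ (root i) 1+n≡q) (fixed i)
        where
        fixed : ∀ i → root i ^ q ≈ root i
        fixed zero = z^q≈z
        fixed (suc i) = trans (sym (homo-^ _ q)) (⟦⟧-cong (^q-fixed _))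
      label : Fin (suc q) → Fin (suc n)
      label i with root i ≈? 0#
      ... | yes _ = zero
      ... | no ≉0 = suc (proj₁ (Q.root⇒power (root i) (^suc-fixed⇒root n ≉0 (root^q i))))
      label-injective : ∀ i j → label i ≡ label j → root i ≈ root j
      label-injective i j eq with root i ≈? 0# | root j ≈? 0#
      ... | yes i≈0 | yes j≈0 = trans i≈0 (sym j≈0)
      label-injective i j () | yes _ | no _
      label-injective i j () | no _ | yes _
      ... | no i≉0 | no j≉0 = trans
        (proj₂ (Q.root⇒power (root i) (^suc-fixed⇒root n i≉0 (root^q i))))
        (trans (^-congʳ (g ^ s) (≡.cong toℕ (Finₚ.suc-injective eq)))
          (sym (proj₂ (Q.root⇒power (root j) (^suc-fixed⇒root n j≉0 (root^q j))))))
      collision : ∃ λ i → ∃ λ j → i Fin.< j ∧ label i ≡ label j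
      collision = Finₚ.pigeonhole (ℕ.s≤s (ℕₚ.≤-reflexive 1+n≡q)) label
      no-collision : ¬ ∃ λ i → ∃ λ j → i Fin.< j ∧ label i ≡ label j
      no-collision (i , zero , () , _)
      no-collision (zero , suc j , _ , eq) = ¬base (j , label-injective zero (suc j) eq)
      no-collision (suc i , suc j , ℕ.s≤s i<j , eq) = Finₚ.<⇒≢ i<j
        (element-injective (ι-injective (label-injective (suc i) (suc j) eq)))

    value : ℕ → Poly → Carrier
    value v a = evaluate (ω ^ v) a

    private
      root-value : ∀ v → (ω ^ v) ^ m ≈ 1#
      root-value v = W.^-root v (subroot r m M≡rm)

      ω^-periodic : ∀ v → ω ^ (v % m) ≈ ω ^ v
      ω^-periodic = ^-periodic m (subroot r m M≡rm)

    value-* : ∀ v a b → value v (a *P b) ≈ value v a * value v b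
    value-* v = evaluate-* (root-value v)

    value-xpow : ∀ v k → value v (xpow k) ≈ (ω ^ v) ^ k
    value-xpow v = evaluate-xpow (root-value v)

    value-cong : ∀ v {a b} → a ≈P b → value v a ≈ value v b
    value-cong v a≈b = pair-congˡ a≈b _

    value-base : ∀ a v w → ω ^ v ≈ ω ^ w → value v a ≈ value w a
    value-base a v w p = pair-congʳ a λ k → ^-congˡ k p

    value-periodic : ∀ v a → value (v % m) a ≈ value v a
    value-periodic v a = value-base a (v % m) v (ω^-periodic v)

    value-0 : ∀ a → value 0 a ≈ ι (eval1 a)
    value-0 a = trans (pair-∑ a _) (trans (∑-cong λ j → trans (*-congˡ (1^n≈1 (toℕ j))) (*-identityʳ _))
      (trans (sym (homo-∑ a)) (⟦⟧-cong (F.sym (FiniteSums.sumFin≈∑ F.commutativeSemiring a)))))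

    -- The q-th power map is additive on K, fixes the coefficients and turns ω^v into ω^(qv).
    value-^q : ∀ v a → value v a ^ q ≈ value (q ℕ.* v) a
    value-^q v a = begin
      value v a ^ q ≈⟨ ^-congˡ q (pair-∑ a _) ⟩
      ∑ (λ j → ι (a j) * (ω ^ v) ^ toℕ j) ^ q ≈⟨ ^q-∑ _ ⟩
      ∑ (λ j → (ι (a j) * (ω ^ v) ^ toℕ j) ^ q) ≈⟨ ∑-cong (λ j → trans (^-distrib-* _ _ q) (*-cong
                                                         (trans (sym (homo-^ (a j) q)) (⟦⟧-cong (^q-fixed (a j))))
                                                         (exchange v (toℕ j)))) ⟩
      ∑ (λ j → ι (a j) * (ω ^ (q ℕ.* v)) ^ toℕ j) ≈⟨ pair-∑ a _ ⟨
      value (q ℕ.* v) a ∎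
      where
      exchange : ∀ v j → ((ω ^ v) ^ j) ^ q ≈ (ω ^ (q ℕ.* v)) ^ j
      exchange v j = trans (^-assocʳ _ j q) (trans (^-assocʳ ω v (j ℕ.* q)) (trans (^-congʳ ω (rearrange v j q)) (sym (^-assocʳ ω (q ℕ.* v) j))))
        where
        rearrange : ∀ v j q → v ℕ.* (j ℕ.* q) ≡ q ℕ.* v ℕ.* j
        rearrange = solve-∀

    value-^q^ : ∀ e v a → value v a ^ (q ℕ.^ e) ≈ value (q ℕ.^ e ℕ.* v) a
    value-^q^ zero v a = trans (*-identityʳ _) (value-base a v (v ℕ.+ 0) (^-congʳ ω (≡.sym (ℕₚ.+-identityʳ v))))
    value-^q^ (suc e) v a = begin
      value v a ^ (q ℕ.* q ℕ.^ e) ≈⟨ ^-assocʳ _ q _ ⟨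
      (value v a ^ q) ^ (q ℕ.^ e) ≈⟨ ^-congˡ (q ℕ.^ e) (value-^q v a) ⟩
      value (q ℕ.* v) a ^ (q ℕ.^ e) ≈⟨ value-^q^ e (q ℕ.* v) a ⟩
      value (q ℕ.^ e ℕ.* (q ℕ.* v)) a ≈⟨ value-base a (q ℕ.^ e ℕ.* (q ℕ.* v)) (q ℕ.* q ℕ.^ e ℕ.* v) (^-congʳ ω (rearrange q (q ℕ.^ e) v)) ⟩
      value (q ℕ.* q ℕ.^ e ℕ.* v) a ∎
      where
      rearrange : ∀ q e v → e ℕ.* (q ℕ.* v) ≡ q ℕ.* e ℕ.* v
      rearrange = solve-∀

    private
      [1+M]v%m : ∀ v → (suc M ℕ.* v) % m ≡ v % m
      [1+M]v%m v = ≡.trans (≡.cong (_% m) (≡.trans (≡.cong (λ t → suc t ℕ.* v) M≡rm) (rearrange r m v))) (ℕ÷.[m+kn]%n≡m%n v (r ℕ.* v) m)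
        where
        rearrange : ∀ r m v → suc (r ℕ.* m) ℕ.* v ≡ v ℕ.+ r ℕ.* v ℕ.* m
        rearrange = solve-∀

      ω^-%-cong : ∀ {v w} → v % m ≡ w % m → ω ^ v ≈ ω ^ w
      ω^-%-cong {v} {w} eq = trans (sym (ω^-periodic v)) (trans (^-congʳ ω eq) (ω^-periodic w))

    value-fixed : ∀ v a → value v a ^ suc M ≈ value v a
    value-fixed v a = trans (^-congʳ (value v a) (≡.sym q^d≡1+M)) (trans (value-^q^ (suc d) v a)
      (value-base a (q ℕ.^ suc d ℕ.* v) v (ω^-%-cong {q ℕ.^ suc d ℕ.* v} {v} (≡.trans (≡.cong (λ t → (t ℕ.* v) % m) q^d≡1+M) ([1+M]v%m v)))))

    value-unit : ∀ v {a} → IsUnit a → value v a ^ M ≈ 1#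
    value-unit v {a} (b , ab≈1) = ^suc-fixed⇒root M (unit≉0 (trans (sym (value-* v a b))
      (trans (value-cong v ab≈1) (value-xpow v 0)))) (value-fixed v a)

    -- Fourier inversion, up to the factor m that is nonzero in K.
    reconstruct : ∀ a (k : Fin m) → ∑ (λ v → value (toℕ v) a * (W.ρ⁻¹ ^ toℕ k) ^ toℕ v) ≈ ι (a k) * (m × 1#)
    reconstruct a k = begin
      ∑ (λ v → value (toℕ v) a * (W.ρ⁻¹ ^ toℕ k) ^ toℕ v)
        ≈⟨ ∑-cong (λ v → trans (*-congʳ (pair-∑ a _)) (trans (∑-*ʳ _ _) (∑-cong λ j → trans (*-assoc _ _ _) (*-congˡ (collect j v))))) ⟩
      ∑ (λ v → ∑ λ j → ι (a j) * (ω ^ toℕ j * W.ρ⁻¹ ^ toℕ k) ^ toℕ v)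
        ≈⟨ ∑-swap _ ⟩
      ∑ (λ j → ∑ λ v → ι (a j) * (ω ^ toℕ j * W.ρ⁻¹ ^ toℕ k) ^ toℕ v)
        ≈⟨ ∑-cong (λ j → ∑-*ˡ _ _) ⟨
      ∑ (λ j → ι (a j) * ∑ {m} λ v → (ω ^ toℕ j * W.ρ⁻¹ ^ toℕ k) ^ toℕ v)
        ≈⟨ ∑-single k (λ j j≢k → trans (*-congˡ (W.orthogonality j k j≢k)) (zeroʳ _)) ⟩
      ι (a k) * ∑ {m} (λ v → (ω ^ toℕ k * W.ρ⁻¹ ^ toℕ k) ^ toℕ v)
        ≈⟨ *-congˡ (W.orthogonality-diagonal k) ⟩
      ι (a k) * (m × 1#) ∎
      where
      collect : ∀ (j v : Fin m) → (ω ^ toℕ v) ^ toℕ j * (W.ρ⁻¹ ^ toℕ k) ^ toℕ v ≈ (ω ^ toℕ j * W.ρ⁻¹ ^ toℕ k) ^ toℕ v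
      collect j v = trans (*-congʳ (trans (^-assocʳ ω (toℕ v) (toℕ j)) (trans (^-congʳ ω (ℕₚ.*-comm (toℕ v) (toℕ j))) (sym (^-assocʳ ω (toℕ j) (toℕ v))))))
        (sym (^-distrib-* _ _ (toℕ v)))

    values-injective : ∀ {a b} → (∀ v → value v a ≈ value v b) → a ≈P b
    values-injective {a} {b} eq k = ι-injective (*-cancelˡ (factor×1≉0 r m M≡rm) (begin
      (m × 1#) * ι (a k) ≈⟨ *-comm _ _ ⟩
      ι (a k) * (m × 1#) ≈⟨ reconstruct a k ⟨
      ∑ (λ v → value (toℕ v) a * (W.ρ⁻¹ ^ toℕ k) ^ toℕ v) ≈⟨ ∑-cong (λ v → *-congʳ (eq (toℕ v))) ⟩
      ∑ (λ v → value (toℕ v) b * (W.ρ⁻¹ ^ toℕ k) ^ toℕ v) ≈⟨ reconstruct b k ⟩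
      ι (b k) * (m × 1#) ≈⟨ *-comm _ _ ⟩
      (m × 1#) * ι (b k) ∎))

    module Interpolation (s : ℕ → Carrier) (s-periodic : ∀ v → s (v % m) ≈ s v) (s-^q : ∀ v → s v ^ q ≈ s (q ℕ.* v)) where

      private
        m⁻¹ : F.Carrier
        m⁻¹ = proj₁ (proj₂ F-field (m ×ᶠ F.1#) λ m×1≈0 → factor×1≉0 r m M≡rm (trans (sym (homo-×1 m)) (trans (⟦⟧-cong m×1≈0) 0#-homo)))

        m×1*m⁻¹≈1 : (m × 1#) * ι m⁻¹ ≈ 1#
        m×1*m⁻¹≈1 = trans (*-congʳ (sym (homo-×1 m))) (trans (sym (*-homo _ _)) (trans (⟦⟧-cong (proj₂ (proj₂ F-field (m ×ᶠ F.1#) _))) 1#-homo))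

        term : ℕ → ℕ → Carrier
        term j v = s v * (W.ρ⁻¹ ^ j) ^ v

        term-periodic : ∀ j v → term j (v % m) ≈ term j v
        term-periodic j v = *-cong (s-periodic v) (^-periodic m (W.^-root j W.ρ⁻¹^n≈1) v)

        term-^q : ∀ j v → term j v ^ q ≈ term j (q ℕ.* v)
        term-^q j v = trans (^-distrib-* _ _ q) (*-cong (s-^q v) (trans (^-assocʳ _ v q) (^-congʳ _ (ℕₚ.*-comm v q))))

        by : ℕ → Fin m → Fin m
        by n v = (n ℕ.* toℕ v) ℕ÷.mod m

        by-inverse : ∀ n n′ → n ℕ.* n′ ≡ suc M → ∀ v → by n (by n′ v) ≡ v
        by-inverse n n′ nn′≡1+M v = Finₚ.toℕ-injective (≡.trans (toℕ-mod _ m) (≡.trans (≡.cong (λ t → (n ℕ.* t) % m) (toℕ-mod _ m))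
          (≡.trans (%-*ʳ n (n′ ℕ.* toℕ v)) (≡.trans (≡.cong (_% m) (≡.trans (≡.sym (ℕₚ.*-assoc n n′ _)) (≡.cong (ℕ._* toℕ v) nn′≡1+M)))
            (≡.trans ([1+M]v%m (toℕ v)) (ℕ÷.m<n⇒m%n≡m (Finₚ.toℕ<n v)))))))
          where
          %-*ʳ : ∀ n x → (n ℕ.* (x % m)) % m ≡ (n ℕ.* x) % m
          %-*ʳ n x = ≡.trans (ℕ÷.%-distribˡ-* n (x % m) m) (≡.trans (≡.cong (λ t → (n % m ℕ.* t) % m) (ℕ÷.m%n%n≡m%n x m)) (≡.sym (ℕ÷.%-distribˡ-* n x m)))

        -- Multiplication by q^d inverts multiplication by q on ℤ/m, because q q^d = 1 + M and m
        -- divides M.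
        frobenius : Perm.Permutation m m
        frobenius = Perm.permutation (by q) (by (q ℕ.^ d)) (by-inverse q (q ℕ.^ d) q^d≡1+M)
          (by-inverse (q ℕ.^ d) q (≡.trans (ℕₚ.*-comm _ q) q^d≡1+M))

        coefficient : Fin m → Carrier
        coefficient j = ι m⁻¹ * ∑ {m} λ v → term (toℕ j) (toℕ v)

        -- The q-th power map permutes the summands of the inverse Fourier transform along v ↦ q v.
        -- Its coefficients are thus fixed by it, which places them in F.
        coefficient-^q : ∀ j → coefficient j ^ q ≈ coefficient j
        coefficient-^q j = trans (^-distrib-* _ _ q) (*-cong (trans (sym (homo-^ m⁻¹ q)) (⟦⟧-cong (^q-fixed m⁻¹))) (begin
          ∑ {m} (λ v → term (toℕ j) (toℕ v)) ^ q ≈⟨ ^q-∑ _ ⟩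
          ∑ (λ v → term (toℕ j) (toℕ v) ^ q) ≈⟨ ∑-cong (λ v → term-^q (toℕ j) (toℕ v)) ⟩
          ∑ (λ v → term (toℕ j) (q ℕ.* toℕ v)) ≈⟨ ∑-cong (λ v → term-periodic (toℕ j) (q ℕ.* toℕ v)) ⟨
          ∑ (λ v → term (toℕ j) ((q ℕ.* toℕ v) % m)) ≈⟨ ∑-cong (λ v → reflexive (≡.cong (term (toℕ j)) (toℕ-mod (q ℕ.* toℕ v) m))) ⟨
          ∑ (λ v → term (toℕ j) (toℕ (by q v))) ≈⟨ ∑-permute (λ v → term (toℕ j) (toℕ v)) frobenius ⟨
          ∑ (λ v → term (toℕ j) (toℕ v)) ∎))

      interpolant : Poly
      interpolant j = proj₁ (^q-fixed⇒base (coefficient j) (coefficient-^q j))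

      value-interpolant : ∀ v → value v interpolant ≈ s v
      value-interpolant v = trans (sym (value-periodic v interpolant)) (trans (value-base interpolant (v % m) (toℕ (v ℕ÷.mod m)) (^-congʳ ω (≡.sym (toℕ-mod v m))))
        (trans (at (v ℕ÷.mod m)) (trans (reflexive (≡.cong s (toℕ-mod v m))) (s-periodic v))))
        where
        collect : ∀ (v w j : Fin m) → (W.ρ⁻¹ ^ toℕ j) ^ toℕ w * (ω ^ toℕ v) ^ toℕ j ≈ (ω ^ toℕ v * W.ρ⁻¹ ^ toℕ w) ^ toℕ j
        collect v w j = trans (*-comm _ _) (trans (*-congˡ (trans (^-assocʳ W.ρ⁻¹ (toℕ j) (toℕ w)) (trans (^-congʳ W.ρ⁻¹ (ℕₚ.*-comm (toℕ j) (toℕ w)))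
          (sym (^-assocʳ W.ρ⁻¹ (toℕ w) (toℕ j)))))) (sym (^-distrib-* _ _ (toℕ j))))
        at : ∀ v → value (toℕ v) interpolant ≈ s (toℕ v)
        at v = begin
          value (toℕ v) interpolant
            ≈⟨ pair-∑ interpolant _ ⟩
          ∑ (λ j → ι (interpolant j) * (ω ^ toℕ v) ^ toℕ j)
            ≈⟨ ∑-cong (λ j → trans (*-congʳ (sym (proj₂ (^q-fixed⇒base (coefficient j) (coefficient-^q j))))) (trans (*-assoc _ _ _) (*-congˡ
                 (trans (∑-*ʳ _ _) (∑-cong λ w → trans (*-assoc _ _ _) (*-congˡ (collect v w j))))))) ⟩
          ∑ (λ j → ι m⁻¹ * ∑ {m} λ w → s (toℕ w) * (ω ^ toℕ v * W.ρ⁻¹ ^ toℕ w) ^ toℕ j)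
            ≈⟨ ∑-*ˡ _ _ ⟨
          ι m⁻¹ * ∑ (λ j → ∑ {m} λ w → s (toℕ w) * (ω ^ toℕ v * W.ρ⁻¹ ^ toℕ w) ^ toℕ j)
            ≈⟨ *-congˡ (trans (∑-swap _) (∑-cong λ w → sym (∑-*ˡ _ _))) ⟩
          ι m⁻¹ * ∑ (λ w → s (toℕ w) * ∑ {m} λ j → (ω ^ toℕ v * W.ρ⁻¹ ^ toℕ w) ^ toℕ j)
            ≈⟨ *-congˡ (∑-single v λ w w≢v → trans (*-congˡ (W.orthogonality v w (w≢v ∘ ≡.sym))) (zeroʳ _)) ⟩
          ι m⁻¹ * (s (toℕ v) * ∑ {m} λ j → (ω ^ toℕ v * W.ρ⁻¹ ^ toℕ v) ^ toℕ j)
            ≈⟨ *-congˡ (*-congˡ (W.orthogonality-diagonal v)) ⟩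
          ι m⁻¹ * (s (toℕ v) * (m × 1#))
            ≈⟨ trans (x∙yz≈y∙zx _ _ _) (trans (*-congˡ m×1*m⁻¹≈1) (*-identityʳ _)) ⟩
          s (toℕ v) ∎
          where open CSemigroup *-commutativeSemigroup using (x∙yz≈y∙zx)

    opaque
      -- The default 0 concerns only elements that are not M-th roots of unity; values of units are
      -- never among them.
      logarithm : Carrier → ℕ
      logarithm z with Finₚ.any? {M} (λ i → z ≈? (g ^ toℕ i))
      ... | yes (i , _) = toℕ i
      ... | no _ = 0

      g^logarithm : ∀ {z} → z ^ M ≈ 1# → g ^ logarithm z ≈ z
      g^logarithm {z} z^M≈1 with Finₚ.any? {M} (λ i → z ≈? (g ^ toℕ i))
      ... | yes (i , z≈g^i) = sym z≈g^i
      ... | no ¬found = contradiction (G.root⇒power z z^M≈1) ¬found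

    log : Poly → ℕ → ℤ
    log a v = + logarithm (value v a)

    private
      g^log : ∀ {a} → InC' a → ∀ v → g ^ logarithm (value v a) ≈ value v a
      g^log (unit , _) v = g^logarithm (value-unit v unit)

      pos-q* : ∀ n → + q ℤ.* + n ≡ + (n ℕ.* q)
      pos-q* n = ≡.trans (≡.sym (ℤₚ.pos-* q n)) (≡.cong +_ (ℕₚ.*-comm q n))

    log-compatible : ∀ {a} → InC' a → Compatible m q M (log a)
    log-compatible {a} a∈@(_ , a1≈1) = record
      { periodic = λ v → G.ρ^-injective (trans (g^log a∈ (v % m)) (trans (value-periodic v a) (sym (g^log a∈ v))))
      ; at-zero = G.ρ^-injective {y = 0} (trans (g^log a∈ 0) (trans (value-0 a) (trans (⟦⟧-cong a1≈1) 1#-homo)))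
      ; frob = λ v → mod-trans (mod-reflexive (pos-q* (logarithm (value v a)))) (G.ρ^-injective (begin
          g ^ (logarithm (value v a) ℕ.* q) ≈⟨ ^-assocʳ g (logarithm (value v a)) q ⟨
          (g ^ logarithm (value v a)) ^ q ≈⟨ ^-congˡ q (g^log a∈ v) ⟩
          value v a ^ q ≈⟨ value-^q v a ⟩
          value (q ℕ.* v) a ≈⟨ g^log a∈ (q ℕ.* v) ⟨
          g ^ logarithm (value (q ℕ.* v) a) ∎)) }

    log-cong : ∀ {a b} → InC' a → InC' b → a ≈P b → ∀ v → log a v ≡ log b v mod[ M ]
    log-cong a∈ b∈ a≈b v = G.ρ^-injective (trans (g^log a∈ v) (trans (value-cong v a≈b) (sym (g^log b∈ v))))

    log-injective : ∀ {a b} → InC' a → InC' b → (∀ v → log a v ≡ log b v mod[ M ]) → a ≈P b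
    log-injective a∈ b∈ eq = values-injective λ v → trans (sym (g^log a∈ v)) (trans (G.ρ^-cong (eq v)) (g^log b∈ v))

    log-* : ∀ {a b} → InC' a → InC' b → InC' (a *P b) → ∀ v → log (a *P b) v ≡ log a v ℤ.+ log b v mod[ M ]
    log-* {a} {b} a∈ b∈ ab∈ v = mod-trans (G.ρ^-injective (begin
      g ^ logarithm (value v (a *P b)) ≈⟨ g^log ab∈ v ⟩
      value v (a *P b) ≈⟨ value-* v a b ⟩
      value v a * value v b ≈⟨ *-cong (g^log a∈ v) (g^log b∈ v) ⟨
      g ^ logarithm (value v a) * g ^ logarithm (value v b) ≈⟨ ^-homo-* g (logarithm (value v a)) _ ⟨
      g ^ (logarithm (value v a) ℕ.+ logarithm (value v b)) ∎)) (mod-reflexive (ℤₚ.pos-+ (logarithm (value v a)) _))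

    log-xpow : ∀ k → InC' (xpow k) → ∀ v → log (xpow k) v ≡ + (k ℕ.* v ℕ.* r) mod[ M ]
    log-xpow k xᵏ∈ v = G.ρ^-injective (begin
      g ^ logarithm (value v (xpow k)) ≈⟨ g^log xᵏ∈ v ⟩
      value v (xpow k) ≈⟨ value-xpow v k ⟩
      ((g ^ r) ^ v) ^ k ≈⟨ trans (^-assocʳ _ v k) (trans (^-assocʳ g r (v ℕ.* k)) (^-congʳ g (rearrange r v k))) ⟩
      g ^ (k ℕ.* v ℕ.* r) ∎)
      where
      rearrange : ∀ r v k → r ℕ.* (v ℕ.* k) ≡ k ℕ.* v ℕ.* r
      rearrange = solve-∀

    log-surjective : ∀ {b} → Compatible m q M b → ∃ λ a → InC' a ∧ ∀ v → log a v ≡ b v mod[ M ]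
    log-surjective {b} b-compatible = a , a∈ , λ v → mod-trans (G.ρ^-injective (trans (g^log a∈ v) (value-a v))) (%ℕ-mod (b v))
      where
      open Compatible b-compatible
      n : ℕ → ℕ
      n v = b v ℤ÷.%ℕ M
      n≡ : ∀ {v w} → b v ≡ b w mod[ M ] → + n v ≡ + n w mod[ M ]
      n≡ {v} {w} p = mod-trans (%ℕ-mod (b v)) (mod-trans p (mod-sym (%ℕ-mod (b w))))
      n-frob : ∀ v → + (n v ℕ.* q) ≡ + n (q ℕ.* v) mod[ M ]
      n-frob v = mod-trans (mod-reflexive (≡.sym (pos-q* (n v)))) (mod-trans (mod-*ˡ (+ q) (%ℕ-mod (b v)))
        (mod-trans (frob v) (mod-sym (%ℕ-mod (b (q ℕ.* v))))))
      ρ⁻¹^-cong : ∀ {x y} → + x ≡ + y mod[ M ] → G.ρ⁻¹ ^ x ≈ G.ρ⁻¹ ^ y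
      ρ⁻¹^-cong {x} {y} eq = *-cancelˡ (G.ρ^≉0 x) (trans (G.ρ^*ρ⁻¹^ x) (sym (trans (*-congʳ (G.ρ^-cong eq)) (G.ρ^*ρ⁻¹^ y))))
      module A = Interpolation (λ v → g ^ n v) (λ v → G.ρ^-cong (n≡ (periodic v)))
        (λ v → trans (^-assocʳ g (n v) q) (G.ρ^-cong (n-frob v)))
      -- Interpolating the inverse values yields the inverse of a, which proves a to be a unit.
      module A⁻¹ = Interpolation (λ v → G.ρ⁻¹ ^ n v) (λ v → ρ⁻¹^-cong (n≡ (periodic v)))
        (λ v → trans (^-assocʳ G.ρ⁻¹ (n v) q) (ρ⁻¹^-cong (n-frob v)))
      a = A.interpolant
      value-a : ∀ v → value v a ≈ g ^ n v
      value-a = A.value-interpolant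
      a∈ : InC' a
      a∈ = (A⁻¹.interpolant , values-injective λ v → trans (value-* v a A⁻¹.interpolant)
             (trans (*-cong (value-a v) (A⁻¹.value-interpolant v)) (trans (G.ρ^*ρ⁻¹^ (n v)) (sym (value-xpow v 0)))))
         , ι-injective (trans (sym (value-0 a)) (trans (value-a 0) (trans (G.ρ^-cong {y = 0} (mod-trans (%ℕ-mod (b 0)) at-zero)) (sym 1#-homo))))

    *P-closed : ∀ {a b} → InC' a → InC' b → InC' (a *P b)
    *P-closed {a} {b} ((a′ , aa′≈1) , a1≈1) ((b′ , bb′≈1) , b1≈1) =
      (a′ *P b′ , values-injective λ v → begin
        value v ((a *P b) *P (a′ *P b′)) ≈⟨ trans (value-* v _ _) (*-cong (value-* v a b) (value-* v a′ b′)) ⟩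
        value v a * value v b * (value v a′ * value v b′) ≈⟨ interchange _ _ _ _ ⟩
        value v a * value v a′ * (value v b * value v b′) ≈⟨ *-cong (inverse v aa′≈1) (inverse v bb′≈1) ⟩
        1# * 1# ≈⟨ *-identityˡ 1# ⟩
        1# ≈⟨ value-xpow v 0 ⟨
        value v 1P ∎)
      , ι-injective (begin
        ι (eval1 (a *P b)) ≈⟨ value-0 _ ⟨
        value 0 (a *P b) ≈⟨ value-* 0 a b ⟩
        value 0 a * value 0 b ≈⟨ *-cong (one a1≈1) (one b1≈1) ⟩
        1# * 1# ≈⟨ *-identityˡ 1# ⟩
        1# ≈⟨ 1#-homo ⟨
        ι F.1# ∎)
      where
      open CSemigroup *-commutativeSemigroup using (interchange)
      inverse : ∀ v {a a′} → a *P a′ ≈P 1P → value v a * value v a′ ≈ 1#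
      inverse v {a} {a′} aa′≈1 = trans (sym (value-* v a a′)) (trans (value-cong v aa′≈1) (value-xpow v 0))
      one : ∀ {a} → eval1 a F.≈ F.1# → value 0 a ≈ 1#
      one {a} a1≈1 = trans (value-0 a) (trans (⟦⟧-cong a1≈1) 1#-homo)

    xpow∈ : ∀ k → InC' (xpow k)
    xpow∈ k = (xpow (ℕ.pred m ℕ.* k) , values-injective λ v → begin
        value v (xpow k *P xpow (ℕ.pred m ℕ.* k)) ≈⟨ trans (value-* v _ _) (*-cong (value-xpow v k) (value-xpow v _)) ⟩
        (ω ^ v) ^ k * (ω ^ v) ^ (ℕ.pred m ℕ.* k) ≈⟨ ^-homo-* _ k _ ⟨
        (ω ^ v) ^ (suc (ℕ.pred m) ℕ.* k) ≈⟨ ^-congʳ _ (≡.cong (ℕ._* k) (ℕₚ.suc-pred m)) ⟩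
        (ω ^ v) ^ (m ℕ.* k) ≈⟨ ^-assocʳ _ m k ⟨
        ((ω ^ v) ^ m) ^ k ≈⟨ trans (^-congˡ k (root-value v)) (1^n≈1 k) ⟩
        1# ≈⟨ value-xpow v 0 ⟨
        value v 1P ∎)
      , ι-injective (trans (sym (value-0 _)) (trans (value-xpow 0 k) (trans (1^n≈1 k) (sym 1#-homo))))

-- Coordinates on 𝒵_m and the transfer of duality to its quotients.

module Lattices where

  open import Data.Integer as ℤ using (ℤ; 0ℤ; 1ℤ; +_; _+_; _*_; -_; _-_)
  open import Data.Integer.Divisibility.Signed using (_∣_)
  open import Data.Integer.Tactic.RingSolver using (solve-∀)
  open import Data.List using (applyUpTo)
  open import Data.Product using (∃; _,_; _×_)
  open import Relation.Binary.PropositionalEquality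
  open Sums
  open SelfTransposition
  open SelfDuality
  open CirculantAlgebra using (toℕ-mod)

  open ℤΣ

  basis-symmetric : ∀ {n} (i j : Fin n) → basis i j ≡ basis j i
  basis-symmetric i j = trans (sym (dot-basisʳ j (basis i))) (trans (dot-comm (basis i) (basis j)) (dot-basisʳ i (basis j)))

  RowSpan : ∀ {n} → Matrix n → ℤ^ n → Set
  RowSpan B z = ∃ λ x → z ≗ x ·ᴹ B

  module _ {n} (B : Matrix n) where

    rowSpan-cong : ∀ {z w} → z ≗ w → RowSpan B z → RowSpan B w
    rowSpan-cong z≗w (x , p) = x , λ j → trans (sym (z≗w j)) (p j)

    rowSpan-+ : ∀ {z w} → RowSpan B z → RowSpan B w → RowSpan B (λ j → z j + w j)
    rowSpan-+ (x , p) (y , q) = (λ i → x i + y i) , λ j → trans (cong₂ _+_ (p j) (q j)) (sym (dot-+ˡ x y ((B ᵀ) j)))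

    rowSpan-* : ∀ a {z} → RowSpan B z → RowSpan B (λ j → a * z j)
    rowSpan-* a (x , p) = (λ i → a * x i) , λ j → trans (cong (a *_) (p j)) (sym (dot-*ˡ a x ((B ᵀ) j)))

    rowSpan-- : ∀ {z w} → RowSpan B z → RowSpan B w → RowSpan B (λ j → z j - w j)
    rowSpan-- {z} {w} p q = rowSpan-cong (λ j → negate (z j) (w j)) (rowSpan-+ p (rowSpan-* (- 1ℤ) q))
      where
      negate : ∀ a b → a + - 1ℤ * b ≡ a - b
      negate = solve-∀

    rowSpan-0 : RowSpan B (λ _ → 0ℤ)
    rowSpan-0 = (λ _ → 0ℤ) , λ j → sym (dot-zeroˡ _ ((B ᵀ) j) λ _ → refl)

    rowSpan-row : ∀ i → RowSpan B (B i)
    rowSpan-row i = basis i , λ j → sym (dot-basisˡ i ((B ᵀ) j))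

    rowSpan-∑ : ∀ {k} (t : Fin k → ℤ^ n) → (∀ i → RowSpan B (t i)) → RowSpan B (λ j → ∑ λ i → t i j)
    rowSpan-∑ {zero} t p = rowSpan-cong (λ j → sym (∑-empty _)) rowSpan-0
    rowSpan-∑ {suc k} t p = rowSpan-cong (λ j → sym (∑-suc _)) (rowSpan-+ (p zero) (rowSpan-∑ (t ∘ suc) (p ∘ suc)))

    kills-basis⇒kills : ∀ a → (∀ i → RowSpan B (λ j → a * basis i j)) →
      ∀ z → ∃ λ x → ∀ j → (x ·ᴹ B) j ≡ a * z j
    kills-basis⇒kills a kills z =
      let x , p = rowSpan-cong combine (rowSpan-∑ _ λ i → rowSpan-* (z i) (kills i)) in x , sym ∘ p
      where
      rearrange : ∀ z a b → z * (a * b) ≡ a * (z * b)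
      rearrange = solve-∀
      combine : ∀ j → ∑ (λ i → z i * (a * basis i j)) ≡ a * z j
      combine j = trans (∑-cong λ i → trans (rearrange (z i) a (basis i j)) (cong (λ t → a * (z i * t)) (basis-symmetric i j)))
        (trans (sym (∑-*ˡ a (λ i → z i * basis j i))) (cong (a *_) (trans (sym (dot-∑ z (basis j))) (dot-basisʳ j z))))

    rowSpan-dual : ∀ M y → (∀ i → + M ∣ dot (B i) y) → ∀ {z} → RowSpan B z → + M ∣ dot z y
    rowSpan-dual M y y∈ {z} (x , p) = subst (+ M ∣_)
      (sym (trans (dot-cong {y = y} p (λ _ → refl)) (trans (dot-·ᴹ B x y) (bilinear-dot B x y))))
      (∣-dot (+ M) x y∈)

  dot--ˡ : ∀ {n} (x y z : ℤ^ n) → dot (λ i → x i - y i) z ≡ dot x z - dot y z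
  dot--ˡ x y z = trans (dot-cong {y = z} (λ i → negate (x i) (y i)) (λ _ → refl)) (trans (dot-+ˡ x _ z)
    (trans (cong (λ t → dot x z + t) (dot-*ˡ (- 1ℤ) y z)) (sym (negate (dot x z) (dot y z)))))
    where
    negate : ∀ a b → a - b ≡ a + - 1ℤ * b
    negate = solve-∀

  -- The coordinate at 0 is dropped: ℤⁿ ≅ 𝒵_m, m = n + 1, with basis e_1 , … , e_n.
  module Lattice (n q : ℕ) where
    private
      m = suc n
    open IntLattice m q

    total : ZVec → ℤ
    total z = ∑ z

    rows : (ℕ → ZVec) → Matrix n
    rows g i j = g (suc (toℕ i)) (suc j)

    sumL-∑ : ∀ k (h : ℕ → ℕ) (G : ℕ → ZVec) j → sumL (applyUpTo h k) G j ≡ ∑ {k} λ i → G (h (toℕ i)) j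
    sumL-∑ zero h G j = sym (∑-empty _)
    sumL-∑ (suc k) h G j = trans (cong (λ t → G (h 0) j + t) (sumL-∑ k (h ∘ suc) G j)) (sym (∑-suc _))

    -- Coefficients in `InSpan` are functions on ℕ, so a finite vector is padded by 0.
    enumerated : ∀ {k} → (Fin k → ℤ) → ℕ → ℤ
    enumerated {zero} x _ = 0ℤ
    enumerated {suc k} x zero = x zero
    enumerated {suc k} x (suc i) = enumerated (x ∘ suc) i

    enumerated-toℕ : ∀ {k} (x : Fin k → ℤ) i → enumerated x (toℕ i) ≡ x i
    enumerated-toℕ x zero = refl
    enumerated-toℕ x (suc i) = enumerated-toℕ (x ∘ suc) i

    module _ {g : ℕ → ZVec} (g-total : ∀ v → total (g v) ≡ 0ℤ) where

      span-total : ∀ {z} → InSpan g z → total z ≡ 0ℤ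
      span-total {z} (c , p) = trans (∑-cong λ j → trans (p j) (sumL-∑ n suc (λ v → c v ·Z g v) j)) (trans (∑-swap {m} {n} _)
        (∑-zero λ i → trans (sym (∑-*ˡ (c (suc (toℕ i))) (g (suc (toℕ i)))))
          (trans (cong (c (suc (toℕ i)) *_) (g-total (suc (toℕ i)))) (ℤₚ.*-zeroʳ (c (suc (toℕ i)))))))

      span⇒rowSpan : ∀ {z} → InSpan g z → RowSpan (rows g) (z ∘ suc)
      span⇒rowSpan (c , p) = (λ i → c (suc (toℕ i))) , λ j → trans (p (suc j)) (trans (sumL-∑ n suc (λ v → c v ·Z g v) (suc j)) (sym (dot-∑ _ _)))

      -- Both sides have coordinate sum 0, so agreement away from coordinate 0 forces agreement
      -- there.
      rowSpan⇒span : ∀ {z} → total z ≡ 0ℤ → RowSpan (rows g) (z ∘ suc) → InSpan g z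
      rowSpan⇒span {z} z-total (x , p) = c , λ { zero → first ; (suc j) → rest j }
        where
        c : ℕ → ℤ
        c zero = 0ℤ
        c (suc i) = enumerated x i
        w = sumL range1 (λ v → c v ·Z g v)
        rest : ∀ j → z (suc j) ≡ w (suc j)
        rest j = trans (p j) (trans (dot-∑ _ _) (trans (∑-cong λ i → cong (_* g (suc (toℕ i)) (suc j)) (sym (enumerated-toℕ x i)))
          (sym (sumL-∑ n suc (λ v → c v ·Z g v) (suc j)))))
        first : z zero ≡ w zero
        first = cancel (z zero) (w zero) (∑ (z ∘ suc)) (trans (sym (∑-suc z)) (trans z-total
          (trans (sym (span-total (c , λ _ → refl))) (trans (∑-suc w) (cong (λ t → w zero + t) (sym (∑-cong rest)))))))
          where
          cancel : ∀ a b s → a + s ≡ b + s → a ≡ b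
          cancel a b s eq = trans (undo a s) (trans (cong (_- s) eq) (sym (undo b s)))
            where
            undo : ∀ a s → a ≡ a + s - s
            undo = solve-∀

    pairing-mono : ∀ k (t : Fin m → ℤ) → ∑ (λ j → mono k j * t j) ≡ t (k ℕ÷.mod m)
    pairing-mono k t = trans (∑-single (k ℕ÷.mod m) off) (on (k ℕ÷.mod m) (toℕ-mod k m))
      where
      off : ∀ j → ¬ j ≡ k ℕ÷.mod m → mono k j * t j ≡ 0ℤ
      off j j≢ with toℕ j ℕ.≟ k % m
      ... | yes j≡ = contradiction (Finₚ.toℕ-injective (trans j≡ (sym (toℕ-mod k m)))) j≢
      ... | no _ = refl
      on : ∀ j → toℕ j ≡ k % m → mono k j * t j ≡ t j
      on j j≡ with toℕ j ℕ.≟ k % m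
      ... | yes _ = ℤₚ.*-identityˡ (t j)
      ... | no j≢ = contradiction j≡ j≢

    mono-total : ∀ k → total (mono k) ≡ 1ℤ
    mono-total k = trans (∑-cong λ j → sym (ℤₚ.*-identityʳ (mono k j))) (pairing-mono k (λ _ → 1ℤ))

    total-- : ∀ z w → total (z -Z w) ≡ total z - total w
    total-- z w = trans (∑-cong λ j → negate (z j) (w j)) (trans (∑-+ z _) (trans (cong (λ t → total z + t) (sym (∑-*ˡ (- 1ℤ) w)))
      (sym (negate (total z) (total w)))))
      where
      negate : ∀ a b → a - b ≡ a + - 1ℤ * b
      negate = solve-∀

    e-total : ∀ v → total (e v) ≡ 0ℤ
    e-total v = trans (total-- (mono v) (mono 0)) (cong₂ _-_ (mono-total v) (mono-total 0))

    ε-total : ∀ v → total (ε v) ≡ 0ℤ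
    ε-total v = trans (total-- (+ q ·Z e v) (e (q ℕ.* v))) (cong₂ _-_
      (trans (sym (∑-*ˡ (+ q) (e v))) (trans (cong (+ q *_) (e-total v)) (ℤₚ.*-zeroʳ (+ q)))) (e-total (q ℕ.* v)))

    sumL-total : ∀ k h (G : ℕ → ZVec) → (∀ i → total (G i) ≡ 1ℤ) → total (sumL (applyUpTo h k) G) ≡ + k
    sumL-total zero h G p = ∑-zero λ _ → refl
    sumL-total (suc k) h G p = trans (∑-+ (G (h 0)) _) (cong₂ _+_ (p (h 0)) (sumL-total k (h ∘ suc) G p))

    f-total : ∀ v → total (f v) ≡ 0ℤ
    f-total v = trans (total-- (+ q ·Z mono v) _) (trans (cong₂ _-_
      (trans (sym (∑-*ˡ (+ q) (mono v))) (trans (cong (+ q *_) (mono-total v)) (ℤₚ.*-identityʳ (+ q))))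
      (sumL-total q id _ λ i → mono-total (q ℕ.* v ℕ.+ i))) (ℤₚ.+-inverseʳ (+ q)))

    -- The coordinates of e_k. Dropping coordinate 0 erases the term -x^0, so x^k and e_k have the
    -- same image and χ 0 is zero.
    χ : ℕ → ℤ^ n
    χ k j = mono k (suc j)

    χ-cong : ∀ {k l} → k % m ≡ l % m → χ k ≗ χ l
    χ-cong eq j rewrite eq = refl

    χ-0 : ∀ j → χ 0 j ≡ 0ℤ
    χ-0 j = refl

    dot-χ : ∀ k y → dot (χ k) y ≡ (0ℤ ∷ᵛ y) (k ℕ÷.mod m)
    dot-χ k y = trans (trans (dot-∑ (χ k) y) (trans (sym (ℤₚ.+-identityˡ _)) (trans
      (cong (_+ ∑ (λ j → χ k j * y j)) (sym (ℤₚ.*-zeroʳ (mono k zero)))) (sym (∑-suc (λ j → mono k j * (0ℤ ∷ᵛ y) j))))))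
      (pairing-mono k (0ℤ ∷ᵛ y))

    χ-basis : ∀ (i : Fin n) → χ (suc (toℕ i)) ≗ basis i
    χ-basis i j = trans (sym (dot-basisʳ j (χ (suc (toℕ i))))) (trans (dot-χ (suc (toℕ i)) (basis j)) (trans (cong (0ℤ ∷ᵛ basis j) index)
      (basis-symmetric j i)))
      where
      index : suc (toℕ i) ℕ÷.mod m ≡ suc i
      index = Finₚ.toℕ-injective (trans (toℕ-mod (suc (toℕ i)) m) (ℕ÷.m<n⇒m%n≡m (ℕ.s≤s (Finₚ.toℕ<n i))))

    residue : ∀ k → (k % m ≡ 0) ⊎ ∃ λ (i : Fin n) → k % m ≡ suc (toℕ i)
    residue k with k ℕ÷.mod m | toℕ-mod k m
    ... | zero | eq = inj₁ (sym eq)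
    ... | suc i | eq = inj₂ (i , sym eq)

    InZ⇒total : ∀ {z} → InZ z → total z ≡ 0ℤ
    InZ⇒total = span-total e-total

    total⇒InZ : ∀ {z} → total z ≡ 0ℤ → InZ z
    total⇒InZ {z} z-total = rowSpan⇒span e-total z-total (z ∘ suc , λ j → sym (trans
      (dot-congʳ (z ∘ suc) λ i → trans (ℤₚ.+-identityʳ (χ (suc (toℕ i)) j)) (χ-basis i j))
      (trans (dot-comm (z ∘ suc) _) (trans (dot-cong {y = z ∘ suc} (λ i → basis-symmetric i j) (λ _ → refl)) (dot-basisˡ j (z ∘ suc))))))

    lift : ℤ^ n → ZVec
    lift y zero = - ∑ y
    lift y (suc j) = y j

    lift-total : ∀ y → total (lift y) ≡ 0ℤ
    lift-total y = trans (∑-suc (lift y)) (ℤₚ.+-inverseˡ (∑ y))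

    -- The common frame of both isomorphisms. Y x lists the values on e_1, ..., e_n of the
    -- homomorphism to ℤ/M attached to x; the hypotheses say that Y identifies the group with the
    -- dual of 𝒵_m modulo the g_v, and `SelfDual` carries that dual back to the quotient itself.
    isomorphism : ∀ {a ℓ p} {A : Set a} {P : A → Set p} {_≈₁_ : A → A → Set ℓ} {_*₁_ : A → A → A}
      (g : ℕ → ZVec) → (∀ v → total (g v) ≡ 0ℤ) → (M : ℕ) → .{{_ : NonZero M}} →
      (∀ i → RowSpan (rows g) (λ j → + M * basis i j)) →
      (Y : A → ℤ^ n) →
      (∀ {x} → P x → ∀ i → + M ∣ dot (rows g i) (Y x)) →
      (∀ {x y} → P x → P y → P (x *₁ y)) →
      (∀ {x y} → P x → P y → x ≈₁ y → ∀ i → Y x i ≡ Y y i mod[ M ]) →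
      (∀ {x y} → P x → P y → ∀ i → Y (x *₁ y) i ≡ Y x i + Y y i mod[ M ]) →
      (∀ {x y} → P x → P y → (∀ i → Y x i ≡ Y y i mod[ M ]) → x ≈₁ y) →
      (∀ {y} → (∀ i → + M ∣ dot (rows g i) y) → ∃ λ x → P x × ∀ i → Y x i ≡ y i mod[ M ]) →
      Isomorphic P _≈₁_ _*₁_ InZ (λ z w → InSpan g (z -Z w)) _+Z_
    isomorphism g g-total M kills Y dual closed Y-cong Y-homo Y-injective Y-surjective = lift ∘ ψ ∘ Y , record
      { into = λ x _ → total⇒InZ (lift-total (ψ (Y x)))
      ; cong = λ x y x∈ y∈ x≈y → rowSpan⇒span g-total (difference-total (lift-total _) (lift-total _))
          (ψ-cong (dual x∈) (dual y∈) (Y-cong x∈ y∈ x≈y))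
      ; homo = λ x y x∈ y∈ → rowSpan⇒span g-total (difference-total (lift-total _) (sum-total (lift-total _) (lift-total _)))
          (ψ-homo (dual (closed x∈ y∈)) (dual x∈) (dual y∈) (Y-homo x∈ y∈))
      ; injective = λ x y x∈ y∈ p → Y-injective x∈ y∈ (ψ-injective (dual x∈) (dual y∈) (span⇒rowSpan g-total p))
      ; surjective = λ z z∈ →
          let y , y∈ , ψy≗z = ψ-surjective (z ∘ suc)
              x , x∈ , Yx≡y = Y-surjective y∈
          in x , x∈ , rowSpan⇒span g-total (difference-total (lift-total _) (InZ⇒total z∈))
            (rowSpan-cong (rows g) (λ j → cong (λ t → ψ (Y x) j - t) (ψy≗z j)) (ψ-cong (dual x∈) y∈ Yx≡y)) }
      where
      open SelfDual (rows g) M (kills-basis⇒kills (rows g) (+ M) kills)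
      difference-total : ∀ {z w} → total z ≡ 0ℤ → total w ≡ 0ℤ → total (z -Z w) ≡ 0ℤ
      difference-total {z} {w} p q = trans (total-- z w) (cong₂ _-_ p q)
      sum-total : ∀ {z w} → total z ≡ 0ℤ → total w ≡ 0ℤ → total (z +Z w) ≡ 0ℤ
      sum-total {z} {w} p q = trans (∑-+ z w) (cong₂ _+_ p q)

-- The relations ε and f, and the homomorphisms to ℤ/M that respect them.

module LatticeRelations where

  open import Data.Integer as ℤ using (ℤ; 0ℤ; 1ℤ; +_; _+_; _*_; -_; _-_)
  open import Data.Integer.Divisibility.Signed using (_∣_; divides; *-cancelˡ-∣)
  open import Data.Integer.Tactic.RingSolver using (solve-∀)
  open import Data.List using (applyUpTo)
  open import Data.Product using (∃; _,_; _×_)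
  open import Relation.Binary.PropositionalEquality
  open Sums
  open SelfTransposition
  open SelfDuality
  open Lattices
  open CirculantAlgebra using (toℕ-mod; %-+ˡ)
  open RootsAndCongruences using (mod-refl; mod-reflexive; mod-sym; mod-trans; mod-+; mod-*ˡ; mod-neg; ≡0-mod⇒∣; Compatible)

  dot-*- : ∀ {n} a (u w y : ℤ^ n) → dot (λ j → a * u j - w j) y ≡ a * dot u y - dot w y
  dot-*- a u w y = trans (dot--ˡ (λ j → a * u j) w y) (cong (_- dot w y) (dot-*ˡ a u y))

  mod-- : ∀ {M a a′ b b′} → a ≡ a′ mod[ M ] → b ≡ b′ mod[ M ] → a - b ≡ a′ - b′ mod[ M ]
  mod-- p q = mod-+ p (mod-neg q)

  module Relations (n q d M r : ℕ) (q^d≡1+M : q ℕ.^ suc d ≡ suc M) (M≡rm : M ≡ r ℕ.* suc n) where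
    private
      m = suc n
    open IntLattice m q
    open Lattice n q

    module _ (B : Matrix n) (u : ℕ → ℤ^ n) (step : ∀ k → RowSpan B (λ j → + q * u k j - u (q ℕ.* k) j)) where

      -- Modulo the relations, multiplication by q acts on u as k ↦ q k. Used with u = χ for Σ and
      -- with u = X for S, in both cases up to the exponent with q^(d+1) = 1 + M.
      iterate : ∀ e k → RowSpan B (λ j → + (q ℕ.^ e) * u k j - u (q ℕ.^ e ℕ.* k) j)
      iterate zero k = rowSpan-cong B (λ j → trans (sym (cancel (u k j))) (cong (λ t → 1ℤ * u k j - u t j) (sym (ℕₚ.+-identityʳ k)))) (rowSpan-0 B)
        where
        cancel : ∀ a → 1ℤ * a - a ≡ 0ℤ
        cancel = solve-∀
      iterate (suc e) k = rowSpan-cong B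
        (λ j → trans (telescope (+ q) (+ (q ℕ.^ e)) (u k j) (u (q ℕ.^ e ℕ.* k) j) _)
          (cong₂ (λ s t → s * u k j - u t j) (sym (ℤₚ.pos-* q (q ℕ.^ e))) (sym (ℕₚ.*-assoc q (q ℕ.^ e) k))))
        (rowSpan-+ B (rowSpan-* B (+ q) (iterate e k)) (step (q ℕ.^ e ℕ.* k)))
        where
        telescope : ∀ q s a b c → q * (s * a - b) + (q * b - c) ≡ q * s * a - c
        telescope = solve-∀

      iterate-1+M : ∀ k → RowSpan B (λ j → + suc M * u k j - u (suc M ℕ.* k) j)
      iterate-1+M k = subst (λ t → RowSpan B (λ j → + t * u k j - u (t ℕ.* k) j)) q^d≡1+M (iterate (suc d) k)

    [1+M]k≡ : ∀ k → suc M ℕ.* k ≡ k ℕ.+ k ℕ.* r ℕ.* m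
    [1+M]k≡ k = trans (cong (λ t → suc t ℕ.* k) M≡rm) (rearrange r m k)
      where
      rearrange : ∀ r m k → suc (r ℕ.* m) ℕ.* k ≡ k ℕ.+ k ℕ.* r ℕ.* m
      rearrange = ℕ-Solver.solve-∀

    χ-zero : ∀ {k} → k % m ≡ 0 → ∀ j → χ k j ≡ 0ℤ
    χ-zero {k} k%m≡0 j = χ-cong {k} {0} k%m≡0 j

    q*-cong : ∀ {k l} → k % m ≡ l % m → (q ℕ.* k) % m ≡ (q ℕ.* l) % m
    q*-cong {k} {l} eq = trans (ℕ÷.%-distribˡ-* q k m) (trans (cong (λ t → (q % m ℕ.* t) % m) eq) (sym (ℕ÷.%-distribˡ-* q l m)))

    suc-toℕ% : ∀ (i : Fin n) → suc (toℕ i) % m ≡ suc (toℕ i)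
    suc-toℕ% i = ℕ÷.m<n⇒m%n≡m (ℕ.s≤s (Finₚ.toℕ<n i))

    ε-row : ∀ v j → ε v (suc j) ≡ + q * χ v j - χ (q ℕ.* v) j
    ε-row v j = cong₂ (λ s t → + q * s - t) (ℤₚ.+-identityʳ (χ v j)) (ℤₚ.+-identityʳ (χ (q ℕ.* v) j))

    -- Only ε_1, ..., ε_n are rows; any other v reduces modulo m to one of these, or to 0, where the
    -- relation is trivial.
    ε-step : ∀ v → RowSpan (rows ε) (λ j → + q * χ v j - χ (q ℕ.* v) j)
    ε-step v with residue v
    ... | inj₁ v%m≡0 = rowSpan-cong (rows ε) (λ j → sym (trans (cong₂ (λ s t → + q * s - t) (χ-zero {v} v%m≡0 j)
            (χ-zero {q ℕ.* v} (trans (q*-cong {v} {0} v%m≡0) (cong (_% m) (ℕₚ.*-zeroʳ q))) j)) (vanish (+ q)))) (rowSpan-0 (rows ε))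
      where
      vanish : ∀ q → q * 0ℤ - 0ℤ ≡ 0ℤ
      vanish = solve-∀
    ... | inj₂ (i , v%m≡) = rowSpan-cong (rows ε) (λ j → trans (ε-row (suc (toℕ i)) j) (cong₂ (λ s t → + q * s - t)
            (χ-cong {suc (toℕ i)} {v} same j) (χ-cong {q ℕ.* suc (toℕ i)} {q ℕ.* v} (q*-cong {suc (toℕ i)} {v} same) j))) (rowSpan-row (rows ε) i)
      where
      same : suc (toℕ i) % m ≡ v % m
      same = trans (suc-toℕ% i) (sym v%m≡)

    -- As 1 + M ≡ 1 modulo m, iterating the relation gives (1 + M) e_v ≡ e_v.
    ε-kills : ∀ i → RowSpan (rows ε) (λ j → + M * basis i j)
    ε-kills i = rowSpan-cong (rows ε) (λ j → trans
      (cong (λ t → + suc M * χ v j - t) (χ-cong {suc M ℕ.* v} {v} (trans (cong (_% m) ([1+M]k≡ v)) (ℕ÷.[m+kn]%n≡m%n v (v ℕ.* r) m)) j))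
      (trans (cong (λ t → t * χ v j - χ v j) (ℤₚ.pos-+ 1 M)) (trans (cancel (+ M) (χ v j)) (cong (+ M *_) (χ-basis i j)))))
      (iterate-1+M (rows ε) χ ε-step v)
      where
      v = suc (toℕ i)
      cancel : ∀ m a → (1ℤ + m) * a - a ≡ m * a
      cancel = solve-∀

    by-residue : ∀ (η : ℕ → ℤ) y → (∀ k → η (k % m) ≡ η k mod[ M ]) → η 0 ≡ 0ℤ mod[ M ] →
      (∀ i → y i ≡ η (suc (toℕ i)) mod[ M ]) → ∀ k → dot (χ k) y ≡ η k mod[ M ]
    by-residue η y η-periodic η0≡0 y≡η k = mod-trans (mod-reflexive (dot-χ k y)) (at (k ℕ÷.mod m) (toℕ-mod k m))
      where
      at : ∀ i → toℕ i ≡ k % m → (0ℤ ∷ᵛ y) i ≡ η k mod[ M ]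
      at zero eq = mod-trans (mod-sym η0≡0) (mod-trans (mod-reflexive (cong η eq)) (η-periodic k))
      at (suc i) eq = mod-trans (y≡η i) (mod-trans (mod-reflexive (cong η eq)) (η-periodic k))

    ε-dual : ∀ {b} → Compatible m q M b → ∀ i → + M ∣ dot (rows ε i) (λ i → b (suc (toℕ i)))
    ε-dual {b} c i = ≡0-mod⇒∣ (mod-trans (mod-reflexive (trans (dot-cong {y = y} (ε-row v) (λ _ → refl)) (dot-*- (+ q) (χ v) (χ (q ℕ.* v)) y)))
      (mod-trans (mod-- (mod-*ˡ (+ q) (value v)) (value (q ℕ.* v))) (mod-trans (mod-- (frob v) mod-refl) (mod-reflexive (ℤₚ.+-inverseʳ (b (q ℕ.* v)))))))
      where
      open Compatible c
      v = suc (toℕ i)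
      y : ℤ^ n
      y i = b (suc (toℕ i))
      value : ∀ k → dot (χ k) y ≡ b k mod[ M ]
      value = by-residue b y periodic at-zero (λ i → mod-refl)

    ε-dual-surjective : ∀ {y} → (∀ i → + M ∣ dot (rows ε i) y) → ∃ λ b → Compatible m q M b × ∀ i → b (suc (toℕ i)) ≡ y i
    ε-dual-surjective {y} y∈ = (λ k → dot (χ k) y) , record
      { periodic = λ v → mod-reflexive (dot-cong {y = y} (χ-cong {v % m} {v} (ℕ÷.m%n%n≡m%n v m)) (λ _ → refl))
      ; at-zero = mod-reflexive (dot-zeroˡ (χ 0) y χ-0)
      ; frob = λ v → congruent (subst (+ M ∣_) (dot-*- (+ q) (χ v) (χ (q ℕ.* v)) y) (rowSpan-dual (rows ε) M y y∈ (ε-step v)))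
      } , λ i → trans (dot-cong {y = y} (χ-basis i) (λ _ → refl)) (dot-basisˡ i y)

    -- The partial sum e_0 + ⋯ + e_(k-1), which multiplication by x - 1 carries to e_k - k e_1.
    X : ℕ → ℤ^ n
    X zero j = 0ℤ
    X (suc k) j = X k j + χ k j

    X-sumL : ∀ ℓ a (h : ℕ → ℕ) (G : ℕ → ZVec) j → (∀ i → G (h i) (suc j) ≡ χ (a ℕ.+ i) j) →
      sumL (applyUpTo h ℓ) G (suc j) ≡ X (a ℕ.+ ℓ) j - X a j
    X-sumL zero a h G j p = sym (trans (cong (λ t → X t j - X a j) (ℕₚ.+-identityʳ a)) (ℤₚ.+-inverseʳ (X a j)))
    X-sumL (suc ℓ) a h G j p = trans (cong₂ _+_ (trans (p 0) (cong (λ t → χ t j) (ℕₚ.+-identityʳ a)))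
      (X-sumL ℓ (suc a) (h ∘ suc) G j λ i → trans (p (suc i)) (cong (λ t → χ t j) (ℕₚ.+-suc a i))))
      (trans (telescope (χ a j) (X (suc a ℕ.+ ℓ) j) (X a j)) (cong (λ t → X t j - X a j) (sym (ℕₚ.+-suc a ℓ))))
      where
      telescope : ∀ c b x → c + (b - (x + c)) ≡ b - x
      telescope = solve-∀

    X-periodic : ∀ k j → X (k ℕ.+ m) j ≡ X k j + X m j
    X-periodic zero j = sym (ℤₚ.+-identityˡ (X m j))
    X-periodic (suc k) j = trans (cong₂ _+_ (X-periodic k j) (χ-cong {k ℕ.+ m} {k} (ℕ÷.[m+n]%n≡m%n k m) j)) (swap (X k j) (X m j) (χ k j))
      where
      swap : ∀ a b c → a + b + c ≡ a + c + b
      swap = solve-∀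

    X-multiple : ∀ k t j → X (k ℕ.+ t ℕ.* m) j ≡ X k j + + t * X m j
    X-multiple k zero j = trans (cong (λ s → X s j) (ℕₚ.+-identityʳ k)) (sym (ℤₚ.+-identityʳ (X k j)))
    X-multiple k (suc t) j = trans (cong (λ s → X s j) (regroup k t m)) (trans (X-periodic (k ℕ.+ t ℕ.* m) j)
      (trans (cong (_+ X m j) (X-multiple k t j)) (trans (collect (X k j) (+ t) (X m j)) (cong (λ s → X k j + s * X m j) (sym (ℤₚ.pos-+ 1 t))))))
      where
      regroup : ∀ k t m → k ℕ.+ suc t ℕ.* m ≡ k ℕ.+ t ℕ.* m ℕ.+ m
      regroup = ℕ-Solver.solve-∀
      collect : ∀ x t y → x + t * y + y ≡ x + (1ℤ + t) * y
      collect = solve-∀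

    -- The vector carried to ε_k by x - 1, as the multiples of e_1 cancel. Thus `f-row` is the
    -- identity (x - 1) f_k = ε_(k+1) - ε_k with x - 1 divided out.
    D : ℕ → ℤ^ n
    D k j = + q * X k j - X (q ℕ.* k) j

    f-row : ∀ k j → f k (suc j) ≡ D (suc k) j - D k j
    f-row k j = trans (cong (λ t → + q * χ k j - t) (X-sumL q (q ℕ.* k) id (λ i → mono (q ℕ.* k ℕ.+ i)) j λ i → refl))
      (trans (regroup (+ q) (X k j) (χ k j) _ (X (q ℕ.* k) j)) (cong (λ t → + q * X (suc k) j - X t j - D k j) (trans (ℕₚ.+-comm (q ℕ.* k) q) (sym (ℕₚ.*-suc q k)))))
      where
      regroup : ∀ q x c s t → q * c - (s - t) ≡ q * (x + c) - s - (q * x - t)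
      regroup = solve-∀

    -- X is periodic only up to multiples of X m, but q X and X (q ·) gain the same multiple over a
    -- full period.
    D-multiple : ∀ k t j → D (k ℕ.+ t ℕ.* m) j ≡ D k j
    D-multiple k t j = trans (cong₂ (λ a b → + q * a - b) (X-multiple k t j)
      (trans (cong (λ s → X s j) (regroup q k t m)) (trans (X-multiple (q ℕ.* k) (q ℕ.* t) j) (cong (λ s → X (q ℕ.* k) j + s * X m j) (ℤₚ.pos-* q t)))))
      (cancel (+ q) (X k j) (+ t) (X m j) (X (q ℕ.* k) j))
      where
      regroup : ∀ q k t m → q ℕ.* (k ℕ.+ t ℕ.* m) ≡ q ℕ.* k ℕ.+ q ℕ.* t ℕ.* m
      regroup = ℕ-Solver.solve-∀
      cancel : ∀ q x t y z → q * (x + t * y) - (z + q * t * y) ≡ q * x - z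
      cancel = solve-∀

    D-0 : ∀ j → D 0 j ≡ 0ℤ
    D-0 j = trans (cong (λ t → + q * 0ℤ - X t j) (ℕₚ.*-zeroʳ q)) (vanish (+ q))
      where
      vanish : ∀ q → q * 0ℤ - 0ℤ ≡ 0ℤ
      vanish = solve-∀

    -- f_0 is not among the generators, but D_m = D_0 = 0, so that D_k = - (f_k + ⋯ + f_(m-1)) for k > 0.
    D-descend : ∀ t k → suc k ℕ.+ t ≡ m → RowSpan (rows f) (D (suc k))
    D-descend zero k eq = rowSpan-cong (rows f) (λ j → sym (trans (cong (λ s → D s j)
      (trans (sym (ℕₚ.+-identityʳ (suc k))) (trans eq (sym (ℕₚ.*-identityˡ m))))) (trans (D-multiple 0 1 j) (D-0 j)))) (rowSpan-0 (rows f))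
    D-descend (suc t) k eq = rowSpan-cong (rows f) (λ j → trans (cong (λ s → D (suc (suc k)) j - s) (trans (cong (λ s → f (suc s) (suc j)) (Finₚ.toℕ-fromℕ< k<n)) (f-row (suc k) j)))
      (cancel (D (suc (suc k)) j) (D (suc k) j)))
      (rowSpan-- (rows f) (D-descend t (suc k) (trans (cong suc (sym (ℕₚ.+-suc k t))) eq)) (rowSpan-row (rows f) (fromℕ< k<n)))
      where
      k<n : k ℕ.< n
      k<n = ℕₚ.≤-trans (ℕ.s≤s (ℕₚ.m≤m+n k t)) (ℕₚ.≤-reflexive (trans (sym (ℕₚ.+-suc k t)) (ℕₚ.suc-injective eq)))
      cancel : ∀ a b → a - (a - b) ≡ b
      cancel = solve-∀

    D-span : ∀ k → RowSpan (rows f) (D k)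
    D-span k = rowSpan-cong (rows f) (λ j → trans (sym (D-multiple (k % m) (k ℕ./ m) j)) (cong (λ s → D s j) (sym (ℕ÷.m≡m%n+[m/n]*n k m)))) (below (k % m) (ℕ÷.m%n<n k m))
      where
      below : ∀ k → k ℕ.< m → RowSpan (rows f) (D k)
      below zero _ = rowSpan-cong (rows f) (sym ∘ D-0) (rowSpan-0 (rows f))
      below (suc k) k<m = D-descend (m ℕ.∸ suc k) k (ℕₚ.m+[n∸m]≡n (ℕₚ.<⇒≤ k<m))

    -- Iteration gives (1 + M) X_k ≡ X_l with l = (1 + M) k = k + k r m, and the k r full periods
    -- contribute k r X_m.
    MX-span : ∀ k → RowSpan (rows f) (λ j → + M * X k j - + (k ℕ.* r) * X m j)
    MX-span k = rowSpan-cong (rows f) (λ j → trans (cong₂ (λ s t → s * X k j - t) (ℤₚ.pos-+ 1 M)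
      (trans (cong (λ s → X s j) ([1+M]k≡ k)) (X-multiple k (k ℕ.* r) j))) (cancel (+ M) (X k j) _)) (iterate-1+M (rows f) X D-span k)
      where
      cancel : ∀ m x y → (1ℤ + m) * x - (x + y) ≡ m * x - y
      cancel = solve-∀

    -- The case k = 1 of `MX-span`, where X 1 = χ 0 = 0 and only the defect is left.
    rXm-span : RowSpan (rows f) (λ j → + r * X m j)
    rXm-span = rowSpan-cong (rows f) (λ j → trans (cong (λ s → - 1ℤ * (+ M * (0ℤ + 0ℤ) - + s * X m j)) (ℕₚ.*-identityˡ r)) (negate (+ M) (+ r) (X m j)))
      (rowSpan-* (rows f) (- 1ℤ) (MX-span 1))
      where
      negate : ∀ m r x → - 1ℤ * (m * (0ℤ + 0ℤ) - r * x) ≡ r * x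
      negate = solve-∀

    -- χ_v = X_(v+1) - X_v, so subtracting two instances of `MX-span` leaves M χ_v - r X_m, and r
    -- X_m is already in the span.
    f-kills : ∀ i → RowSpan (rows f) (λ j → + M * basis i j)
    f-kills i = rowSpan-cong (rows f) (λ j → trans (combine (+ M) (X v j) (χ v j) (+ v) (+ r) (X m j) _ _
        (trans (cong +_ (refl {x = suc v ℕ.* r})) (trans (ℤₚ.pos-+ r (v ℕ.* r)) (cong (λ t → + r + t) (ℤₚ.pos-* v r)))) (ℤₚ.pos-* v r))
        (cong (+ M *_) (χ-basis i j)))
      (rowSpan-- (rows f) (rowSpan-- (rows f) (MX-span (suc v)) (MX-span v)) (rowSpan-* (rows f) (- 1ℤ) rXm-span))
      where
      v = suc (toℕ i)
      combine : ∀ m x c v r y s t → s ≡ r + v * r → t ≡ v * r → m * (x + c) - s * y - (m * x - t * y) - - 1ℤ * (r * y) ≡ m * c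
      combine m x c v r y _ _ refl refl = identity m x c v r y
        where
        identity : ∀ m x c v r y → m * (x + c) - (r + v * r) * y - (m * x - v * r * y) - - 1ℤ * (r * y) ≡ m * c
        identity = solve-∀

    -- The restriction of b to (x - 1) 𝒵_m: y_v = b((x - 1) e_v).
    restrict : (ℕ → ℤ) → ℕ → ℤ
    restrict b v = b (suc v) - b v - b 1

    -- Pairing with y is b after multiplication by x - 1. Hence X_k pairs to b_k - k b_1 and D_k to
    -- the value of b on ε_k, which is 0; f_k is a difference of two D's.
    f-dual : ∀ {b} → Compatible m q M b → ∀ i → + M ∣ dot (rows f i) (λ i → restrict b (suc (toℕ i)))
    f-dual {b} c i = ≡0-mod⇒∣ (mod-trans (mod-reflexive (trans (dot-cong {y = y} (f-row (suc (toℕ i))) (λ _ → refl)) (dot--ˡ (D (suc (suc (toℕ i)))) (D (suc (toℕ i))) y)))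
      (mod-trans (mod-- (D-value (suc (suc (toℕ i)))) (D-value (suc (toℕ i)))) mod-refl))
      where
      open Compatible c
      y : ℤ^ n
      y i = restrict b (suc (toℕ i))
      b-suc : ∀ k → b (suc (k % m)) ≡ b (suc k) mod[ M ]
      b-suc k = mod-trans (mod-sym (periodic (suc (k % m)))) (mod-trans (mod-reflexive (cong b
        (trans (cong (_% m) (ℕₚ.+-comm 1 (k % m))) (trans (%-+ˡ m k 1) (cong (_% m) (ℕₚ.+-comm k 1)))))) (periodic (suc k)))
      cancel-zero : ∀ a b → a - b - a ≡ - b
      cancel-zero = solve-∀
      χ-value : ∀ k → dot (χ k) y ≡ restrict b k mod[ M ]
      χ-value = by-residue (restrict b) y (λ k → mod-- (mod-- (b-suc k) (periodic k)) mod-refl)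
        (mod-trans (mod-reflexive (cancel-zero (b 1) (b 0))) (mod-neg at-zero)) (λ i → mod-refl)
      X-value : ∀ k → dot (X k) y ≡ b k - + k * b 1 mod[ M ]
      X-value zero = mod-trans (mod-reflexive (dot-zeroˡ (X 0) y λ _ → refl)) (mod-trans (mod-sym at-zero) (mod-reflexive (sym (ℤₚ.+-identityʳ (b 0)))))
      X-value (suc k) = mod-trans (mod-reflexive (dot-+ˡ (X k) (χ k) y)) (mod-trans (mod-+ (X-value k) (χ-value k))
        (mod-reflexive (trans (collect (b k) (+ k) (b 1) (b (suc k))) (cong (λ t → b (suc k) - t * b 1) (sym (ℤₚ.pos-+ 1 k))))))
        where
        collect : ∀ b k c b′ → b - k * c + (b′ - b - c) ≡ b′ - (1ℤ + k) * c
        collect = solve-∀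
      D-value : ∀ k → dot (D k) y ≡ 0ℤ mod[ M ]
      D-value k = mod-trans (mod-reflexive (dot-*- (+ q) (X k) (X (q ℕ.* k)) y))
        (mod-trans (mod-- (mod-*ˡ (+ q) (X-value k)) (X-value (q ℕ.* k)))
        (mod-trans (mod-reflexive (trans (cong (λ t → + q * (b k - + k * b 1) - (b (q ℕ.* k) - t * b 1)) (ℤₚ.pos-* q k)) (collect (+ q) (b k) (+ k) (b 1) (b (q ℕ.* k)))))
        (mod-trans (mod-- (frob k) mod-refl) (mod-reflexive (ℤₚ.+-inverseʳ (b (q ℕ.* k)))))))
        where
        collect : ∀ q b k c b′ → q * (b - k * c) - (b′ - q * k * c) ≡ q * b - b′
        collect = solve-∀

    -- Extending a functional from (x - 1) 𝒵_m to 𝒵_m means choosing c = b_1, after which b_v = v c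
    -- + Y_v is forced. Periodicity requires m c = - Y_m, which is solvable: r X_m lies in the span,
    -- so M = r m divides r Y_m and m divides Y_m.
    f-dual-surjective : .{{_ : NonZero r}} → ∀ {y} → (∀ i → + M ∣ dot (rows f i) y) →
      ∃ λ b → Compatible m q M b × ∀ i → restrict b (suc (toℕ i)) ≡ y i
    f-dual-surjective {y} y∈ = b , record
      { periodic = λ v → mod-reflexive (periodic v)
      ; at-zero = mod-reflexive (trans (cong (λ t → 0ℤ * c + t) Y-0) refl)
      ; frob = λ v → congruent (subst (+ M ∣_) (trans (dot-*- (+ q) (X v) (X (q ℕ.* v)) y) (shift (+ q) (+ v) c (Y v) (Y (q ℕ.* v)) _ (ℤₚ.pos-* q v)))
          (rowSpan-dual (rows f) M y y∈ (D-span v))) } ,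
      λ i → trans (restricted (suc (toℕ i))) (trans (dot-cong {y = y} (χ-basis i) (λ _ → refl)) (dot-basisˡ i y))
      where
      Y : ℕ → ℤ
      Y k = dot (X k) y
      Y-0 : Y 0 ≡ 0ℤ
      Y-0 = dot-zeroˡ (X 0) y λ _ → refl
      m∣Ym : + m ∣ Y m
      m∣Ym = *-cancelˡ-∣ (+ r) (subst₂ _∣_ (trans (cong +_ M≡rm) (ℤₚ.pos-* r m)) (dot-*ˡ (+ r) (X m) y) (rowSpan-dual (rows f) M y y∈ rXm-span))
      t = _∣_.quotient m∣Ym
      c = - t
      b : ℕ → ℤ
      b v = + v * c + Y v
      shift : ∀ q v c a a′ w → w ≡ q * v → q * a - a′ ≡ q * (v * c + a) - (w * c + a′)
      shift q v c a a′ _ refl = identity q v c a a′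
        where
        identity : ∀ q v c a a′ → q * a - a′ ≡ q * (v * c + a) - (q * v * c + a′)
        identity = solve-∀
      periodic : ∀ v → b (v % m) ≡ b v
      periodic v = sym (trans (cong b (ℕ÷.m≡m%n+[m/n]*n v m)) (full-turns (v % m) (v ℕ./ m)))
        where
        full-turns : ∀ k s → b (k ℕ.+ s ℕ.* m) ≡ b k
        full-turns k s = trans (cong₂ (λ a a′ → a * c + a′) (trans (ℤₚ.pos-+ k (s ℕ.* m)) (cong (λ u → + k + u) (ℤₚ.pos-* s m)))
          (trans (dot-cong {y = y} (X-multiple k s) (λ _ → refl)) (trans (dot-+ˡ (X k) _ y) (cong (λ u → Y k + u) (trans (dot-*ˡ (+ s) (X m) y) (cong (+ s *_) (_∣_.equality m∣Ym)))))))
          (cancel (+ k) (+ s) (+ m) t (Y k))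
          where
          cancel : ∀ k s m t y → (k + s * m) * - t + (y + s * (t * m)) ≡ k * - t + y
          cancel = solve-∀
      Y-suc : ∀ k → Y (suc k) ≡ Y k + dot (χ k) y
      Y-suc k = dot-+ˡ (X k) (χ k) y
      Y-1 : Y 1 ≡ 0ℤ
      Y-1 = dot-zeroˡ (X 1) y λ _ → refl
      restricted : ∀ k → restrict b k ≡ dot (χ k) y
      restricted k = trans (cong₂ (λ u w → (u * c + w) - b k - b 1) (ℤₚ.pos-+ 1 k) (Y-suc k))
        (trans (cancel (+ k) c (Y k) (dot (χ k) y) (Y 1)) (trans (cong (λ s → dot (χ k) y - s) Y-1) (ℤₚ.+-identityʳ _)))
        where
        cancel : ∀ k c a x z → (1ℤ + k) * c + (a + x) - (k * c + a) - (1ℤ * c + z) ≡ x - z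
        cancel = solve-∀

    -- b vanishes on (x - 1) 𝒵_m exactly when b_v = v b_1, and then m b_1 = b_m = 0.
    restrict-kernel : .{{_ : NonZero r}} → ∀ {b b′} → Compatible m q M b → Compatible m q M b′ →
      (∀ i → restrict b (suc (toℕ i)) ≡ restrict b′ (suc (toℕ i)) mod[ M ]) →
      ∃ λ k → ∀ v → b v ≡ b′ v + + (k ℕ.* v ℕ.* r) mod[ M ]
    restrict-kernel {b} {b′} c c′ same = k , λ v → mod-trans (mod-reflexive (split (b v) (b′ v)))
        (mod-+ (mod-refl {a = b′ v}) (mod-trans (δ-periodic v) (mod-trans (linear (v % m) (ℕₚ.<⇒≤ (ℕ÷.m%n<n v m)))
          (mod-trans (mod-*ˡ (+ (v % m)) β≡kr) (mod-trans (mod-reflexive (reorder (+ (v % m)) (+ k) (+ r)))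
          (mod-trans (scaled v) (mod-reflexive (sym (trans (ℤₚ.pos-* (k ℕ.* v) r) (cong (_* + r) (ℤₚ.pos-* k v)))))))))))
      where
      module C = Compatible c
      module C′ = Compatible c′
      δ : ℕ → ℤ
      δ v = b v - b′ v
      split : ∀ a a′ → a ≡ a′ + (a - a′)
      split = solve-∀
      δ-0 : δ 0 ≡ 0ℤ mod[ M ]
      δ-0 = mod-- C.at-zero C′.at-zero
      δ-periodic : ∀ v → δ v ≡ δ (v % m) mod[ M ]
      δ-periodic v = mod-sym (mod-- (C.periodic v) (C′.periodic v))
      δ-suc : ∀ v → v ℕ.< m → δ (suc v) ≡ δ v + δ 1 mod[ M ]
      δ-suc zero _ = mod-trans (mod-reflexive (sym (ℤₚ.+-identityˡ (δ 1)))) (mod-+ (mod-sym δ-0) mod-refl)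
      δ-suc (suc v) (ℕ.s≤s v<n) = mod-trans (mod-reflexive (regroup (b (suc (suc v))) (b (suc v)) (b 1) (b′ (suc (suc v)))))
        (mod-trans (mod-+ (mod-- (subst (λ i → restrict b (suc i) ≡ restrict b′ (suc i) mod[ M ]) (Finₚ.toℕ-fromℕ< v<n) (same (fromℕ< v<n)))
            (mod-refl {a = b′ (suc (suc v))})) (mod-refl {a = b (suc v) + b 1}))
          (mod-reflexive (regroup′ (b (suc v)) (b 1) (b′ (suc (suc v))) (b′ (suc v)) (b′ 1))))
        where
        regroup : ∀ x y z w → x - w ≡ x - y - z - w + (y + z)
        regroup = solve-∀
        regroup′ : ∀ y z w u v → w - u - v - w + (y + z) ≡ y - u + (z - v)
        regroup′ = solve-∀
      linear : ∀ v → v ℕ.≤ m → δ v ≡ + v * δ 1 mod[ M ]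
      linear zero _ = δ-0
      linear (suc v) v<m = mod-trans (δ-suc v v<m) (mod-trans (mod-+ (linear v (ℕₚ.<⇒≤ v<m)) mod-refl)
        (mod-reflexive (trans (collect (+ v) (δ 1)) (cong (_* δ 1) (sym (ℤₚ.pos-+ 1 v))))))
        where
        collect : ∀ v x → v * x + x ≡ (1ℤ + v) * x
        collect = solve-∀
      M∣mδ1 : + M ∣ + m * δ 1
      M∣mδ1 = ≡0-mod⇒∣ (mod-trans (mod-sym (linear m ℕₚ.≤-refl)) (mod-trans (δ-periodic m)
        (mod-trans (mod-reflexive (cong δ (ℕ÷.n%n≡0 m))) δ-0)))
      +M≡ : + M ≡ + m * + r
      +M≡ = trans (cong +_ M≡rm) (trans (ℤₚ.pos-* r m) (ℤₚ.*-comm (+ r) (+ m)))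
      r∣δ1 : + r ∣ δ 1
      r∣δ1 = *-cancelˡ-∣ (+ m) (subst (_∣ + m * δ 1) +M≡ M∣mδ1)
      -- The exponent of x has to be natural, so the quotient δ 1 / r is reduced modulo m; this
      -- changes δ 1 by a multiple of m r = M.
      k : ℕ
      k = _∣_.quotient r∣δ1 ℤ÷.%ℕ m
      β≡kr : δ 1 ≡ + k * + r mod[ M ]
      β≡kr = congruent (divides s (trans (cong (_- + k * + r) (_∣_.equality r∣δ1))
        (trans (cong (λ t → t * + r - + k * + r) (ℤ÷.a≡a%ℕn+[a/ℕn]*n (_∣_.quotient r∣δ1) m))
          (trans (cancel (+ k) s (+ m) (+ r)) (cong (s *_) (sym +M≡))))))
        where
        s = _∣_.quotient r∣δ1 ℤ÷./ℕ m
        cancel : ∀ k s m r → (k + s * m) * r - k * r ≡ s * (m * r)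
        cancel = solve-∀
      reorder : ∀ v k r → v * (k * r) ≡ k * v * r
      reorder = solve-∀
      scaled : ∀ v → + k * + (v % m) * + r ≡ + k * + v * + r mod[ M ]
      scaled v = mod-sym (congruent (divides (+ k * + (v ℕ./ m)) (trans
        (cong (λ t → + k * t * + r - + k * + (v % m) * + r) (trans (cong +_ (ℕ÷.m≡m%n+[m/n]*n v m))
          (trans (ℤₚ.pos-+ (v % m) _) (cong (λ u → + (v % m) + u) (ℤₚ.pos-* (v ℕ./ m) m)))))
        (trans (cancel (+ k) (+ (v % m)) (+ (v ℕ./ m)) (+ m) (+ r)) (cong (+ k * + (v ℕ./ m) *_) (sym +M≡))))))
        where
        cancel : ∀ k a s m r → k * (a + s * m) * r - k * a * r ≡ k * s * (m * r)
        cancel = solve-∀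

-- The choice of M, and the two isomorphisms.

open import Level using (0ℓ)
open import Data.Nat.Divisibility using (m%n≡0⇒n∣m) renaming (_∣_ to _ℕ∣_)
open import Data.Nat.Coprimality using (Coprime; coprime-divisor)
open import Data.Nat.Primality using (prime⇒nonTrivial)
open import Data.Integer as ℤ using (ℤ; +_)
open import Data.Integer.Tactic.RingSolver using (solve-∀)
open import Data.Product using (∃; _×_; _,_)
open import Relation.Binary.PropositionalEquality
open SelfDuality
open CirculantAlgebra using (toℕ-mod; %-cancelʳ-+)
open RootExtensions
open RootsAndCongruences
open UnitLogarithms
open Lattices
open LatticeRelations

coprime-^-divisor : ∀ {m q} → Coprime m q → ∀ i {x} → m ℕ∣ q ℕ.^ i ℕ.* x → m ℕ∣ x
coprime-^-divisor {m} {q} c zero {x} p = subst (m ℕ∣_) (ℕₚ.+-identityʳ x) p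
coprime-^-divisor {m} {q} c (suc i) {x} p = coprime-^-divisor c i
  (coprime-divisor c (subst (m ℕ∣_) (ℕₚ.*-assoc q (q ℕ.^ i) x) p))

primePower>1 : ∀ {q} → IsPrimePower q → 1 ℕ.< q
primePower>1 (p , suc k , pr , _ , refl) = ℕₚ.<-≤-trans p>1 (ℕₚ.m≤m*n p (p ℕ.^ k) {{ℕₚ.m^n≢0 p k {{ℕ.>-nonZero (ℕₚ.<⇒≤ p>1)}}}})
  where p>1 = ℕ.nonTrivial⇒n>1 p {{prime⇒nonTrivial pr}}

-- Two of the m + 1 powers q^0, ..., q^m agree modulo m, and coprimality cancels the smaller one.
-- The exponent d + 1 is the one so found; minimality is not claimed.
multiplicativeOrder : ∀ m .{{_ : NonZero m}} {q} → Coprime m q → 1 ℕ.< q →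
  ∃ λ d → ∃ λ M → ∃ λ r → (q ℕ.^ suc d ≡ suc M) × (M ≡ r ℕ.* m) × NonZero M × NonZero r
multiplicativeOrder m {q} coprime 1<q
  with Finₚ.pigeonhole (ℕₚ.n<1+n m) (λ (i : Fin (suc m)) → (q ℕ.^ toℕ i) ℕ÷.mod m)
... | i , j , i<j , same = let d , eq = ℕₚ.m≤n⇒∃[o]m+o≡n i<j in build (d , trans (ℕₚ.+-suc (toℕ i) d) eq)
  where
  instance
    q-nonZero : NonZero q
    q-nonZero = ℕ.>-nonZero (ℕₚ.<⇒≤ 1<q)
  build : (∃ λ d → toℕ i ℕ.+ suc d ≡ toℕ j) →
    ∃ λ d → ∃ λ M → ∃ λ r → (q ℕ.^ suc d ≡ suc M) × (M ≡ r ℕ.* m) × NonZero M × NonZero r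
  build (d , i+1+d≡j) = d , M , quotient , q^1+d≡1+M , equality , M-nonZero , r-nonZero
    where
    M = ℕ.pred (q ℕ.^ suc d)
    q^1+d≡1+M : q ℕ.^ suc d ≡ suc M
    q^1+d≡1+M = sym (ℕₚ.suc-pred (q ℕ.^ suc d) {{ℕₚ.m^n≢0 q (suc d)}})
    M-nonZero : NonZero M
    M-nonZero = ℕ.>-nonZero (ℕₚ.≤-pred (subst (1 ℕ.<_) q^1+d≡1+M
      (ℕₚ.<-≤-trans 1<q (ℕₚ.m≤m*n q (q ℕ.^ d) {{ℕₚ.m^n≢0 q d}}))))
    Q = q ℕ.^ toℕ i
    q^j≡ : q ℕ.^ toℕ j ≡ Q ℕ.* M ℕ.+ Q
    q^j≡ = trans (cong (q ℕ.^_) (sym i+1+d≡j)) (trans (ℕₚ.^-distribˡ-+-* q (toℕ i) (suc d))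
      (trans (cong (Q ℕ.*_) q^1+d≡1+M) (trans (ℕₚ.*-suc Q M) (ℕₚ.+-comm Q _))))
    m∣M : m ℕ∣ M
    m∣M = coprime-^-divisor coprime (toℕ i) (m%n≡0⇒n∣m (Q ℕ.* M) m (trans (%-cancelʳ-+ m Q (trans (cong (_% m) (sym q^j≡))
      (trans (sym (toℕ-mod (q ℕ.^ toℕ j) m)) (trans (cong toℕ (sym same)) (toℕ-mod Q m))))) (ℕ÷.m*n%n≡0 0 m)))
    open _ℕ∣_ m∣M
    r-nonZero : NonZero quotient
    r-nonZero = ℕₚ.m*n≢0⇒m≢0 quotient {{subst NonZero equality M-nonZero}}

module Isomorphisms {c ℓ} (F : CommutativeRing c ℓ) (F-field : IsField F) {q : ℕ}
  (enum : Bijection (setoid (Fin q)) (CommutativeRing.setoid F)) (q-primePower : IsPrimePower q)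
  (n d M r : ℕ) .{{_ : NonZero M}} .{{_ : NonZero r}} (q^1+d≡1+M : q ℕ.^ suc d ≡ suc M) (M≡rm : M ≡ r ℕ.* suc n)
  (extension : RootExtension F M) where

  private
    m = suc n
  open Circulant F m using (_≈P_; _≈X_; _*P_; xpow; InC')
  open IntLattice m q using (ε; f; InZ; _≈Σ_; _≈S_; _+Z_)
  open Lattice n q
  open Relations n q d M r q^1+d≡1+M M≡rm
  open UnitLogarithm F F-field enum q-primePower m d M r q^1+d≡1+M M≡rm
    extension

  -- The coordinate vectors record b only at 1, ..., m - 1; the value at 0 and periodicity supply
  -- the rest.
  determined : ∀ {b b′} → Compatible m q M b → Compatible m q M b′ →
    (∀ (i : Fin n) → b (suc (toℕ i)) ≡ b′ (suc (toℕ i)) mod[ M ]) → ∀ v → b v ≡ b′ v mod[ M ]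
  determined {b} {b′} c c′ same v = mod-trans (mod-sym (C.periodic v)) (mod-trans (at (v ℕ÷.mod m) (toℕ-mod v m)) (C′.periodic v))
    where
    module C = Compatible c
    module C′ = Compatible c′
    at : ∀ (i : Fin m) → toℕ i ≡ v % m → b (v % m) ≡ b′ (v % m) mod[ M ]
    at zero eq = subst (λ t → b t ≡ b′ t mod[ M ]) eq (mod-trans C.at-zero (mod-sym C′.at-zero))
    at (suc i) eq = subst (λ t → b t ≡ b′ t mod[ M ]) eq (same i)

  log-*xpow : ∀ {b} → InC' b → ∀ k v → log (b *P xpow k) v ≡ log b v ℤ.+ + (k ℕ.* v ℕ.* r) mod[ M ]
  log-*xpow {b} b∈ k v = mod-trans (log-* {b} {xpow k} b∈ (xpow∈ k) (*P-closed {b} {xpow k} b∈ (xpow∈ k)) v)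
    (mod-+ (mod-refl {a = log b v}) (log-xpow k (xpow∈ k) v))

  restrict-mod : ∀ {b b′} → (∀ v → b v ≡ b′ v mod[ M ]) → ∀ v → restrict b v ≡ restrict b′ v mod[ M ]
  restrict-mod eq v = mod-- (mod-- (eq (suc v)) (eq v)) (eq 1)

  restrict-+ : ∀ {b b₁ b₂} → (∀ v → b v ≡ b₁ v ℤ.+ b₂ v mod[ M ]) → ∀ v → restrict b v ≡ restrict b₁ v ℤ.+ restrict b₂ v mod[ M ]
  restrict-+ {b} {b₁} {b₂} eq v = mod-trans (restrict-mod {b} {λ v → b₁ v ℤ.+ b₂ v} eq v)
    (mod-reflexive (regroup (b₁ (suc v)) (b₂ (suc v)) (b₁ v) (b₂ v) (b₁ 1) (b₂ 1)))
    where
    regroup : ∀ a a′ b b′ c c′ → a ℤ.+ a′ ℤ.- (b ℤ.+ b′) ℤ.- (c ℤ.+ c′) ≡ a ℤ.- b ℤ.- c ℤ.+ (a′ ℤ.- b′ ℤ.- c′)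
    regroup = solve-∀

  restrict-cong : ∀ {b b′ k} → (∀ v → b v ≡ b′ v ℤ.+ + (k ℕ.* v ℕ.* r) mod[ M ]) → ∀ v → restrict b v ≡ restrict b′ v mod[ M ]
  restrict-cong {b} {b′} {k} eq v = mod-trans (restrict-+ {b} {b′} {λ v → + (k ℕ.* v ℕ.* r)} eq v)
    (mod-reflexive (trans (cong (λ t → restrict b′ v ℤ.+ t) vanish) (ℤₚ.+-identityʳ _)))
    where
    linear : ∀ v → + (k ℕ.* v ℕ.* r) ≡ + k ℤ.* + v ℤ.* + r
    linear v = trans (ℤₚ.pos-* (k ℕ.* v) r) (cong (ℤ._* + r) (ℤₚ.pos-* k v))
    cancel : ∀ k v r → k ℤ.* (+ 1 ℤ.+ v) ℤ.* r ℤ.- k ℤ.* v ℤ.* r ℤ.- k ℤ.* + 1 ℤ.* r ≡ + 0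
    cancel = solve-∀
    vanish : + (k ℕ.* suc v ℕ.* r) ℤ.- + (k ℕ.* v ℕ.* r) ℤ.- + (k ℕ.* 1 ℕ.* r) ≡ + 0
    vanish = trans (cong₂ ℤ._-_ (cong₂ ℤ._-_ (trans (linear (suc v)) (cong (λ t → + k ℤ.* t ℤ.* + r) (ℤₚ.pos-+ 1 v))) (linear v)) (linear 1))
      (cancel (+ k) (+ v) (+ r))

  -- The common end of both surjectivity proofs: Y reads off the values of b itself for Σ, and those
  -- of its restriction for S.
  unit-with-log : (Y : (ℕ → ℤ) → Fin n → ℤ) → (∀ {b b′ : ℕ → ℤ} → (∀ v → b v ≡ b′ v mod[ M ]) → ∀ i → Y b i ≡ Y b′ i mod[ M ]) →
    ∀ {y : Fin n → ℤ} → (∃ λ b → Compatible m q M b × ∀ i → Y b i ≡ y i) → ∃ λ a → InC' a × ∀ i → Y (log a) i ≡ y i mod[ M ]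
  unit-with-log Y Y-mod {y} (b , b-compatible , Yb≡y) = through (log-surjective {b} b-compatible)
    where
    through : (∃ λ a → InC' a × ∀ v → log a v ≡ b v mod[ M ]) → ∃ λ a → InC' a × ∀ i → Y (log a) i ≡ y i mod[ M ]
    through (a , a∈ , log≡b) = a , a∈ , λ i → mod-trans (Y-mod {log a} {b} log≡b i) (mod-reflexive (Yb≡y i))

  log-kernel : ∀ {a b} → InC' a → InC' b → (∃ λ k → ∀ v → log a v ≡ log b v ℤ.+ + (k ℕ.* v ℕ.* r) mod[ M ]) → a ≈X b
  log-kernel {a} {b} a∈ b∈ (k , kernel) = k , log-injective {a} {b *P xpow k} a∈ (*P-closed {b} {xpow k} b∈ (xpow∈ k))
    (λ v → mod-trans (kernel v) (mod-sym (log-*xpow {b} b∈ k v)))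

  InC'≅Σ : Isomorphic InC' _≈P_ _*P_ InZ _≈Σ_ _+Z_
  InC'≅Σ = isomorphism {P = InC'} {_≈P_} {_*P_} ε ε-total M ε-kills (λ a i → log a (suc (toℕ i)))
    (λ {a} a∈ → ε-dual {log a} (log-compatible {a} a∈))
    (λ {a} {b} → *P-closed {a} {b})
    (λ {a} {b} a∈ b∈ a≈b i → log-cong {a} {b} a∈ b∈ a≈b (suc (toℕ i)))
    (λ {a} {b} a∈ b∈ i → log-* {a} {b} a∈ b∈ (*P-closed {a} {b} a∈ b∈) (suc (toℕ i)))
    (λ {a} {b} a∈ b∈ same → log-injective {a} {b} a∈ b∈ (determined {log a} {log b} (log-compatible {a} a∈) (log-compatible {b} b∈) same))
    (λ {y} y∈ → unit-with-log (λ b i → b (suc (toℕ i))) (λ {b} {b′} eq i → eq (suc (toℕ i))) (ε-dual-surjective {y} y∈))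

  InC'/X≅S : Isomorphic InC' _≈X_ _*P_ InZ _≈S_ _+Z_
  InC'/X≅S = isomorphism {P = InC'} {_≈X_} {_*P_} f f-total M f-kills (λ a i → restrict (log a) (suc (toℕ i)))
    (λ {a} a∈ → f-dual {log a} (log-compatible {a} a∈))
    (λ {a} {b} → *P-closed {a} {b})
    (λ {a} {b} a∈ b∈ (k , a≈bxᵏ) i → restrict-cong {log a} {log b} {k} (λ v → mod-trans
      (log-cong {a} {b *P xpow k} a∈ (*P-closed {b} {xpow k} b∈ (xpow∈ k)) a≈bxᵏ v) (log-*xpow {b} b∈ k v)) (suc (toℕ i)))
    (λ {a} {b} a∈ b∈ i → restrict-+ {log (a *P b)} {log a} {log b} (log-* {a} {b} a∈ b∈ (*P-closed {a} {b} a∈ b∈)) (suc (toℕ i)))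
    (λ {a} {b} a∈ b∈ same → log-kernel {a} {b} a∈ b∈ (restrict-kernel {log a} {log b} (log-compatible {a} a∈) (log-compatible {b} b∈) same))
    (λ {y} y∈ → unit-with-log (λ b i → restrict b (suc (toℕ i))) (λ {b} {b′} eq i → restrict-mod {b} {b′} eq (suc (toℕ i))) (f-dual-surjective {y} y∈))

theorem6p1 : (q : ℕ) → IsPrimePower q →
    (F : CommutativeRing 0ℓ 0ℓ) → IsField F →
    Bijection (setoid (Fin q)) (CommutativeRing.setoid F) →
    (m : ℕ) .{{_ : NonZero m}} → Coprime m q →
    Isomorphic (Circulant.InC' F m) (Circulant._≈P_ F m) (Circulant._*P_ F m)
    (IntLattice.InZ m q) (IntLattice._≈Σ_ m q) (IntLattice._+Z_ m q)
    × Isomorphic (Circulant.InC' F m) (Circulant._≈X_ F m) (Circulant._*P_ F m)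
    (IntLattice.InZ m q) (IntLattice._≈S_ m q) (IntLattice._+Z_ m q)
theorem6p1 q q-primePower F F-field enum zero _ = contradiction refl (ℕ.≢-nonZero⁻¹ 0)
theorem6p1 q q-primePower F F-field enum m@(suc n) coprime =
  from-order (multiplicativeOrder m coprime (primePower>1 q-primePower))
  where
  from-order : (∃ λ d → ∃ λ M → ∃ λ r → (q ℕ.^ suc d ≡ suc M) × (M ≡ r ℕ.* m) × NonZero M × NonZero r) → _
  from-order (d , M , r , q^1+d≡1+M , M≡rm , M-nonZero , r-nonZero) =
    Isomorphisms.InC'≅Σ F F-field enum q-primePower n d M r {{M-nonZero}} {{r-nonZero}} q^1+d≡1+M M≡rm extension ,
    Isomorphisms.InC'/X≅S F F-field enum q-primePower n d M r {{M-nonZero}} {{r-nonZero}} q^1+d≡1+M M≡rm extension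
    where
    extension = Extension.rootExtension F F-field enum q-primePower (suc d) M {{M-nonZero}} q^1+d≡1+M
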